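{- Let $\mathcal{F}:\mathcal{C}\to\Omega$ be a quasi-Fitting invariant. Then there is a unique family $\{\mathcal{F}^{\langle n\rangle}:\mathcal{M}\to\Omega\}_{n\in\mathbb{Z}}$ of maps satisfying the following: \begin{itemize} \item $\mathcal{F}^{\langle0\rangle}$ is an extension of $\mathcal{F}:\mathcal{C}\to\Omega$. \item If $P\in\mathcal{Q}$, then $\mathcal{F}^{\langle n\rangle}(P)\in\Omega^\times$ for any $n\in\mathbb{Z}$. \item If $0\to N\to P\to M\to0$ is an exact sequence in $\mathcal{M}$ with $P\in\mathcal{Q}$, then $\mathcal{F}^{\langle n\rangle}(M)=\mathcal{F}^{\langle n\rangle}(P)\mathcal{F}^{\langle n-1\rangle}(N)$ for any $n\in\mathbb{Z}$. \item If $0\to M'\to M\to P\to0$ is an exact sequence in $\mathcal{M}$ with $P\in\mathcal{Q}$, then $\mathcal{F}^{\langle n\rangle}(M)=\mathcal{F}^{\langle n\rangle}(P)\mathcal{F}^{\langle n\rangle}(M')$ for any $n\in\mathbb{Z}$. \item If $0\to P\to M\to M'\to0$ is an exact sequence in $\mathcal{M}$ with $P\in\mathcal{Q}$, then $\mathcal{F}^{\langle n\rangle}(M)=\mathcal{F}^{\langle n\rangle}(P)\mathcal{F}^{\langle n\rangle}(M')$ for any $n\in\mathbb{Z}$. \end{itemize}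
   Context: $R$ is a (not necessarily commutative) left and right noetherian ring with unity, and $S$ is an Ore set of $R$ consisting of non-zero-divisors: $1\in S$; $S$ is closed under multiplication; for $f\in S$, $a\in R$ one has $fR\cap aS\ne\emptyset$ and $Rf\cap Sa\ne\emptyset$. Put $E^i_R(M)=\mathrm{Ext}^i_R(M,R)$ and $\mathrm{pd}^\star_R(M)=\sup\{i\in\mathbb Z\mid E^i_R(M)\ne0\}$. It is assumed that there is an integer $d(R)$ with $\mathrm{pd}^\star_R(M)\le d(R)$ for every finitely generated left or right $R$-module $M$. $\mathcal M$ is the category of finitely generated $S$-torsion left $R$-modules ($S$-torsion: every element is annihilated by an element of $S$); $\mathcal C=\{M\in\mathcal M\mid\mathrm{pd}^\star_R(M)\le1\}$; $\mathcal P=\{P\in\mathcal M\mid\mathrm{pd}_R(P)\le1\}$; $\mathcal Q=\{M\in\mathcal M\mid\mathrm{pd}_R(M)<\infty\}$ (the zero module has $\mathrm{pd}_R=-\infty$). A quasi-Fitting invariant is a map $\mathcal F$ assigning to each object of $\mathcal C$ an element of a commutative monoid $\Omega$ such that: (i) $\mathcal F(P)\in\Omega^\times$ for $P\in\mathcal P$; (ii) if $0\to M'\to M\to P\to0$ is exact in $\mathcal C$ with $P\in\mathcal P$, then $\mathcal F(M)=\mathcal F(P)\mathcal F(M')$; (iii) if $0\to P\to M\to M'\to0$ is exact in $\mathcal C$ with $P\in\mathcal P$, then $\mathcal F(M)=\mathcal F(P)\mathcal F(M')$. -}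

module Defs where

open import Algebra.Bundles using (Ring; AbelianGroup; CommutativeMonoid)
open import Algebra.Module.Bundles using (LeftModule)
open import Algebra.Module.Morphism.Structures using (module LeftModuleMorphisms)
open import Data.Integer.Base as ℤ using (ℤ; +_; 0ℤ; 1ℤ)
open import Data.Nat.Base using (ℕ; zero; suc)
open import Data.Product using (Σ; ∃; _×_; _,_; proj₁; proj₂)
open import Data.Vec.Functional using (Vector)
open import Function.Definitions using (Injective; Surjective)
open import Level using (Level; _⊔_) renaming (suc to lsuc)
open import Relation.Binary.Definitions using (_Respects_)
open import Relation.Unary using (Pred; _∈_)

import Algebra.Construct.Flip.Op as Op
import Algebra.Definitions as AlgebraicDefinitions
import Algebra.Definitions.RawMonoid as RawMonoidDefinitions
import Algebra.Module.Construct.TensorUnit as TensorUnit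
import Algebra.Module.Morphism.Construct.Composition as Composition
import Algebra.Module.Morphism.LeftModuleMonomorphism as Monomorphism
import Algebra.Properties.AbelianGroup as AbelianGroupProperties
import Algebra.Properties.CommutativeSemigroup as CommutativeSemigroupProperties
import Relation.Binary.Reasoning.Setoid as SetoidReasoning

-- Module theory over a fixed ring.  Everything is stated for left modules;
-- right R-modules are the left modules over the opposite ring `Op.ring R`.

module Homological {ℓ : Level} (R : Ring ℓ ℓ) where

  open Ring R using (Carrier; _≈_; _+_; _*_; 0#; 1#; -_)
  open LeftModule

  Mod : Set (lsuc ℓ)
  Mod = LeftModule R ℓ ℓ

  ∣_∣ : Mod → Set ℓ
  ∣ M ∣ = Carrierᴹ M

  regular : Mod
  regular = TensorUnit.leftModule {R = R}

  record Hom (M N : Mod) : Set ℓ where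
    open LeftModuleMorphisms (rawLeftModule M) (rawLeftModule N)
    field
      ⟦_⟧                      : ∣ M ∣ → ∣ N ∣
      isLeftModuleHomomorphism : IsLeftModuleHomomorphism ⟦_⟧
    open IsLeftModuleHomomorphism isLeftModuleHomomorphism public

  open Hom using (⟦_⟧)

  infixr 9 _∘ʰ_
  _∘ʰ_ : ∀ {L M N} → Hom M N → Hom L M → Hom L N
  _∘ʰ_ {N = N} g f = record
    { ⟦_⟧ = λ x → ⟦ g ⟧ (⟦ f ⟧ x)
    ; isLeftModuleHomomorphism = Composition.isLeftModuleHomomorphism
        (≈ᴹ-trans N) (Hom.isLeftModuleHomomorphism f) (Hom.isLeftModuleHomomorphism g)
    }

  IsInjective : ∀ {M N} → Hom M N → Set ℓ
  IsInjective {M} {N} f = Injective (_≈ᴹ_ M) (_≈ᴹ_ N) ⟦ f ⟧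

  IsSurjective : ∀ {M N} → Hom M N → Set ℓ
  IsSurjective {M} {N} f = Surjective (_≈ᴹ_ M) (_≈ᴹ_ N) ⟦ f ⟧

  Exact : ∀ {L M N} → Hom L M → Hom M N → Set ℓ
  Exact {L} {M} {N} f g =
    (∀ x → _≈ᴹ_ N (⟦ g ⟧ (⟦ f ⟧ x)) (0ᴹ N)) ×
    (∀ y → _≈ᴹ_ N (⟦ g ⟧ y) (0ᴹ N) → ∃ λ x → _≈ᴹ_ M (⟦ f ⟧ x) y)

  record ShortExact (L M N : Mod) : Set ℓ where
    field
      f          : Hom L M
      g          : Hom M N
      injective  : IsInjective f
      exact      : Exact f g
      surjective : IsSurjective g

  IsZero : AbelianGroup ℓ ℓ → Set ℓ
  IsZero A = ∀ x → x A.≈ A.ε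
    where module A = AbelianGroup A

  IsZeroᴹ : Mod → Set ℓ
  IsZeroᴹ M = IsZero (+ᴹ-abelianGroup M)

  linearCombination : ∀ (M : Mod) {n} → Vector Carrier n → Vector ∣ M ∣ n → ∣ M ∣
  linearCombination M c x = sum (λ i → _*ₗ_ M (c i) (x i))
    where open RawMonoidDefinitions (+ᴹ-rawMonoid M) using (sum)

  FinitelyGenerated : Mod → Set ℓ
  FinitelyGenerated M = ∃ λ n → Σ (Vector ∣ M ∣ n) λ x →
    ∀ m → ∃ λ c → _≈ᴹ_ M (linearCombination M c x) m

  record IsLeftIdeal (I : Pred Carrier ℓ) : Set ℓ where
    field
      resp     : I Respects _≈_
      0∈       : 0# ∈ I
      +-closed : ∀ {a b} → a ∈ I → b ∈ I → a + b ∈ I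
      *-closed : ∀ r {a} → a ∈ I → r * a ∈ I

  -- As ideals are arbitrary predicates, this is the classical notion: for a
  -- proposition A, finite generation of { x | x = 0 or A } already yields
  -- A or (A → 1 = 0).
  LeftNoetherian : Set (lsuc ℓ)
  LeftNoetherian = ∀ (I : Pred Carrier ℓ) → IsLeftIdeal I →
    ∃ λ n → Σ (Vector Carrier n) λ x → (∀ i → x i ∈ I) ×
      (∀ {a} → a ∈ I → ∃ λ c → linearCombination regular c x ≈ a)

  Projective : Mod → Set (lsuc ℓ)
  Projective P = ∀ {X Y : Mod} (g : Hom X Y) → IsSurjective g → (f : Hom P Y) →
    Σ (Hom P X) λ h → ∀ x → _≈ᴹ_ Y (⟦ g ⟧ (⟦ h ⟧ x)) (⟦ f ⟧ x)

  record ProjectiveResolution (M : Mod) : Set (lsuc ℓ) where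
    field
      P          : ℕ → Mod
      projective : ∀ n → Projective (P n)
      d          : ∀ n → Hom (P (suc n)) (P n)
      ε          : Hom (P 0) M
      ε-surj     : IsSurjective ε
      exact₀     : Exact (d 0) ε
      exact      : ∀ n → Exact (d (suc n)) (d n)

  -- pd M ≤ k.  The bound ranges over ℤ so that pd 0 = -∞ is accommodated.
  pd_≤_ : Mod → ℤ → Set (lsuc ℓ)
  pd M ≤ k = Σ (ProjectiveResolution M) λ P• →
    ∀ i → k ℤ.< + i → IsZeroᴹ (ProjectiveResolution.P P• i)

  FinitePd : Mod → Set (lsuc ℓ)
  FinitePd M = ∃ λ k → pd M ≤ k

  mkHom : ∀ (M N : Mod) (h : ∣ M ∣ → ∣ N ∣) →
          (∀ {x y} → _≈ᴹ_ M x y → _≈ᴹ_ N (h x) (h y)) →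
          (∀ x y → _≈ᴹ_ N (h (_+ᴹ_ M x y)) (_+ᴹ_ N (h x) (h y))) →
          (∀ r x → _≈ᴹ_ N (h (_*ₗ_ M r x)) (_*ₗ_ N r (h x))) →
          Hom M N
  mkHom M N h cong add scale = record
    { ⟦_⟧ = h
    ; isLeftModuleHomomorphism = record
      { +ᴹ-isGroupHomomorphism = record
        { isMonoidHomomorphism = record
          { isMagmaHomomorphism = record
            { isRelHomomorphism = record { cong = cong }
            ; homo = add
            }
          ; ε-homo = h0
          }
        ; ⁻¹-homo = λ x → inverseˡ-unique (h (M.-ᴹ x)) (h x)
            (N.≈ᴹ-trans (N.≈ᴹ-sym (add (M.-ᴹ x) x))
              (N.≈ᴹ-trans (cong (M.-ᴹ‿inverseˡ x)) h0))
        }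
      ; *ₗ-homo = scale
      }
    }
    where
    module M = LeftModule M
    module N = LeftModule N
    open AbelianGroupProperties N.+ᴹ-abelianGroup using (inverseˡ-unique)
    h0 : h M.0ᴹ N.≈ᴹ N.0ᴹ
    h0 = N.≈ᴹ-trans (cong (M.≈ᴹ-sym (M.*ₗ-zeroˡ M.0ᴹ)))
           (N.≈ᴹ-trans (scale 0# M.0ᴹ) (N.*ₗ-zeroˡ (h M.0ᴹ)))

  module _ {M N : Mod} (f : Hom M N) where

    private
      module M = LeftModule M
      module N = LeftModule N
      module f = Hom f
      K : Set ℓ
      K = Σ M.Carrierᴹ λ x → f.⟦ x ⟧ N.≈ᴹ N.0ᴹ

      add : K → K → K
      add (x , p) (y , q) = x M.+ᴹ y ,
        N.≈ᴹ-trans (f.+ᴹ-homo x y) (N.≈ᴹ-trans (N.+ᴹ-cong p q) (N.+ᴹ-identityˡ N.0ᴹ))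

      scale : Carrier → K → K
      scale r (x , p) = r M.*ₗ x ,
        N.≈ᴹ-trans (f.*ₗ-homo r x) (N.≈ᴹ-trans (N.*ₗ-congˡ p) (N.*ₗ-zeroʳ r))

      neg : K → K
      neg (x , p) = M.-ᴹ x ,
        N.≈ᴹ-trans (f.-ᴹ-homo x) (N.≈ᴹ-trans (N.-ᴹ‿cong p) ε⁻¹≈ε)
        where open AbelianGroupProperties N.+ᴹ-abelianGroup using (ε⁻¹≈ε)

    kernel : Mod
    kernel = record
      { Carrierᴹ = K
      ; _≈ᴹ_ = λ x y → proj₁ x M.≈ᴹ proj₁ y
      ; _+ᴹ_ = add
      ; _*ₗ_ = scale
      ; 0ᴹ = M.0ᴹ , f.0ᴹ-homo
      ; -ᴹ_ = neg
      ; isLeftModule = Monomorphism.isLeftModule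
          {M = record { _≈ᴹ_ = λ x y → proj₁ x M.≈ᴹ proj₁ y ; _+ᴹ_ = add ; _*ₗ_ = scale
                      ; 0ᴹ = M.0ᴹ , f.0ᴹ-homo ; -ᴹ_ = neg }}
          {N = M.rawLeftModule}
          (record
            { isLeftModuleHomomorphism = record
              { +ᴹ-isGroupHomomorphism = record
                { isMonoidHomomorphism = record
                  { isMagmaHomomorphism = record
                    { isRelHomomorphism = record { cong = λ e → e }
                    ; homo = λ _ _ → M.≈ᴹ-refl
                    }
                  ; ε-homo = M.≈ᴹ-refl
                  }
                ; ⁻¹-homo = λ _ → M.≈ᴹ-refl
                }
              ; *ₗ-homo = λ _ _ → M.≈ᴹ-refl
              }
            ; injective = λ e → e
            })
          (Ring.isRing R) M.isLeftModule
      }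

    kernel-inclusion : Hom kernel M
    kernel-inclusion = mkHom kernel M proj₁ (λ e → e) (λ _ _ → M.≈ᴹ-refl) (λ _ _ → M.≈ᴹ-refl)

  -- The free module on a set X: formal expressions in the elements of X,
  -- modulo the congruence generated by the module axioms.  This presentation
  -- needs no decidable equality on X.
  module _ (X : Set ℓ) where

    infixl 6 _⊕_
    infixr 7 _⊙_
    infix  8 ⊖_
    data Expr : Set ℓ where
      var : X → Expr
      _⊕_ : Expr → Expr → Expr
      _⊙_ : Carrier → Expr → Expr
      𝟘   : Expr
      ⊖_  : Expr → Expr

    infix 4 _≋_
    data _≋_ : Expr → Expr → Set ℓ where
      ≋-refl     : ∀ {x} → x ≋ x
      ≋-sym      : ∀ {x y} → x ≋ y → y ≋ x
      ≋-trans    : ∀ {x y z} → x ≋ y → y ≋ z → x ≋ z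
      ⊕-cong     : ∀ {x x′ y y′} → x ≋ x′ → y ≋ y′ → x ⊕ y ≋ x′ ⊕ y′
      ⊖-cong     : ∀ {x x′} → x ≋ x′ → ⊖ x ≋ ⊖ x′
      ⊙-cong     : ∀ {r r′ x x′} → r ≈ r′ → x ≋ x′ → r ⊙ x ≋ r′ ⊙ x′
      ⊕-assoc    : ∀ x y z → (x ⊕ y) ⊕ z ≋ x ⊕ (y ⊕ z)
      ⊕-comm     : ∀ x y → x ⊕ y ≋ y ⊕ x
      ⊕-idˡ      : ∀ x → 𝟘 ⊕ x ≋ x
      ⊖-invˡ     : ∀ x → ⊖ x ⊕ x ≋ 𝟘
      ⊙-zeroˡ    : ∀ x → 0# ⊙ x ≋ 𝟘
      ⊙-zeroʳ    : ∀ r → r ⊙ 𝟘 ≋ 𝟘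
      ⊙-idˡ      : ∀ x → 1# ⊙ x ≋ x
      ⊙-assoc    : ∀ r s x → (r * s) ⊙ x ≋ r ⊙ (s ⊙ x)
      ⊙-distribʳ : ∀ x r s → (r + s) ⊙ x ≋ r ⊙ x ⊕ s ⊙ x
      ⊙-distribˡ : ∀ r x y → r ⊙ (x ⊕ y) ≋ r ⊙ x ⊕ r ⊙ y

    free : Mod
    free = record
      { Carrierᴹ = Expr
      ; _≈ᴹ_ = _≋_
      ; _+ᴹ_ = _⊕_
      ; _*ₗ_ = _⊙_
      ; 0ᴹ = 𝟘
      ; -ᴹ_ = ⊖_
      ; isLeftModule = record
        { isLeftSemimodule = record
          { +ᴹ-isCommutativeMonoid = record
            { isMonoid = record
              { isSemigroup = record
                { isMagma = record
                  { isEquivalence = record { refl = ≋-refl ; sym = ≋-sym ; trans = ≋-trans }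
                  ; ∙-cong = ⊕-cong
                  }
                ; assoc = ⊕-assoc
                }
              ; identity = ⊕-idˡ , λ x → ≋-trans (⊕-comm x 𝟘) (⊕-idˡ x)
              }
            ; comm = ⊕-comm
            }
          ; isPreleftSemimodule = record
            { *ₗ-cong = ⊙-cong
            ; *ₗ-zeroˡ = ⊙-zeroˡ
            ; *ₗ-distribʳ = ⊙-distribʳ
            ; *ₗ-identityˡ = ⊙-idˡ
            ; *ₗ-assoc = ⊙-assoc
            ; *ₗ-zeroʳ = ⊙-zeroʳ
            ; *ₗ-distribˡ = ⊙-distribˡ
            }
          }
        ; -ᴹ‿cong = ⊖-cong
        ; -ᴹ‿inverse = ⊖-invˡ , λ x → ≋-trans (⊕-comm x (⊖ x)) (⊖-invˡ x)
        }
      }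

  module _ {X : Set ℓ} (N : Mod) (φ : X → ∣ N ∣) where

    private module N = LeftModule N

    eval : Expr X → ∣ N ∣
    eval (var x) = φ x
    eval (a ⊕ b) = eval a N.+ᴹ eval b
    eval (r ⊙ a) = r N.*ₗ eval a
    eval 𝟘       = N.0ᴹ
    eval (⊖ a)   = N.-ᴹ eval a

    eval-cong : ∀ {a b} → _≋_ X a b → eval a N.≈ᴹ eval b
    eval-cong ≋-refl             = N.≈ᴹ-refl
    eval-cong (≋-sym p)          = N.≈ᴹ-sym (eval-cong p)
    eval-cong (≋-trans p q)      = N.≈ᴹ-trans (eval-cong p) (eval-cong q)
    eval-cong (⊕-cong p q)       = N.+ᴹ-cong (eval-cong p) (eval-cong q)
    eval-cong (⊖-cong p)         = N.-ᴹ‿cong (eval-cong p)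
    eval-cong (⊙-cong r p)       = N.*ₗ-cong r (eval-cong p)
    eval-cong (⊕-assoc a b c)    = N.+ᴹ-assoc (eval a) (eval b) (eval c)
    eval-cong (⊕-comm a b)       = N.+ᴹ-comm (eval a) (eval b)
    eval-cong (⊕-idˡ a)          = N.+ᴹ-identityˡ (eval a)
    eval-cong (⊖-invˡ a)         = N.-ᴹ‿inverseˡ (eval a)
    eval-cong (⊙-zeroˡ a)        = N.*ₗ-zeroˡ (eval a)
    eval-cong (⊙-zeroʳ r)        = N.*ₗ-zeroʳ r
    eval-cong (⊙-idˡ a)          = N.*ₗ-identityˡ (eval a)
    eval-cong (⊙-assoc r s a)    = N.*ₗ-assoc r s (eval a)
    eval-cong (⊙-distribʳ a r s) = N.*ₗ-distribʳ (eval a) r s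
    eval-cong (⊙-distribˡ r a b) = N.*ₗ-distribˡ r (eval a) (eval b)

    free-rec : Hom (free X) N
    free-rec = mkHom (free X) N eval eval-cong (λ _ _ → N.≈ᴹ-refl) (λ _ _ → N.≈ᴹ-refl)

  free-unique : ∀ {X : Set ℓ} (N : Mod) (f g : Hom (free X) N) →
                (∀ x → _≈ᴹ_ N (⟦ f ⟧ (var x)) (⟦ g ⟧ (var x))) →
                ∀ a → _≈ᴹ_ N (⟦ f ⟧ a) (⟦ g ⟧ a)
  free-unique {X} N f g eq = go
    where
    module N = LeftModule N
    module f = Hom f
    module g = Hom g
    go : ∀ a → f.⟦ a ⟧ N.≈ᴹ g.⟦ a ⟧
    go (var x) = eq x
    go (a ⊕ b) = N.≈ᴹ-trans (f.+ᴹ-homo a b)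
                   (N.≈ᴹ-trans (N.+ᴹ-cong (go a) (go b)) (N.≈ᴹ-sym (g.+ᴹ-homo a b)))
    go (r ⊙ a) = N.≈ᴹ-trans (f.*ₗ-homo r a)
                   (N.≈ᴹ-trans (N.*ₗ-congˡ (go a)) (N.≈ᴹ-sym (g.*ₗ-homo r a)))
    go 𝟘       = N.≈ᴹ-trans f.0ᴹ-homo (N.≈ᴹ-sym g.0ᴹ-homo)
    go (⊖ a)   = N.≈ᴹ-trans (f.-ᴹ-homo a)
                   (N.≈ᴹ-trans (N.-ᴹ‿cong (go a)) (N.≈ᴹ-sym (g.-ᴹ-homo a)))

  free-projective : ∀ (X : Set ℓ) → Projective (free X)
  free-projective X {A} {B} g g-surj f = h , free-unique B (g ∘ʰ h) f
      (λ x → proj₂ (g-surj (⟦ f ⟧ (var x))) (≈ᴹ-refl A))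
    where
    h : Hom (free X) A
    h = free-rec A (λ x → proj₁ (g-surj (⟦ f ⟧ (var x))))

  -- The canonical free resolution of M: each syzygy is covered by the free
  -- module on its own underlying set.
  cover : ∀ M → Hom (free ∣ M ∣) M
  cover M = free-rec M (λ x → x)

  syzygy : Mod → ℕ → Mod
  syzygy M zero    = M
  syzygy M (suc n) = kernel (cover (syzygy M n))

  freeResolution : ∀ M → ProjectiveResolution M
  freeResolution M = record
    { P          = λ n → free ∣ syzygy M n ∣
    ; projective = λ n → free-projective ∣ syzygy M n ∣
    ; d          = λ n → kernel-inclusion (cover (syzygy M n)) ∘ʰ cover (syzygy M (suc n))
    ; ε          = cover M
    ; ε-surj     = cover-surj M
    ; exact₀     = (λ a → proj₂ (⟦ cover (syzygy M 1) ⟧ a)) ,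
                   (λ b p → var (b , p) , ≋-refl)
    ; exact      = λ n → (λ a → proj₂ (⟦ cover (syzygy M (suc (suc n))) ⟧ a)) ,
                         (λ b p → var (b , p) , ≋-refl)
    }
    where
    cover-surj : ∀ N → IsSurjective (cover N)
    cover-surj N y = var y , eval-cong N (λ x → x)

  module Cohomology {M : Mod} (P• : ProjectiveResolution M) (N : Mod) where

    open ProjectiveResolution P•

    private
      module N = LeftModule N
      open AbelianGroupProperties N.+ᴹ-abelianGroup
        using (⁻¹-∙-comm; ε⁻¹≈ε; inverseˡ-unique; x≈y⇒x∙y⁻¹≈ε)
      open CommutativeSemigroupProperties
        (CommutativeMonoid.commutativeSemigroup N.+ᴹ-commutativeMonoid) using (interchange)
      open SetoidReasoning N.≈ᴹ-setoid

      infixl 6 _-_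
      _-_ : ∣ N ∣ → ∣ N ∣ → ∣ N ∣
      x - y = x N.+ᴹ (N.-ᴹ y)

      *ₗ-neg : ∀ r x → (N.-ᴹ (r N.*ₗ x)) N.≈ᴹ (r N.*ₗ (N.-ᴹ x))
      *ₗ-neg r x = N.≈ᴹ-sym (inverseˡ-unique _ _ (begin
        (r N.*ₗ (N.-ᴹ x)) N.+ᴹ (r N.*ₗ x) ≈⟨ N.*ₗ-distribˡ r _ x ⟨
        r N.*ₗ ((N.-ᴹ x) N.+ᴹ x)          ≈⟨ N.*ₗ-congˡ (N.-ᴹ‿inverseˡ x) ⟩
        r N.*ₗ N.0ᴹ                       ≈⟨ N.*ₗ-zeroʳ r ⟩
        N.0ᴹ                              ∎))

    addʰ : ∀ {L} → Hom L N → Hom L N → Hom L N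
    addʰ {L} φ ψ = mkHom L N (λ x → φ.⟦ x ⟧ N.+ᴹ ψ.⟦ x ⟧)
      (λ e → N.+ᴹ-cong (φ.⟦⟧-cong e) (ψ.⟦⟧-cong e))
      (λ x y → N.≈ᴹ-trans (N.+ᴹ-cong (φ.+ᴹ-homo x y) (ψ.+ᴹ-homo x y))
                 (interchange φ.⟦ x ⟧ φ.⟦ y ⟧ ψ.⟦ x ⟧ ψ.⟦ y ⟧))
      (λ r x → N.≈ᴹ-trans (N.+ᴹ-cong (φ.*ₗ-homo r x) (ψ.*ₗ-homo r x))
                 (N.≈ᴹ-sym (N.*ₗ-distribˡ r φ.⟦ x ⟧ ψ.⟦ x ⟧)))
      where
      module φ = Hom φ
      module ψ = Hom ψ

    negʰ : ∀ {L} → Hom L N → Hom L N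
    negʰ {L} φ = mkHom L N (λ x → N.-ᴹ φ.⟦ x ⟧)
      (λ e → N.-ᴹ‿cong (φ.⟦⟧-cong e))
      (λ x y → N.≈ᴹ-trans (N.-ᴹ‿cong (φ.+ᴹ-homo x y)) (N.≈ᴹ-sym (⁻¹-∙-comm φ.⟦ x ⟧ φ.⟦ y ⟧)))
      (λ r x → N.≈ᴹ-trans (N.-ᴹ‿cong (φ.*ₗ-homo r x)) (*ₗ-neg r φ.⟦ x ⟧))
      where module φ = Hom φ

    zeroʰ : ∀ {L} → Hom L N
    zeroʰ {L} = mkHom L N (λ _ → N.0ᴹ) (λ _ → N.≈ᴹ-refl)
      (λ _ _ → N.≈ᴹ-sym (N.+ᴹ-identityˡ N.0ᴹ)) (λ r _ → N.≈ᴹ-sym (N.*ₗ-zeroʳ r))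

    IsCocycle : ∀ i → Hom (P i) N → Set ℓ
    IsCocycle i φ = ∀ x → ⟦ φ ⟧ (⟦ d i ⟧ x) N.≈ᴹ N.0ᴹ

    IsCoboundary : ∀ i → (∣ P i ∣ → ∣ N ∣) → Set ℓ
    IsCoboundary zero    χ = ∀ x → χ x N.≈ᴹ N.0ᴹ
    IsCoboundary (suc i) χ = Σ (Hom (P i) N) λ θ → ∀ x → χ x N.≈ᴹ ⟦ θ ⟧ (⟦ d i ⟧ x)

    private
      cob-ext : ∀ i {χ χ′} → (∀ x → χ x N.≈ᴹ χ′ x) → IsCoboundary i χ → IsCoboundary i χ′
      cob-ext zero    e p       = λ x → N.≈ᴹ-trans (N.≈ᴹ-sym (e x)) (p x)
      cob-ext (suc i) e (θ , p) = θ , λ x → N.≈ᴹ-trans (N.≈ᴹ-sym (e x)) (p x)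

      cob-0 : ∀ i {χ} → (∀ x → χ x N.≈ᴹ N.0ᴹ) → IsCoboundary i χ
      cob-0 zero    e = e
      cob-0 (suc i) e = zeroʰ , e

      cob-+ : ∀ i {χ χ′} → IsCoboundary i χ → IsCoboundary i χ′ →
              IsCoboundary i (λ x → χ x N.+ᴹ χ′ x)
      cob-+ zero    p       q       =
        λ x → N.≈ᴹ-trans (N.+ᴹ-cong (p x) (q x)) (N.+ᴹ-identityˡ N.0ᴹ)
      cob-+ (suc i) (θ , p) (η , q) = addʰ θ η , λ x → N.+ᴹ-cong (p x) (q x)

      cob-neg : ∀ i {χ} → IsCoboundary i χ → IsCoboundary i (λ x → N.-ᴹ χ x)
      cob-neg zero    p       = λ x → N.≈ᴹ-trans (N.-ᴹ‿cong (p x)) ε⁻¹≈ε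
      cob-neg (suc i) (θ , p) = negʰ θ , λ x → N.-ᴹ‿cong (p x)

      neg-sub : ∀ x y → (N.-ᴹ (x - y)) N.≈ᴹ (y - x)
      neg-sub = ⁻¹-anti-homo‿-
        where open AbelianGroupProperties N.+ᴹ-abelianGroup using (⁻¹-anti-homo‿-)

      sub-sub : ∀ x y z → ((x - y) N.+ᴹ (y - z)) N.≈ᴹ (x - z)
      sub-sub x y z = begin
        (x - y) N.+ᴹ (y - z)               ≈⟨ N.+ᴹ-assoc x (N.-ᴹ y) (y - z) ⟩
        x N.+ᴹ ((N.-ᴹ y) N.+ᴹ (y - z))     ≈⟨ N.+ᴹ-congˡ (N.+ᴹ-assoc (N.-ᴹ y) y (N.-ᴹ z)) ⟨
        x N.+ᴹ (((N.-ᴹ y) N.+ᴹ y) - z)     ≈⟨ N.+ᴹ-congˡ (N.+ᴹ-congʳ (N.-ᴹ‿inverseˡ y)) ⟩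
        x N.+ᴹ (N.0ᴹ - z)                  ≈⟨ N.+ᴹ-congˡ (N.+ᴹ-identityˡ (N.-ᴹ z)) ⟩
        x - z                              ∎

      add-sub : ∀ x y z w → ((x - y) N.+ᴹ (z - w)) N.≈ᴹ ((x N.+ᴹ z) - (y N.+ᴹ w))
      add-sub x y z w = N.≈ᴹ-trans (interchange x (N.-ᴹ y) z (N.-ᴹ w))
        (N.+ᴹ-congˡ (⁻¹-∙-comm y w))

    -- H^i of the complex Hom(P•, N): cocycles, equal when they differ by a coboundary.
    H : ℕ → AbelianGroup ℓ ℓ
    H i = record
      { Carrier = Z
      ; _≈_ = _∼_
      ; _∙_ = _∙_
      ; ε = e
      ; _⁻¹ = inv
      ; isAbelianGroup = record
        { isGroup = record
          { isMonoid = record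
            { isSemigroup = record
              { isMagma = record
                { isEquivalence = record
                  { refl  = λ {φ} → pointwise {φ} {φ} λ _ → N.≈ᴹ-refl
                  ; sym   = λ {φ} {ψ} p → cob-ext i (λ x → neg-sub (at φ x) (at ψ x)) (cob-neg i p)
                  ; trans = λ {φ} {ψ} {χ} p q →
                      cob-ext i (λ x → sub-sub (at φ x) (at ψ x) (at χ x)) (cob-+ i p q)
                  }
                ; ∙-cong = λ {φ} {φ′} {ψ} {ψ′} p q →
                    cob-ext i (λ x → add-sub (at φ x) (at φ′ x) (at ψ x) (at ψ′ x)) (cob-+ i p q)
                }
              ; assoc = λ φ ψ χ → pointwise {(φ ∙ ψ) ∙ χ} {φ ∙ (ψ ∙ χ)}
                  λ x → N.+ᴹ-assoc (at φ x) (at ψ x) (at χ x)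
              }
            ; identity = (λ φ → pointwise {e ∙ φ} {φ} λ x → N.+ᴹ-identityˡ (at φ x))
                       , (λ φ → pointwise {φ ∙ e} {φ} λ x → N.+ᴹ-identityʳ (at φ x))
            }
          ; inverse = (λ φ → pointwise {inv φ ∙ φ} {e} λ x → N.-ᴹ‿inverseˡ (at φ x))
                    , (λ φ → pointwise {φ ∙ inv φ} {e} λ x → N.-ᴹ‿inverseʳ (at φ x))
          ; ⁻¹-cong = λ {φ} {ψ} p →
              cob-ext i (λ x → N.≈ᴹ-sym (⁻¹-∙-comm (at φ x) (N.-ᴹ (at ψ x)))) (cob-neg i p)
          }
        ; comm = λ φ ψ → pointwise {φ ∙ ψ} {ψ ∙ φ} λ x → N.+ᴹ-comm (at φ x) (at ψ x)
        }
      }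
      where
      Z : Set ℓ
      Z = Σ (Hom (P i) N) (IsCocycle i)

      at : Z → ∣ P i ∣ → ∣ N ∣
      at φ = ⟦ proj₁ φ ⟧

      _∼_ : Z → Z → Set ℓ
      φ ∼ ψ = IsCoboundary i (λ x → at φ x - at ψ x)

      pointwise : ∀ {φ ψ} → (∀ x → at φ x N.≈ᴹ at ψ x) → φ ∼ ψ
      pointwise eq = cob-0 i (λ x → x≈y⇒x∙y⁻¹≈ε (eq x))

      _∙_ : Z → Z → Z
      (φ , p) ∙ (ψ , q) = addʰ φ ψ , λ x →
        N.≈ᴹ-trans (N.+ᴹ-cong (p x) (q x)) (N.+ᴹ-identityˡ N.0ᴹ)

      e : Z
      e = zeroʰ , λ _ → N.≈ᴹ-refl

      inv : Z → Z
      inv (φ , p) = negʰ φ , λ x → N.≈ᴹ-trans (N.-ᴹ‿cong (p x)) ε⁻¹≈ε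

  Ext : ℕ → Mod → Mod → AbelianGroup ℓ ℓ
  Ext i M N = Cohomology.H (freeResolution M) N i

  E : ℕ → Mod → AbelianGroup ℓ ℓ
  E i M = Ext i M regular

  -- pd⋆ M ≤ k, i.e. k is an upper bound of { i | E i M ≠ 0 }, in the
  -- constructively meaningful form "E i M = 0 for all i > k".
  pd⋆_≤_ : Mod → ℤ → Set ℓ
  pd⋆ M ≤ k = ∀ i → k ℤ.< + i → IsZero (E i M)

Noetherian : ∀ {ℓ} → Ring ℓ ℓ → Set (lsuc ℓ)
Noetherian R = Homological.LeftNoetherian R × Homological.LeftNoetherian (Op.ring R)

BoundedBy : ∀ {ℓ} → Ring ℓ ℓ → ℤ → Set (lsuc ℓ)
BoundedBy R k = left R × left (Op.ring R)
  where
  left : ∀ A → Set _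
  left A = ∀ M → FinitelyGenerated M → pd⋆ M ≤ k
    where open Homological A

record IsOreSet {ℓ} (R : Ring ℓ ℓ) (S : Pred (Ring.Carrier R) ℓ) : Set ℓ where
  open Ring R
  field
    resp           : S Respects _≈_
    1∈S            : 1# ∈ S
    *-closed       : ∀ {f g} → f ∈ S → g ∈ S → f * g ∈ S
    nonZeroDivisor : ∀ {f} → f ∈ S → ∀ a → (f * a ≈ 0# → a ≈ 0#) × (a * f ≈ 0# → a ≈ 0#)
    -- fR ∩ aS ≠ ∅
    oreʳ           : ∀ {f} → f ∈ S → ∀ a → ∃ λ b → ∃ λ s → s ∈ S × f * b ≈ a * s
    -- Rf ∩ Sa ≠ ∅
    oreˡ           : ∀ {f} → f ∈ S → ∀ a → ∃ λ b → ∃ λ s → s ∈ S × b * f ≈ s * a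

module Fitting {ℓ : Level} (R : Ring ℓ ℓ) (S : Pred (Ring.Carrier R) ℓ) where

  open Homological R

  IsTorsion : Mod → Set ℓ
  IsTorsion M = ∀ m → ∃ λ s → s ∈ S × s *ₗ m ≈ᴹ 0ᴹ
    where open LeftModule M

  record 𝓜 : Set (lsuc ℓ) where
    field
      mod               : Mod
      finitelyGenerated : FinitelyGenerated mod
      torsion           : IsTorsion mod
  open 𝓜 public using (mod)

  record 𝓒 : Set (lsuc ℓ) where
    field
      obj   : 𝓜
      pd⋆≤1 : pd⋆ mod obj ≤ 1ℤ
  open 𝓒 public using (obj)

  _∈𝓟 : 𝓜 → Set (lsuc ℓ)
  M ∈𝓟 = pd mod M ≤ 1ℤ

  _∈𝓠 : 𝓜 → Set (lsuc ℓ)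
  M ∈𝓠 = FinitePd (mod M)

  0⟶_⟶_⟶_⟶0 : 𝓜 → 𝓜 → 𝓜 → Set ℓ
  0⟶ L ⟶ M ⟶ N ⟶0 = ShortExact (mod L) (mod M) (mod N)

  module _ {a e : Level} (Ω : CommutativeMonoid a e) where

    open CommutativeMonoid Ω

    IsUnit : Carrier → Set (a ⊔ e)
    IsUnit = AlgebraicDefinitions.Invertible _≈_ ε _∙_

    record IsQuasiFitting (𝓕 : 𝓒 → Carrier) : Set (lsuc ℓ ⊔ a ⊔ e) where
      field
        unit      : ∀ P → obj P ∈𝓟 → IsUnit (𝓕 P)
        quotient  : ∀ {M′ M P} → obj P ∈𝓟 → 0⟶ obj M′ ⟶ obj M ⟶ obj P ⟶0 → 𝓕 M ≈ 𝓕 P ∙ 𝓕 M′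
        submodule : ∀ {P M M′} → obj P ∈𝓟 → 0⟶ obj P ⟶ obj M ⟶ obj M′ ⟶0 → 𝓕 M ≈ 𝓕 P ∙ 𝓕 M′

    record IsShiftedFamily (𝓕 : 𝓒 → Carrier) (𝓕⟨_⟩ : ℤ → 𝓜 → Carrier) : Set (lsuc ℓ ⊔ a ⊔ e) where
      field
        extends   : ∀ C → 𝓕⟨ 0ℤ ⟩ (obj C) ≈ 𝓕 C
        unit      : ∀ {P} → P ∈𝓠 → ∀ n → IsUnit (𝓕⟨ n ⟩ P)
        shift     : ∀ {N P M} → P ∈𝓠 → 0⟶ N ⟶ P ⟶ M ⟶0 →
                    ∀ n → 𝓕⟨ n ⟩ M ≈ 𝓕⟨ n ⟩ P ∙ 𝓕⟨ n ℤ.- 1ℤ ⟩ N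
        quotient  : ∀ {M′ M P} → P ∈𝓠 → 0⟶ M′ ⟶ M ⟶ P ⟶0 →
                    ∀ n → 𝓕⟨ n ⟩ M ≈ 𝓕⟨ n ⟩ P ∙ 𝓕⟨ n ⟩ M′
        submodule : ∀ {P M M′} → P ∈𝓠 → 0⟶ P ⟶ M ⟶ M′ ⟶0 →
                    ∀ n → 𝓕⟨ n ⟩ M ≈ 𝓕⟨ n ⟩ P ∙ 𝓕⟨ n ⟩ M′

{-# OPTIONS --safe #-}
module Submission where

open import Defs
open import Algebra.Bundles using (Ring; CommutativeMonoid)
open import Algebra.Module.Bundles using (LeftModule)
open import Data.Fin.Base as Fin using (Fin; zero; suc)
open import Data.Integer.Base as ℤ using (ℤ; +_; -[1+_]; 0ℤ; 1ℤ)
open import Data.Nat.Base as ℕ using (ℕ; zero; suc)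
open import Data.Product using (Σ; ∃; ∃!; _×_; _,_; proj₁; proj₂)
open import Data.Sum.Base using ([_,_]; inj₁; inj₂)
open import Data.Vec.Functional using (Vector; _++_)
open import Function.Base using (_∘_)
open import Level using (Level; _⊔_) renaming (suc to lsuc)
open import Relation.Binary.PropositionalEquality as ≡ using (_≡_)
open import Relation.Unary using (Pred; _∈_)

import Algebra.Construct.Flip.Op as Op
import Algebra.Module.Construct.DirectProduct as DirectProduct
import Algebra.Module.Construct.Zero as Zero
import Algebra.Properties.AbelianGroup as AbelianGroupProperties
import Algebra.Properties.CommutativeSemigroup as CommutativeSemigroupProperties
import Data.Fin.Properties as Fin
import Data.Integer.Properties as ℤ
import Data.Nat.Properties as ℕ
import Relation.Binary.Reasoning.Setoid as SetoidReasoning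

-- For an invariant F and 0 → N → P → M → 0 with P ∈ 𝓠, the shift property forces
-- F⟨n⟩(P) · F⟨n-1⟩(P) = 1, hence F⟨n-1⟩(P) · F⟨n⟩(M) = F⟨n-1⟩(N).  Every M ∈ 𝓜 is covered by some
-- P = ⨁ R/Rsᵢ, which lowers pd⋆ by one until 𝓒 is reached; this determines F⟨n⟩ on 𝓜 by
-- its lower shifts on 𝓒 and, read as a definition Φ, produces F⟨n⟩ from F⟨n-1⟩.
--
-- Negative shifts need embeddings 0 → M → P → C → 0 with M, C ∈ 𝓒 and P ∈ 𝓟.  Let
-- 0 → K → Rⁿ → M → 0 be exact.  As pd⋆ is bounded on both sides, finitely generated modules
-- with Extⁱ(-, R) = 0 for all i ≥ 1 are torsionless, as one sees by dualising a resolution.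
-- Generators yᵢ of Hom(K, R) embed K in Rᵐ with such a cokernel; by the Ore condition yᵢsᵢ
-- extends to zᵢ : Rⁿ → R for some sᵢ ∈ S, and the zᵢ induce an injection M → ⨁ R/Rsᵢ.

-- The forced relation F⟨n⟩(P) · F⟨n-1⟩(P) = 1 is the shift property of 0 → P → P → 0 → 0, because
-- the zero module must have value 1. The two directions are not symmetric. Kernels of covers
-- improve pd⋆, but for an embedding of M ∈ 𝓒 into P ∈ 𝓟 the cokernel C has Ext²(C, R) =
-- coker(Ext¹(P, R) → Ext¹(M, R)), so C ∈ 𝓒 needs this map to be onto. This is why the yᵢ must
-- generate Hom(K, R), which surjects onto Ext¹(M, R). The axioms of 𝓕 speak of 𝓟 and the conclusion
-- of 𝓠. They meet because a finitely generated module of finite projective dimension with Extⁱ(-,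
-- R) = 0 for all i ≥ 1 is projective; applied to a first syzygy this gives 𝓠 ∩ 𝓒 = 𝓟. Only the
-- vanishing of Ext matters, so it is encoded as extendability of functionals, iterated along
-- syzygies; closure under short exact sequences takes the place of the long exact sequence. The
-- values on modules with larger pd⋆ come from lower shifts on 𝓒, so they must be shown to agree on
-- 𝓒 with the shift itself. This rests on Φ ∘ Ψ = id.

-- Elementary module theory: factorisations, cokernels, pullbacks and pushouts of exact sequences.

module Modules {ℓ : Level} (R : Ring ℓ ℓ) where

  open Ring R using (Carrier)
  open Homological R
  open Hom using (⟦_⟧)

  module ModuleProperties (M : Mod) where
    open LeftModule M public
    open AbelianGroupProperties +ᴹ-abelianGroup public
      using (⁻¹-∙-comm; ε⁻¹≈ε; inverseˡ-unique; ⁻¹-anti-homo‿-)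
      renaming ( x∙y⁻¹≈ε⇒x≈y to x-y≈0⇒x≈y; x≈y⇒x∙y⁻¹≈ε to x≈y⇒x-y≈0
               ; //-rightDividesˡ to [y-x]+x≈y; //-rightDividesʳ to [y+x]-x≈y)
    open CommutativeSemigroupProperties
      (CommutativeMonoid.commutativeSemigroup +ᴹ-commutativeMonoid) public using (interchange)

    infixl 6 _-_
    _-_ : ∣ M ∣ → ∣ M ∣ → ∣ M ∣
    x - y = x +ᴹ (-ᴹ y)

    *ₗ-neg : ∀ r x → r *ₗ (-ᴹ x) ≈ᴹ -ᴹ (r *ₗ x)
    *ₗ-neg r x = inverseˡ-unique _ _
      (≈ᴹ-trans (≈ᴹ-sym (*ₗ-distribˡ r (-ᴹ x) x)) (≈ᴹ-trans (*ₗ-congˡ (-ᴹ‿inverseˡ x)) (*ₗ-zeroʳ r)))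

    *ₗ-sub : ∀ r x y → r *ₗ (x - y) ≈ᴹ (r *ₗ x) - (r *ₗ y)
    *ₗ-sub r x y = ≈ᴹ-trans (*ₗ-distribˡ r x (-ᴹ y)) (+ᴹ-congˡ (*ₗ-neg r y))

    +-sub : ∀ x y z w → (x - y) +ᴹ (z - w) ≈ᴹ (x +ᴹ z) - (y +ᴹ w)
    +-sub x y z w = ≈ᴹ-trans (interchange x (-ᴹ y) z (-ᴹ w)) (+ᴹ-congˡ (⁻¹-∙-comm y w))

    sub-sub : ∀ x y z → (x - y) +ᴹ (y - z) ≈ᴹ x - z
    sub-sub x y z = ≈ᴹ-trans (≈ᴹ-sym (+ᴹ-assoc (x - y) y (-ᴹ z))) (+ᴹ-congʳ ([y-x]+x≈y y x))

    x-0≈x : ∀ x → x - 0ᴹ ≈ᴹ x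
    x-0≈x x = ≈ᴹ-trans (+ᴹ-congˡ ε⁻¹≈ε) (+ᴹ-identityʳ x)

    0+0≈0 : 0ᴹ +ᴹ 0ᴹ ≈ᴹ 0ᴹ
    0+0≈0 = +ᴹ-identityˡ 0ᴹ

    x-[x-y]≈y : ∀ x y → x - (x - y) ≈ᴹ y
    x-[x-y]≈y x y = ≈ᴹ-trans (+ᴹ-congˡ (⁻¹-anti-homo‿- x y)) (≈ᴹ-trans (+ᴹ-comm _ _) ([y-x]+x≈y x y))

    x+y-x≈y : ∀ x y → (x +ᴹ y) - x ≈ᴹ y
    x+y-x≈y x y = ≈ᴹ-trans (+ᴹ-congʳ (+ᴹ-comm x y)) ([y+x]-x≈y x y)

  ⟦⟧-sub : ∀ {M N} (f : Hom M N) x y →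
           let module M = ModuleProperties M
               module N = ModuleProperties N in
           ⟦ f ⟧ (x M.- y) N.≈ᴹ ⟦ f ⟧ x N.- ⟦ f ⟧ y
  ⟦⟧-sub {N = N} f x y = N.≈ᴹ-trans (f.+ᴹ-homo x _) (N.+ᴹ-congˡ (f.-ᴹ-homo y))
    where module N = ModuleProperties N
          module f = Hom f

  injective-if : ∀ {M N} (f : Hom M N) →
                 (∀ x → LeftModule._≈ᴹ_ N (⟦ f ⟧ x) (LeftModule.0ᴹ N) →
                        LeftModule._≈ᴹ_ M x (LeftModule.0ᴹ M)) →
                 IsInjective f
  injective-if {M} {N} f trivialKernel {x} {y} e = M.x-y≈0⇒x≈y x y
    (trivialKernel _ (N.≈ᴹ-trans (⟦⟧-sub f x y) (N.x≈y⇒x-y≈0 e)))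
    where module M = ModuleProperties M
          module N = ModuleProperties N

  surjective-if : ∀ {M N} (f : Hom M N) →
                  (∀ y → ∃ λ x → LeftModule._≈ᴹ_ N (⟦ f ⟧ x) y) → IsSurjective f
  surjective-if {N = N} f pre y =
    proj₁ (pre y) , λ e → LeftModule.≈ᴹ-trans N (Hom.⟦⟧-cong f e) (proj₂ (pre y))

  preimage : ∀ {M N} (f : Hom M N) → IsSurjective f →
             ∀ y → ∃ λ x → LeftModule._≈ᴹ_ N (⟦ f ⟧ x) y
  preimage {M} f surj y = proj₁ (surj y) , proj₂ (surj y) (LeftModule.≈ᴹ-refl M)

  zeroᴹ : Mod
  zeroᴹ = Zero.leftModule

  infixr 6 _⊞_
  _⊞_ : Mod → Mod → Mod
  M ⊞ N = DirectProduct.leftModule M N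

  idʰ : ∀ {M} → Hom M M
  idʰ {M} = mkHom M M (λ x → x) (λ e → e) (λ _ _ → ≈ᴹ-refl) (λ _ _ → ≈ᴹ-refl)
    where open LeftModule M

  0ʰ : ∀ {M N} → Hom M N
  0ʰ {M} {N} = mkHom M N (λ _ → 0ᴹ) (λ _ → ≈ᴹ-refl)
    (λ _ _ → ≈ᴹ-sym (+ᴹ-identityˡ 0ᴹ)) (λ r _ → ≈ᴹ-sym (*ₗ-zeroʳ r))
    where open LeftModule N

  infixl 6 _+ʰ_ _-ʰ_
  _+ʰ_ : ∀ {M N} → Hom M N → Hom M N → Hom M N
  _+ʰ_ {M} {N} φ ψ = mkHom M N (λ x → φ.⟦ x ⟧ N.+ᴹ ψ.⟦ x ⟧)
    (λ e → N.+ᴹ-cong (φ.⟦⟧-cong e) (ψ.⟦⟧-cong e))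
    (λ x y → N.≈ᴹ-trans (N.+ᴹ-cong (φ.+ᴹ-homo x y) (ψ.+ᴹ-homo x y)) (N.interchange _ _ _ _))
    (λ r x → N.≈ᴹ-trans (N.+ᴹ-cong (φ.*ₗ-homo r x) (ψ.*ₗ-homo r x))
                        (N.≈ᴹ-sym (N.*ₗ-distribˡ r _ _)))
    where module N = ModuleProperties N
          module φ = Hom φ
          module ψ = Hom ψ

  -ʰ_ : ∀ {M N} → Hom M N → Hom M N
  -ʰ_ {M} {N} φ = mkHom M N (λ x → N.-ᴹ φ.⟦ x ⟧)
    (λ e → N.-ᴹ‿cong (φ.⟦⟧-cong e))
    (λ x y → N.≈ᴹ-trans (N.-ᴹ‿cong (φ.+ᴹ-homo x y)) (N.≈ᴹ-sym (N.⁻¹-∙-comm _ _)))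
    (λ r x → N.≈ᴹ-trans (N.-ᴹ‿cong (φ.*ₗ-homo r x)) (N.≈ᴹ-sym (N.*ₗ-neg r _)))
    where module N = ModuleProperties N
          module φ = Hom φ

  _-ʰ_ : ∀ {M N} → Hom M N → Hom M N → Hom M N
  φ -ʰ ψ = φ +ʰ (-ʰ ψ)

  fstʰ : ∀ {M N} → Hom (M ⊞ N) M
  fstʰ {M} {N} = mkHom (M ⊞ N) M proj₁ proj₁ (λ _ _ → ≈ᴹ-refl) (λ _ _ → ≈ᴹ-refl)
    where open LeftModule M

  sndʰ : ∀ {M N} → Hom (M ⊞ N) N
  sndʰ {M} {N} = mkHom (M ⊞ N) N proj₂ proj₂ (λ _ _ → ≈ᴹ-refl) (λ _ _ → ≈ᴹ-refl)
    where open LeftModule N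

  pairʰ : ∀ {L M N} → Hom L M → Hom L N → Hom L (M ⊞ N)
  pairʰ {L} {M} {N} f g = mkHom L (M ⊞ N) (λ x → ⟦ f ⟧ x , ⟦ g ⟧ x)
    (λ e → Hom.⟦⟧-cong f e , Hom.⟦⟧-cong g e)
    (λ x y → Hom.+ᴹ-homo f x y , Hom.+ᴹ-homo g x y)
    (λ r x → Hom.*ₗ-homo f r x , Hom.*ₗ-homo g r x)

  copairʰ : ∀ {L M N} → Hom L N → Hom M N → Hom (L ⊞ M) N
  copairʰ f g = (f ∘ʰ fstʰ) +ʰ (g ∘ʰ sndʰ)

  module _ {X M N : Mod} (e : Hom X M) (e-surj : IsSurjective e) (f : Hom X N)
           (kernel⊆ : ∀ x → LeftModule._≈ᴹ_ M (⟦ e ⟧ x) (LeftModule.0ᴹ M) →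
                            LeftModule._≈ᴹ_ N (⟦ f ⟧ x) (LeftModule.0ᴹ N)) where

    private
      module X = ModuleProperties X
      module M = ModuleProperties M
      module N = ModuleProperties N
      module e = Hom e
      module f = Hom f
      pre = preimage e e-surj

      respects : ∀ {x y} → e.⟦ x ⟧ M.≈ᴹ e.⟦ y ⟧ → f.⟦ x ⟧ N.≈ᴹ f.⟦ y ⟧
      respects {x} {y} p = N.x-y≈0⇒x≈y _ _ (N.≈ᴹ-trans (N.≈ᴹ-sym (⟦⟧-sub f x y))
        (kernel⊆ _ (M.≈ᴹ-trans (⟦⟧-sub e x y) (M.x≈y⇒x-y≈0 p))))

    -- A proof of surjectivity carries a preimage of every element, so the induced map needs no
    -- choice principle; `respects` makes its value independent of the preimage.
    descend : Hom M N
    descend = mkHom M N (λ m → f.⟦ proj₁ (pre m) ⟧)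
      (λ {m} {m′} p → respects
        (M.≈ᴹ-trans (proj₂ (pre m)) (M.≈ᴹ-trans p (M.≈ᴹ-sym (proj₂ (pre m′))))))
      (λ m m′ → N.≈ᴹ-trans (respects (M.≈ᴹ-trans (proj₂ (pre _))
        (M.≈ᴹ-sym (M.≈ᴹ-trans (e.+ᴹ-homo _ _) (M.+ᴹ-cong (proj₂ (pre m)) (proj₂ (pre m′)))))))
        (f.+ᴹ-homo _ _))
      (λ r m → N.≈ᴹ-trans (respects (M.≈ᴹ-trans (proj₂ (pre _))
        (M.≈ᴹ-sym (M.≈ᴹ-trans (e.*ₗ-homo _ _) (M.*ₗ-congˡ (proj₂ (pre m)))))))
        (f.*ₗ-homo _ _))

    descend-∘ : ∀ x → ⟦ descend ⟧ (e.⟦ x ⟧) N.≈ᴹ f.⟦ x ⟧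
    descend-∘ x = respects (proj₂ (pre _))

  module _ {X N Y : Mod} (i : Hom N Y) (i-inj : IsInjective i) (f : Hom X Y)
           (image⊆ : ∀ x → ∃ λ n → LeftModule._≈ᴹ_ Y (⟦ i ⟧ n) (⟦ f ⟧ x)) where

    private
      module Y = ModuleProperties Y
      module i = Hom i
      module f = Hom f

    corestrict : Hom X N
    corestrict = mkHom X N (λ x → proj₁ (image⊆ x))
      (λ {x} {x′} p → i-inj (Y.≈ᴹ-trans (proj₂ (image⊆ x))
        (Y.≈ᴹ-trans (f.⟦⟧-cong p) (Y.≈ᴹ-sym (proj₂ (image⊆ x′))))))
      (λ x x′ → i-inj (Y.≈ᴹ-trans (proj₂ (image⊆ _)) (Y.≈ᴹ-trans (f.+ᴹ-homo x x′)
        (Y.≈ᴹ-sym (Y.≈ᴹ-trans (i.+ᴹ-homo _ _) (Y.+ᴹ-cong (proj₂ (image⊆ x)) (proj₂ (image⊆ x′))))))))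
      (λ r x → i-inj (Y.≈ᴹ-trans (proj₂ (image⊆ _)) (Y.≈ᴹ-trans (f.*ₗ-homo r x)
        (Y.≈ᴹ-sym (Y.≈ᴹ-trans (i.*ₗ-homo _ _) (Y.*ₗ-congˡ (proj₂ (image⊆ x))))))))

    ∘-corestrict : ∀ x → ⟦ i ⟧ (⟦ corestrict ⟧ x) Y.≈ᴹ f.⟦ x ⟧
    ∘-corestrict x = proj₂ (image⊆ x)

  kernel-exact : ∀ {M N} (g : Hom M N) → IsSurjective g → ShortExact (kernel g) M N
  kernel-exact {M} g g-surj = record
    { f = kernel-inclusion g ; g = g ; injective = λ e → e
    ; exact = proj₂ , λ y p → (y , p) , LeftModule.≈ᴹ-refl M
    ; surjective = g-surj }

  -- The operations of `N` are kept and only the equality is coarsened, so an element of a quotient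
  -- is literally an element of `N`, and an equality in it is a preimage under `f`.
  cokernel : ∀ {M N} → Hom M N → Mod
  cokernel {M} {N} f = record
    { Carrierᴹ = ∣ N ∣ ; _≈ᴹ_ = _∼_ ; _+ᴹ_ = N._+ᴹ_ ; _*ₗ_ = N._*ₗ_ ; 0ᴹ = N.0ᴹ ; -ᴹ_ = N.-ᴹ_
    ; isLeftModule = record
      { isLeftSemimodule = record
        { +ᴹ-isCommutativeMonoid = record
          { isMonoid = record
            { isSemigroup = record
              { isMagma = record
                { isEquivalence = record
                  { refl  = from N.≈ᴹ-refl
                  ; sym   = λ (m , p) → M.-ᴹ m ,
                      N.≈ᴹ-trans (f.-ᴹ-homo m) (N.≈ᴹ-trans (N.-ᴹ‿cong p) (N.⁻¹-anti-homo‿- _ _))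
                  ; trans = λ (m , p) (m′ , q) → m M.+ᴹ m′ ,
                      N.≈ᴹ-trans (f.+ᴹ-homo m m′) (N.≈ᴹ-trans (N.+ᴹ-cong p q) (N.sub-sub _ _ _))
                  }
                ; ∙-cong = λ (m , p) (m′ , q) → m M.+ᴹ m′ ,
                    N.≈ᴹ-trans (f.+ᴹ-homo m m′) (N.≈ᴹ-trans (N.+ᴹ-cong p q) (N.+-sub _ _ _ _))
                }
              ; assoc = λ x y z → from (N.+ᴹ-assoc x y z)
              }
            ; identity = (λ x → from (N.+ᴹ-identityˡ x)) , (λ x → from (N.+ᴹ-identityʳ x))
            }
          ; comm = λ x y → from (N.+ᴹ-comm x y)
          }
        ; isPreleftSemimodule = record
          { *ₗ-cong = λ {r} {_} {x} {y} r≈s (m , p) → r M.*ₗ m , N.≈ᴹ-trans (f.*ₗ-homo r m)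
              (N.≈ᴹ-trans (N.*ₗ-congˡ p) (N.≈ᴹ-trans (N.*ₗ-sub r x y)
                (N.+ᴹ-congˡ (N.-ᴹ‿cong (N.*ₗ-congʳ r≈s)))))
          ; *ₗ-zeroˡ = λ x → from (N.*ₗ-zeroˡ x)
          ; *ₗ-distribʳ = λ x r s → from (N.*ₗ-distribʳ x r s)
          ; *ₗ-identityˡ = λ x → from (N.*ₗ-identityˡ x)
          ; *ₗ-assoc = λ r s x → from (N.*ₗ-assoc r s x)
          ; *ₗ-zeroʳ = λ r → from (N.*ₗ-zeroʳ r)
          ; *ₗ-distribˡ = λ r x y → from (N.*ₗ-distribˡ r x y)
          }
        }
      ; -ᴹ‿cong = λ (m , p) → M.-ᴹ m ,
          N.≈ᴹ-trans (f.-ᴹ-homo m) (N.≈ᴹ-trans (N.-ᴹ‿cong p) (N.≈ᴹ-sym (N.⁻¹-∙-comm _ _)))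
      ; -ᴹ‿inverse = (λ x → from (N.-ᴹ‿inverseˡ x)) , (λ x → from (N.-ᴹ‿inverseʳ x))
      }
    }
    where
    module M = ModuleProperties M
    module N = ModuleProperties N
    module f = Hom f
    _∼_ : ∣ N ∣ → ∣ N ∣ → Set ℓ
    x ∼ y = ∃ λ m → f.⟦ m ⟧ N.≈ᴹ x N.- y
    from : ∀ {x y} → x N.≈ᴹ y → x ∼ y
    from p = M.0ᴹ , N.≈ᴹ-trans f.0ᴹ-homo (N.≈ᴹ-sym (N.x≈y⇒x-y≈0 p))

  module _ {M N : Mod} (f : Hom M N) where

    private
      module N = ModuleProperties N
      module C = LeftModule (cokernel f)

    ≈⇒cokernel≈ : ∀ {x y} → x N.≈ᴹ y → x C.≈ᴹ y
    ≈⇒cokernel≈ p = LeftModule.0ᴹ M ,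
      N.≈ᴹ-trans (Hom.0ᴹ-homo f) (N.≈ᴹ-sym (N.x≈y⇒x-y≈0 p))

    cokernel-projection : Hom N (cokernel f)
    cokernel-projection = mkHom N (cokernel f) (λ x → x) ≈⇒cokernel≈
      (λ _ _ → C.≈ᴹ-refl) (λ _ _ → C.≈ᴹ-refl)

    cokernel-exact : IsInjective f → ShortExact M N (cokernel f)
    cokernel-exact f-inj = record
      { f = f ; g = cokernel-projection ; injective = f-inj
      ; exact = (λ x → x , N.≈ᴹ-sym (N.x-0≈x _)) ,
                (λ y (m , p) → m , N.≈ᴹ-trans p (N.x-0≈x y))
      ; surjective = surjective-if cokernel-projection (λ y → y , C.≈ᴹ-refl) }

  -- `K` is the preimage in `Q` of the submodule `M′`, so it contains the kernel `N` of `Q → M`.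
  kernel-of-composite : ∀ {N Q M M′ P} → ShortExact N Q M → ShortExact M′ M P →
                        ∃ λ K → ShortExact K Q P × ShortExact N K M′
  kernel-of-composite {N} {Q} {M} {M′} {P} s t =
    kernel pq , kernel-exact pq pq-surj , record
      { f = j ; g = h ; injective = s.injective
      ; exact = (λ n → t.injective (M.≈ᴹ-trans (h-spec _)
                  (M.≈ᴹ-trans (proj₁ s.exact n) (M.≈ᴹ-sym i.0ᴹ-homo)))) ,
                (λ k p → proj₂ s.exact (proj₁ k)
                  (M.≈ᴹ-trans (M.≈ᴹ-sym (h-spec k)) (M.≈ᴹ-trans (i.⟦⟧-cong p) i.0ᴹ-homo)))
      ; surjective = surjective-if h λ m′ →
          let x , p = preimage s.g s.surjective (i.⟦ m′ ⟧)
              k = x , P.≈ᴹ-trans (Hom.⟦⟧-cong t.g p) (proj₁ t.exact m′)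
          in k , t.injective (M.≈ᴹ-trans (h-spec k) p)
      }
    where
    module s = ShortExact s
    module t = ShortExact t
    module M = ModuleProperties M
    module P = ModuleProperties P
    module i = Hom t.f
    pq = t.g ∘ʰ s.g
    pq-surj : IsSurjective pq
    pq-surj = surjective-if pq λ p →
      let m , e = preimage t.g t.surjective p
          x , e′ = preimage s.g s.surjective m
      in x , P.≈ᴹ-trans (Hom.⟦⟧-cong t.g e′) e
    j : Hom N (kernel pq)
    j = corestrict (kernel-inclusion pq) (λ e → e) s.f
      (λ n → (⟦ s.f ⟧ n , P.≈ᴹ-trans (Hom.⟦⟧-cong t.g (proj₁ s.exact n)) (Hom.0ᴹ-homo t.g))
             , LeftModule.≈ᴹ-refl Q)
    lift : ∀ k → ∃ λ m′ → i.⟦ m′ ⟧ M.≈ᴹ ⟦ s.g ⟧ (proj₁ k)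
    lift (x , p) = proj₂ t.exact (⟦ s.g ⟧ x) p
    h : Hom (kernel pq) M′
    h = corestrict t.f t.injective (s.g ∘ʰ kernel-inclusion pq) lift
    h-spec = ∘-corestrict t.f t.injective (s.g ∘ʰ kernel-inclusion pq) lift

  -- The third isomorphism theorem: `K` is `Q/M′`, which contains `M/M′`, that is `P`, with quotient
  -- `Q/M`, that is `C`.
  cokernel-of-composite : ∀ {M Q C M′ P} → ShortExact M Q C → ShortExact M′ M P →
                          ∃ λ K → ShortExact M′ Q K × ShortExact P K C
  cokernel-of-composite {M} {Q} {C} {M′} {P} s t =
    cokernel ij , cokernel-exact ij (λ e → t.injective (s.injective e)) , record
      { f = u ; g = v
      ; injective = injective-if u λ x p →
          let m , e = preimage t.g t.surjective x
              m′ , q = K.≈ᴹ-trans (K.≈ᴹ-sym (u-spec m)) (K.≈ᴹ-trans (Hom.⟦⟧-cong u e) p)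
          in P.≈ᴹ-trans (P.≈ᴹ-sym e) (P.≈ᴹ-trans
               (Hom.⟦⟧-cong t.g (M.≈ᴹ-sym (s.injective (Q.≈ᴹ-trans q (Q.x-0≈x _)))))
               (proj₁ t.exact m′))
      ; exact = (λ x → let m , e = preimage t.g t.surjective x in
                  C.≈ᴹ-trans (Hom.⟦⟧-cong v (K.≈ᴹ-trans (Hom.⟦⟧-cong u (P.≈ᴹ-sym e)) (u-spec m)))
                    (C.≈ᴹ-trans (v-spec _) (proj₁ s.exact m))) ,
                (λ y p → let m , e = proj₂ s.exact y (C.≈ᴹ-trans (C.≈ᴹ-sym (v-spec y)) p) in
                  ⟦ t.g ⟧ m , K.≈ᴹ-trans (u-spec m) (≈⇒cokernel≈ ij e))
      ; surjective = surjective-if v λ c → let x , e = preimage s.g s.surjective c in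
          x , C.≈ᴹ-trans (v-spec x) e
      }
    where
    module s = ShortExact s
    module t = ShortExact t
    module M = ModuleProperties M
    module P = ModuleProperties P
    module Q = ModuleProperties Q
    module C = ModuleProperties C
    ij = s.f ∘ʰ t.f
    module K = ModuleProperties (cokernel ij)
    π-surj = ShortExact.surjective (cokernel-exact ij (λ e → t.injective (s.injective e)))
    u-kernel : ∀ m → ⟦ t.g ⟧ m P.≈ᴹ P.0ᴹ → ⟦ s.f ⟧ m K.≈ᴹ K.0ᴹ
    u-kernel m p = let m′ , e = proj₂ t.exact m p in
      m′ , Q.≈ᴹ-trans (Hom.⟦⟧-cong s.f e) (Q.≈ᴹ-sym (Q.x-0≈x _))
    u : Hom P (cokernel ij)
    u = descend t.g t.surjective (cokernel-projection ij ∘ʰ s.f) u-kernel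
    u-spec = descend-∘ t.g t.surjective (cokernel-projection ij ∘ʰ s.f) u-kernel
    v-kernel : ∀ x → x K.≈ᴹ K.0ᴹ → ⟦ s.g ⟧ x C.≈ᴹ C.0ᴹ
    v-kernel x (m′ , p) = C.≈ᴹ-trans
      (Hom.⟦⟧-cong s.g (Q.≈ᴹ-trans (Q.≈ᴹ-sym (Q.x-0≈x x)) (Q.≈ᴹ-sym p))) (proj₁ s.exact _)
    v : Hom (cokernel ij) C
    v = descend (cokernel-projection ij) π-surj s.g v-kernel
    v-spec = descend-∘ (cokernel-projection ij) π-surj s.g v-kernel

  pullback : ∀ {A B M A′ B′} → ShortExact A B M → ShortExact A′ B′ M →
             ∃ λ X → ShortExact A X B′ × ShortExact A′ X B
  pullback {A} {B} {M} {A′} {B′} s t = kernel δ , record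
      { f = corestrict ι (λ e → e) (pairʰ s.f 0ʰ) left
      ; g = sndʰ ∘ʰ ι
      ; injective = λ e → s.injective (proj₁ e)
      ; exact = (λ _ → B′.≈ᴹ-refl) ,
          (λ ((b , b′) , p) q →
            let a , e = proj₂ s.exact b (M.≈ᴹ-trans (M.x-y≈0⇒x≈y _ _ p)
                          (M.≈ᴹ-trans (Hom.⟦⟧-cong t.g q) (Hom.0ᴹ-homo t.g)))
            in a , e , B′.≈ᴹ-sym q)
      ; surjective = surjective-if (sndʰ ∘ʰ ι) λ b′ →
          let b , e = preimage s.g s.surjective (⟦ t.g ⟧ b′)
          in ((b , b′) , M.x≈y⇒x-y≈0 e) , B′.≈ᴹ-refl
      } , record
      { f = corestrict ι (λ e → e) (pairʰ 0ʰ t.f) right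
      ; g = fstʰ ∘ʰ ι
      ; injective = λ e → t.injective (proj₂ e)
      ; exact = (λ _ → B.≈ᴹ-refl) ,
          (λ ((b , b′) , p) q →
            let a , e = proj₂ t.exact b′ (M.≈ᴹ-trans (M.≈ᴹ-sym (M.x-y≈0⇒x≈y _ _ p))
                          (M.≈ᴹ-trans (Hom.⟦⟧-cong s.g q) (Hom.0ᴹ-homo s.g)))
            in a , B.≈ᴹ-sym q , e)
      ; surjective = surjective-if (fstʰ ∘ʰ ι) λ b →
          let b′ , e = preimage t.g t.surjective (⟦ s.g ⟧ b)
          in ((b , b′) , M.x≈y⇒x-y≈0 (M.≈ᴹ-sym e)) , B.≈ᴹ-refl
      }
    where
    module s = ShortExact s
    module t = ShortExact t
    module M = ModuleProperties M
    module B = LeftModule B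
    module B′ = LeftModule B′
    δ : Hom (B ⊞ B′) M
    δ = (s.g ∘ʰ fstʰ) -ʰ (t.g ∘ʰ sndʰ)
    ι = kernel-inclusion δ
    module BB′ = LeftModule (B ⊞ B′)
    left : ∀ a → ∃ λ x → proj₁ {B = λ x → ⟦ δ ⟧ x M.≈ᴹ M.0ᴹ} x BB′.≈ᴹ (⟦ s.f ⟧ a , B′.0ᴹ)
    left a = ((⟦ s.f ⟧ a , B′.0ᴹ) ,
      M.x≈y⇒x-y≈0 (M.≈ᴹ-trans (proj₁ s.exact a) (M.≈ᴹ-sym (Hom.0ᴹ-homo t.g)))) , BB′.≈ᴹ-refl
    right : ∀ a → ∃ λ x → proj₁ {B = λ x → ⟦ δ ⟧ x M.≈ᴹ M.0ᴹ} x BB′.≈ᴹ (B.0ᴹ , ⟦ t.f ⟧ a)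
    right a = ((B.0ᴹ , ⟦ t.f ⟧ a) ,
      M.x≈y⇒x-y≈0 (M.≈ᴹ-trans (Hom.0ᴹ-homo s.g) (M.≈ᴹ-sym (proj₁ t.exact a)))) , BB′.≈ᴹ-refl

  pushout : ∀ {M B C B′ C′} → ShortExact M B C → ShortExact M B′ C′ →
            ∃ λ X → ShortExact B X C′ × ShortExact B′ X C
  pushout {M} {B} {C} {B′} {C′} s t = cokernel δ , record
      { f = inl
      ; g = toC′
      ; injective = injective-if inl λ b (m , p , q) →
          let m≈0 = t.injective (B′.≈ᴹ-trans q (B′.≈ᴹ-trans (B′.x-0≈x _) (B′.≈ᴹ-sym (Hom.0ᴹ-homo t.f))))
          in B.≈ᴹ-trans (B.≈ᴹ-sym (B.≈ᴹ-trans p (B.x-0≈x b)))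
               (B.≈ᴹ-trans (Hom.⟦⟧-cong s.f m≈0) (Hom.0ᴹ-homo s.f))
      ; exact = (λ b → C′.≈ᴹ-trans (toC′-spec (b , B′.0ᴹ)) (Hom.0ᴹ-homo t.g)) ,
          (λ (b , b′) p →
            let m , e = proj₂ t.exact b′ (C′.≈ᴹ-trans (C′.≈ᴹ-sym (toC′-spec (b , b′))) p)
            in b B.- ⟦ s.f ⟧ m , X.≈ᴹ-sym (m ,
                 B.≈ᴹ-sym (B.x-[x-y]≈y b _) ,
                 B′.≈ᴹ-trans e (B′.≈ᴹ-sym (B′.x-0≈x b′))))
      ; surjective = surjective-if toC′ λ c → let b′ , e = preimage t.g t.surjective c in
          (B.0ᴹ , b′) , C′.≈ᴹ-trans (toC′-spec (B.0ᴹ , b′)) e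
      } , record
      { f = inr
      ; g = toC
      ; injective = injective-if inr λ b (m , p , q) →
          let m≈0 = s.injective (B.≈ᴹ-trans p (B.≈ᴹ-trans (B.x-0≈x _) (B.≈ᴹ-sym (Hom.0ᴹ-homo s.f))))
          in B′.≈ᴹ-trans (B′.≈ᴹ-sym (B′.≈ᴹ-trans q (B′.x-0≈x b)))
               (B′.≈ᴹ-trans (Hom.⟦⟧-cong t.f m≈0) (Hom.0ᴹ-homo t.f))
      ; exact = (λ b → C.≈ᴹ-trans (toC-spec (B.0ᴹ , b)) (Hom.0ᴹ-homo s.g)) ,
          (λ (b , b′) p →
            let m , e = proj₂ s.exact b (C.≈ᴹ-trans (C.≈ᴹ-sym (toC-spec (b , b′))) p)
            in b′ B′.- ⟦ t.f ⟧ m , X.≈ᴹ-sym (m ,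
                 B.≈ᴹ-trans e (B.≈ᴹ-sym (B.x-0≈x b)) ,
                 B′.≈ᴹ-sym (B′.x-[x-y]≈y b′ _)))
      ; surjective = surjective-if toC λ c → let b , e = preimage s.g s.surjective c in
          (b , B′.0ᴹ) , C.≈ᴹ-trans (toC-spec (b , B′.0ᴹ)) e
      }
    where
    module s = ShortExact s
    module t = ShortExact t
    module B = ModuleProperties B
    module B′ = ModuleProperties B′
    module C = ModuleProperties C
    module C′ = ModuleProperties C′
    δ : Hom M (B ⊞ B′)
    -- There is no sign here, so the square of the pushout commutes only up to sign; the two exact
    -- sequences do not see this.
    δ = pairʰ s.f t.f
    module X = LeftModule (cokernel δ)
    π : Hom (B ⊞ B′) (cokernel δ)
    π = cokernel-projection δ
    π-surj : IsSurjective π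
    π-surj = surjective-if π (λ y → y , X.≈ᴹ-refl)
    inl = π ∘ʰ pairʰ idʰ 0ʰ
    inr = π ∘ʰ pairʰ 0ʰ idʰ
    toC′-kernel : ∀ x → x X.≈ᴹ X.0ᴹ → ⟦ t.g ⟧ (proj₂ x) C′.≈ᴹ C′.0ᴹ
    toC′-kernel x (m , _ , q) = C′.≈ᴹ-trans
      (Hom.⟦⟧-cong t.g (B′.≈ᴹ-trans (B′.≈ᴹ-sym (B′.x-0≈x _)) (B′.≈ᴹ-sym q))) (proj₁ t.exact m)
    toC′ = descend π π-surj (t.g ∘ʰ sndʰ) toC′-kernel
    toC′-spec = descend-∘ π π-surj (t.g ∘ʰ sndʰ) toC′-kernel
    toC-kernel : ∀ x → x X.≈ᴹ X.0ᴹ → ⟦ s.g ⟧ (proj₁ x) C.≈ᴹ C.0ᴹ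
    toC-kernel x (m , p , _) = C.≈ᴹ-trans
      (Hom.⟦⟧-cong s.g (B.≈ᴹ-trans (B.≈ᴹ-sym (B.x-0≈x _)) (B.≈ᴹ-sym p))) (proj₁ s.exact m)
    toC = descend π π-surj (s.g ∘ʰ fstʰ) toC-kernel
    toC-spec = descend-∘ π π-surj (s.g ∘ʰ fstʰ) toC-kernel

-- Dimension shifting for projective dimension and for the vanishing of Ext(-, R).

module Dimension {ℓ : Level} (R : Ring ℓ ℓ) where

  open Homological R
  open Hom using (⟦_⟧)
  open Modules R

  module _ {N X P : Mod} (s : ShortExact N X P) (P-proj : Projective P) where

    private
      module s = ShortExact s
      module X = ModuleProperties X
      module P = ModuleProperties P

    section : Hom P X
    section = proj₁ (P-proj s.g s.surjective idʰ)

    section-∘ : ∀ p → ⟦ s.g ⟧ (⟦ section ⟧ p) P.≈ᴹ p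
    section-∘ = proj₂ (P-proj s.g s.surjective idʰ)

    private
      complement : Hom X X
      complement = idʰ -ʰ (section ∘ʰ s.g)

      complement∈ : ∀ x → ∃ λ n → ⟦ s.f ⟧ n X.≈ᴹ ⟦ complement ⟧ x
      complement∈ x = proj₂ s.exact _ (P.≈ᴹ-trans (⟦⟧-sub s.g _ _)
        (P.x≈y⇒x-y≈0 (P.≈ᴹ-sym (section-∘ _))))

    retraction : Hom X N
    retraction = corestrict s.f s.injective complement complement∈

    retraction-sum : ∀ x → ⟦ s.f ⟧ (⟦ retraction ⟧ x) X.+ᴹ ⟦ section ⟧ (⟦ s.g ⟧ x) X.≈ᴹ x
    retraction-sum x = X.≈ᴹ-trans
      (X.+ᴹ-congʳ (∘-corestrict s.f s.injective complement complement∈ x)) (X.[y-x]+x≈y _ _)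

    retraction-∘ : ∀ n → LeftModule._≈ᴹ_ N (⟦ retraction ⟧ (⟦ s.f ⟧ n)) n
    retraction-∘ n = s.injective (X.≈ᴹ-trans
      (∘-corestrict s.f s.injective complement complement∈ _)
      (X.≈ᴹ-trans (X.+ᴹ-congˡ (X.-ᴹ‿cong (X.≈ᴹ-trans
        (Hom.⟦⟧-cong section (proj₁ s.exact n)) (Hom.0ᴹ-homo section)))) (X.x-0≈x _)))

  zero-projective : ∀ {P} → IsZeroᴹ P → Projective P
  zero-projective {P} P≈0 {X} {Y} g _ f = 0ʰ , λ x →
    Y.≈ᴹ-trans (Hom.0ᴹ-homo g) (Y.≈ᴹ-sym (Y.≈ᴹ-trans (Hom.⟦⟧-cong f (P≈0 x)) (Hom.0ᴹ-homo f)))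
    where module Y = LeftModule Y

  retract-projective : ∀ {P Q} (i : Hom P Q) (r : Hom Q P) →
    (∀ p → LeftModule._≈ᴹ_ P (⟦ r ⟧ (⟦ i ⟧ p)) p) → Projective Q → Projective P
  retract-projective i r ri Q-proj {Y = Y} g g-surj f =
    let h , gh = Q-proj g g-surj (f ∘ʰ r)
    in h ∘ʰ i , λ p → LeftModule.≈ᴹ-trans Y (gh _) (Hom.⟦⟧-cong f (ri p))

  -- Invariance under adding a projective summand, phrased without direct sums.
  record IsStable (𝒱 : Mod → Set (lsuc ℓ)) : Set (lsuc ℓ) where
    field
      enlarge : ∀ {N X P} → ShortExact N X P → Projective P → 𝒱 N → 𝒱 X
      shrink  : ∀ {N X P} → ShortExact N X P → Projective P → 𝒱 X → 𝒱 N

  IsExtensionClosed : (Mod → Set (lsuc ℓ)) → Set (lsuc ℓ)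
  IsExtensionClosed 𝒱 = ∀ {L M N} → ShortExact L M N → 𝒱 L → 𝒱 N → 𝒱 M

  projective-shrink : ∀ {N X P} → ShortExact N X P → Projective P → Projective X → Projective N
  projective-shrink s P-proj = retract-projective s.f (retraction s P-proj) (retraction-∘ s P-proj)
    where module s = ShortExact s

  projective-closed : IsExtensionClosed Projective
  projective-closed {N} {M} {P} s N-proj P-proj {A} {B} g g-surj f =
    let a , ga = N-proj g g-surj (f ∘ʰ s.f)
        b , gb = P-proj g g-surj (f ∘ʰ σ)
    in (a ∘ʰ ρ) +ʰ (b ∘ʰ s.g) , λ x →
      B.≈ᴹ-trans (Hom.+ᴹ-homo g _ _) (B.≈ᴹ-trans (B.+ᴹ-cong (ga _) (gb _))
        (B.≈ᴹ-trans (B.≈ᴹ-sym (Hom.+ᴹ-homo f _ _)) (Hom.⟦⟧-cong f (retraction-sum s P-proj x))))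
    where
    module s = ShortExact s
    module B = LeftModule B
    σ = section s P-proj
    ρ = retraction s P-proj

  projective-stable : IsStable Projective
  projective-stable = record
    { enlarge = λ s P-proj N-proj → projective-closed s N-proj P-proj
    ; shrink = projective-shrink }

  cover-exact : ∀ M → ShortExact (syzygy M 1) (free ∣ M ∣) M
  cover-exact M = kernel-exact (cover M) (ProjectiveResolution.ε-surj (freeResolution M))

  -- Quantifying over all projective presentations lets any presentation at hand be used; `Ω⁻-from`
  -- shows that for stable `𝒱` a single one suffices.
  Ω⁻ : (Mod → Set (lsuc ℓ)) → Mod → Set (lsuc ℓ)
  Ω⁻ 𝒱 M = ∀ {N P} → ShortExact N P M → Projective P → 𝒱 N

  -- Schanuel's lemma, through the pullback of the two presentations.
  Ω⁻-from : ∀ {𝒱} → IsStable 𝒱 → ∀ {N P M} → ShortExact N P M → Projective P → 𝒱 N → Ω⁻ 𝒱 M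
  Ω⁻-from 𝒱-stable s P-proj v t Q-proj =
    let _ , s′ , t′ = pullback s t
    in shrink t′ P-proj (enlarge s′ Q-proj v)
    where open IsStable 𝒱-stable

  -- A presentation of `X` restricts to one of `N`: the kernel of its composite with `X → P` is
  -- again projective, as `P` is, and the syzygy stays the same.
  Ω⁻-stable : ∀ {𝒱} → IsStable 𝒱 → IsStable (Ω⁻ 𝒱)
  Ω⁻-stable {𝒱} 𝒱-stable = record
    { enlarge = λ s P-proj v t Q-proj →
        let _ , t₁ , t₂ = kernel-of-composite t s
        in v t₂ (projective-shrink t₁ P-proj Q-proj)
    ; shrink = λ {_} {X} s P-proj v →
        let _ , t₁ , t₂ = kernel-of-composite (cover-exact X) s
            F-proj = free-projective ∣ X ∣
        in Ω⁻-from {𝒱} 𝒱-stable t₂ (projective-shrink t₁ P-proj F-proj) (v (cover-exact X) F-proj)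
    }

  Ω⁻^ : ℕ → (Mod → Set (lsuc ℓ)) → Mod → Set (lsuc ℓ)
  Ω⁻^ zero    𝒱 = 𝒱
  Ω⁻^ (suc n) 𝒱 = Ω⁻ (Ω⁻^ n 𝒱)

  module Shift {𝒱 : Mod → Set (lsuc ℓ)} (𝒱-stable : IsStable 𝒱)
               (𝒱-closed : IsExtensionClosed 𝒱) where

    stable : ∀ n → IsStable (Ω⁻^ n 𝒱)
    stable zero    = 𝒱-stable
    stable (suc n) = Ω⁻-stable {Ω⁻^ n 𝒱} (stable n)

    from : ∀ n {N P M} → ShortExact N P M → Projective P → Ω⁻^ n 𝒱 N → Ω⁻^ (suc n) 𝒱 M
    from n = Ω⁻-from {Ω⁻^ n 𝒱} (stable n)

    enlarge : ∀ n {N X P} → ShortExact N X P → Projective P → Ω⁻^ n 𝒱 N → Ω⁻^ n 𝒱 X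
    enlarge n = IsStable.enlarge (stable n)

    shrink : ∀ n {N X P} → ShortExact N X P → Projective P → Ω⁻^ n 𝒱 X → Ω⁻^ n 𝒱 N
    shrink n = IsStable.shrink (stable n)

    private
      -- Rotating 0 → L → M → N → 0 into 0 → ΩN → Y → M → 0, where Y is L up to a projective.
      rotate : ∀ {L M N} → ShortExact L M N →
               ∃ λ Y → ShortExact L Y (free ∣ N ∣) × ShortExact (syzygy N 1) Y M
      rotate {N = N} s = pullback s (cover-exact N)

    -- The substitute for the long exact sequence. On the rotated sequence, `left` reduces to
    -- `middle` and `right` to `left` at the same `n`, while `middle` at `suc n` reduces to `right`
    -- at `n`; a full turn lowers `n` by one.
    middle : ∀ n → IsExtensionClosed (Ω⁻^ n 𝒱)
    left   : ∀ n {L M N} → ShortExact L M N → Ω⁻^ n 𝒱 M → Ω⁻^ (suc n) 𝒱 N → Ω⁻^ n 𝒱 L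
    right  : ∀ n {L M N} → ShortExact L M N → Ω⁻^ n 𝒱 L → Ω⁻^ (suc n) 𝒱 M → Ω⁻^ (suc n) 𝒱 N

    middle zero    s vL vN = 𝒱-closed s vL vN
    middle (suc n) {N = N} s vL vN = let _ , s₁ , s₂ = rotate s ; F-proj = free-projective ∣ N ∣ in
      right n s₂ (vN (cover-exact N) F-proj) (enlarge (suc n) s₁ F-proj vL)

    left n {N = N} s vM vN = let _ , s₁ , s₂ = rotate s ; F-proj = free-projective ∣ N ∣ in
      shrink n s₁ F-proj (middle n s₂ (vN (cover-exact N) F-proj) vM)

    right n {N = N} s vL vM = let _ , s₁ , s₂ = rotate s ; F-proj = free-projective ∣ N ∣ in
      from n (cover-exact N) F-proj (left n s₂ (enlarge n s₁ F-proj vL) vM)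

    from-syzygy : ∀ i j {M} → Ω⁻^ j 𝒱 (syzygy M i) → Ω⁻^ (i ℕ.+ j) 𝒱 M
    from-syzygy zero    j v = v
    from-syzygy (suc i) j {M} v = ≡.subst (λ k → Ω⁻^ k 𝒱 M) (ℕ.+-suc i j) (from-syzygy i (suc j)
      (from j (cover-exact (syzygy M i)) (free-projective _) v))

    to-syzygy : ∀ i j {M} → Ω⁻^ (i ℕ.+ j) 𝒱 M → Ω⁻^ j 𝒱 (syzygy M i)
    to-syzygy zero    j v = v
    to-syzygy (suc i) j {M} v = to-syzygy i (suc j) {M} (≡.subst (λ k → Ω⁻^ k 𝒱 M) (≡.sym (ℕ.+-suc i j)) v)
      (cover-exact (syzygy M i)) (free-projective _)

  Extendable : ∀ {K X} → Hom K X → Set ℓ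
  Extendable {K} {X} i = ∀ (ψ : Hom K regular) → Σ (Hom X regular) λ θ →
    ∀ k → LeftModule._≈ᴹ_ regular (⟦ θ ⟧ (⟦ i ⟧ k)) (⟦ ψ ⟧ k)

  -- This is Ext¹(M, R) = 0: a functional on `K` extends to `X` exactly when the pushout of the
  -- sequence along it, an extension of `M` by `R`, splits. Neither a group nor a resolution has to
  -- be chosen.
  Ext¹Vanishes : Mod → Set (lsuc ℓ)
  Ext¹Vanishes M = ∀ {K X} (s : ShortExact K X M) → Extendable (ShortExact.f s)

  -- One projective presentation is enough. A lift `h : P → X` of `P → M` restricts to `K → K′`; the
  -- functional `ψ`, pulled back to `K`, extends to `θ` on `P`. As `X` is a quotient of `P ⊞ K′`,
  -- and `θ` and `ψ` together vanish on the kernel, they descend to `X`.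
  Ext¹Vanishes-from : ∀ {K P M} (s : ShortExact K P M) → Projective P →
                      Extendable (ShortExact.f s) → Ext¹Vanishes M
  Ext¹Vanishes-from {K} {P} {M} s P-proj extend {K′} {X} t ψ =
    descend e e-surj φ e-kernel , λ k′ → A.≈ᴹ-trans
      (Hom.⟦⟧-cong (descend e e-surj φ e-kernel)
        (X.≈ᴹ-sym (X.≈ᴹ-trans (X.+ᴹ-congʳ (Hom.0ᴹ-homo h)) (X.+ᴹ-identityˡ _))))
      (A.≈ᴹ-trans (descend-∘ e e-surj φ e-kernel (P.0ᴹ , k′))
        (A.≈ᴹ-trans (A.+ᴹ-congʳ (Hom.0ᴹ-homo θ)) (A.+ᴹ-identityˡ _)))
    where
    module s = ShortExact s
    module t = ShortExact t
    module A = ModuleProperties regular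
    module M = LeftModule M
    module X = ModuleProperties X
    module P = LeftModule P
    module K′ = ModuleProperties K′
    h : Hom P X
    h = proj₁ (P-proj t.g t.surjective s.g)
    h-spec : ∀ p → ⟦ t.g ⟧ (⟦ h ⟧ p) M.≈ᴹ ⟦ s.g ⟧ p
    h-spec = proj₂ (P-proj t.g t.surjective s.g)
    hs∈ : ∀ k → ∃ λ k′ → ⟦ t.f ⟧ k′ X.≈ᴹ ⟦ h ⟧ (⟦ s.f ⟧ k)
    hs∈ k = proj₂ t.exact _ (M.≈ᴹ-trans (h-spec _) (proj₁ s.exact k))
    h∣ : Hom K K′
    h∣ = corestrict t.f t.injective (h ∘ʰ s.f) hs∈
    θ : Hom P regular
    θ = proj₁ (extend (ψ ∘ʰ h∣))
    θ-spec : ∀ k → ⟦ θ ⟧ (⟦ s.f ⟧ k) A.≈ᴹ ⟦ ψ ⟧ (⟦ h∣ ⟧ k)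
    θ-spec = proj₂ (extend (ψ ∘ʰ h∣))
    e : Hom (P ⊞ K′) X
    e = copairʰ h t.f
    φ : Hom (P ⊞ K′) regular
    φ = copairʰ θ ψ
    e-surj : IsSurjective e
    e-surj = surjective-if e λ x →
      let p , q = preimage s.g s.surjective (⟦ t.g ⟧ x)
          k′ , q′ = proj₂ t.exact (x X.- ⟦ h ⟧ p) (M.≈ᴹ-trans (⟦⟧-sub t.g _ _)
            (ModuleProperties.x≈y⇒x-y≈0 M (M.≈ᴹ-sym (M.≈ᴹ-trans (h-spec p) q))))
      in (p , k′) , X.≈ᴹ-trans (X.+ᴹ-congˡ q′) (X.≈ᴹ-trans (X.+ᴹ-comm _ _) (X.[y-x]+x≈y _ x))
    e-kernel : ∀ y → ⟦ e ⟧ y X.≈ᴹ X.0ᴹ → ⟦ φ ⟧ y A.≈ᴹ A.0ᴹ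
    e-kernel (p , k′) eq =
      let k , q = proj₂ s.exact p (M.≈ᴹ-trans (M.≈ᴹ-sym (h-spec p)) (M.≈ᴹ-trans
            (M.≈ᴹ-sym (M.≈ᴹ-trans (M.+ᴹ-congˡ (proj₁ t.exact k′)) (M.+ᴹ-identityʳ _)))
            (M.≈ᴹ-trans (M.≈ᴹ-sym (Hom.+ᴹ-homo t.g _ _))
              (M.≈ᴹ-trans (Hom.⟦⟧-cong t.g eq) (Hom.0ᴹ-homo t.g)))))
          hk+k′≈0 : (⟦ h∣ ⟧ k K′.+ᴹ k′) K′.≈ᴹ K′.0ᴹ
          hk+k′≈0 = t.injective (X.≈ᴹ-trans (Hom.+ᴹ-homo t.f _ _)
            (X.≈ᴹ-trans (X.+ᴹ-congʳ (X.≈ᴹ-trans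
              (∘-corestrict t.f t.injective (h ∘ʰ s.f) hs∈ k) (Hom.⟦⟧-cong h q)))
            (X.≈ᴹ-trans eq (X.≈ᴹ-sym (Hom.0ᴹ-homo t.f)))))
      in A.≈ᴹ-trans (A.+ᴹ-congʳ (A.≈ᴹ-trans (Hom.⟦⟧-cong θ (P.≈ᴹ-sym q)) (θ-spec k)))
        (A.≈ᴹ-trans (A.≈ᴹ-sym (Hom.+ᴹ-homo ψ _ _))
          (A.≈ᴹ-trans (Hom.⟦⟧-cong ψ hk+k′≈0) (Hom.0ᴹ-homo ψ)))

  Projective⇒Ext¹Vanishes : ∀ {P} → Projective P → Ext¹Vanishes P
  Projective⇒Ext¹Vanishes P-proj s ψ =
    ψ ∘ʰ retraction s P-proj , λ k → Hom.⟦⟧-cong ψ (retraction-∘ s P-proj k)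

  -- A functional is extended in two steps: first to the preimage of `L`, then to the whole middle
  -- term.
  Ext¹Vanishes-closed : IsExtensionClosed Ext¹Vanishes
  Ext¹Vanishes-closed s vL vN t ψ =
    let _ , t₁ , t₂ = kernel-of-composite t s
        ψ₁ , e₁ = vL t₂ ψ
        ψ₂ , e₂ = vN t₁ ψ₁
    in ψ₂ , λ k → A.≈ᴹ-trans (e₂ (⟦ ShortExact.f t₂ ⟧ k)) (e₁ k)
    where module A = LeftModule regular

  Ext¹Vanishes-stable : IsStable Ext¹Vanishes
  Ext¹Vanishes-stable = record
    { enlarge = λ s P-proj vN → Ext¹Vanishes-closed s vN (Projective⇒Ext¹Vanishes P-proj)
    ; shrink = λ {_} {X} s P-proj vX →
        let _ , t₁ , t₂ = kernel-of-composite (cover-exact X) s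
        in Ext¹Vanishes-from t₂ (projective-shrink t₁ P-proj (free-projective ∣ X ∣)) λ ψ →
             let θ , e = vX (cover-exact X) ψ
             in θ ∘ʰ ShortExact.f t₁ , e
    }

  module Ext = Shift {Ext¹Vanishes} Ext¹Vanishes-stable Ext¹Vanishes-closed
  module Pd = Shift {Projective} projective-stable projective-closed

  -- Extⁱ⁺¹(M, R) = 0
  ExtVanishes : ℕ → Mod → Set (lsuc ℓ)
  ExtVanishes i = Ω⁻^ i Ext¹Vanishes

  PdAtMost : ℕ → Mod → Set (lsuc ℓ)
  PdAtMost n = Ω⁻^ n Projective

  Projective⇒ExtVanishes : ∀ i {P} → Projective P → ExtVanishes i P
  Projective⇒ExtVanishes zero    P-proj = Projective⇒Ext¹Vanishes P-proj
  Projective⇒ExtVanishes (suc i) P-proj s Q-proj =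
    Projective⇒ExtVanishes i (projective-shrink s P-proj Q-proj)

  PdAtMost-suc : ∀ n {M} → PdAtMost n M → PdAtMost (suc n) M
  PdAtMost-suc zero    M-proj s P-proj = projective-shrink s M-proj P-proj
  PdAtMost-suc (suc n) p s P-proj = PdAtMost-suc n (p s P-proj)

  PdAtMost-+ : ∀ k n {M} → PdAtMost n M → PdAtMost (k ℕ.+ n) M
  PdAtMost-+ zero    n p = p
  PdAtMost-+ (suc k) n p = PdAtMost-suc (k ℕ.+ n) (PdAtMost-+ k n p)

  PdAtMost⇒ExtVanishes : ∀ n i {M} → PdAtMost n M → ExtVanishes (n ℕ.+ i) M
  PdAtMost⇒ExtVanishes zero    i p = Projective⇒ExtVanishes i p
  PdAtMost⇒ExtVanishes (suc n) i p s P-proj = PdAtMost⇒ExtVanishes n i (p s P-proj)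

  -- Cocycles of degree `suc i` are the functionals on the syzygy of that order, pulled back along
  -- its cover; a cochain bounding such a cocycle is an extension of the functional to the free
  -- module below. Reading this off at the generators `var k` gives the claim.
  E-zero⇒ExtVanishes : ∀ i {M} → IsZero (E (suc i) M) → ExtVanishes i M
  E-zero⇒ExtVanishes i {M} z = ≡.subst (λ k → ExtVanishes k M) (ℕ.+-identityʳ i)
    (Ext.from-syzygy i 0 (Ext¹Vanishes-from (cover-exact (syzygy M i)) (free-projective _) extend))
    where
    module A = ModuleProperties regular
    cov = cover (syzygy M (suc i))
    extend : Extendable (kernel-inclusion (cover (syzygy M i)))
    extend ψ =
      let θ , e = z (ψ ∘ʰ cov , λ x → A.≈ᴹ-trans
                      (Hom.⟦⟧-cong ψ (proj₂ (⟦ cover (syzygy M (suc (suc i))) ⟧ x))) (Hom.0ᴹ-homo ψ))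
      in θ , λ k → A.≈ᴹ-sym (A.≈ᴹ-trans (A.≈ᴹ-sym (A.x-0≈x _)) (e (var k)))

  ExtVanishes⇒E-zero : ∀ i {M} → ExtVanishes i M → IsZero (E (suc i) M)
  ExtVanishes⇒E-zero i {M} v (φ , φ-cocycle) =
    let θ , e = Ext.to-syzygy i 0 (≡.subst (λ k → ExtVanishes k M) (≡.sym (ℕ.+-identityʳ i)) v)
                  (cover-exact (syzygy M i)) ψ
    in θ , λ x → A.≈ᴹ-trans (A.x-0≈x _)
         (A.≈ᴹ-trans (A.≈ᴹ-sym (descend-∘ cov cov-surj φ φ-kernel x)) (A.≈ᴹ-sym (e (⟦ cov ⟧ x))))
    where
    module A = ModuleProperties regular
    cov = cover (syzygy M (suc i))
    cov-surj = ShortExact.surjective (cover-exact (syzygy M (suc i)))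
    φ-kernel : ∀ x → LeftModule._≈ᴹ_ (syzygy M (suc i)) (⟦ cov ⟧ x) (LeftModule.0ᴹ (syzygy M (suc i))) →
               ⟦ φ ⟧ x A.≈ᴹ A.0ᴹ
    -- The pair `(x , p)` is an element of the next syzygy, hence a generator of the next free
    -- module, and the differential sends it to `x`.
    φ-kernel x p = φ-cocycle (var (x , p))
    ψ : Hom (syzygy M (suc i)) regular
    ψ = descend cov cov-surj φ φ-kernel

i≤∣i∣ : ∀ i → i ℤ.≤ + ℤ.∣ i ∣
i≤∣i∣ (+ n)    = ℤ.≤-refl
i≤∣i∣ -[1+ n ] = ℤ.-≤+

-- Translation between the given `pd` and `pd⋆` and the inductive notions.

module Resolutions {ℓ : Level} (R : Ring ℓ ℓ) where

  open Homological R
  open Hom using (⟦_⟧)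
  open Modules R
  open Dimension R

  -- This is pd⋆ ≤ k: since `ExtVanishes` counts from Ext¹, the index `k` already stands for the
  -- first group beyond the bound.
  ExtVanishesFrom : ℕ → Mod → Set (lsuc ℓ)
  ExtVanishesFrom k M = ∀ i → ExtVanishes (k ℕ.+ i) M

  ExtDimensionAtMost : ℕ → Set (lsuc ℓ)
  ExtDimensionAtMost k = ∀ M → FinitelyGenerated M → ExtVanishesFrom k M

  pd⋆⇒ExtVanishesFrom : ∀ k {M} → pd⋆ M ≤ (+ k) → ExtVanishesFrom k M
  pd⋆⇒ExtVanishesFrom k z i =
    E-zero⇒ExtVanishes (k ℕ.+ i) (z (suc (k ℕ.+ i)) (ℤ.+<+ (ℕ.s≤s (ℕ.m≤m+n k i))))

  ExtVanishesFrom⇒pd⋆ : ∀ k {M} → ExtVanishesFrom k M → pd⋆ M ≤ (+ k)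
  ExtVanishesFrom⇒pd⋆ k {M} v i (ℤ.+<+ k<i) with j , eq ← ℕ.m≤n⇒∃[o]m+o≡n k<i =
    ≡.subst (λ n → IsZero (E n M)) eq (ExtVanishes⇒E-zero (k ℕ.+ j) (v j))

  shift-resolution : ∀ {M} (P• : ProjectiveResolution M) →
                     ProjectiveResolution (kernel (ProjectiveResolution.ε P•))
  shift-resolution P• = record
    { P = λ n → P (suc n) ; projective = λ n → projective (suc n) ; d = λ n → d (suc n)
    ; ε = ε′
    ; ε-surj = surjective-if ε′ λ (y , p) → proj₂ exact₀ y p
    ; exact₀ = proj₁ (exact 0) , proj₂ (exact 0)
    ; exact = λ n → exact (suc n) }
    where
    open ProjectiveResolution P•
    module P₀ = LeftModule (P 0)
    ε′ : Hom (P 1) (kernel ε)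
    ε′ = corestrict (kernel-inclusion ε) (λ e → e) (d 0)
      (λ x → (⟦ d 0 ⟧ x , proj₁ exact₀ x) , P₀.≈ᴹ-refl)

  PdAtMost-from-resolution : ∀ n {M} (P• : ProjectiveResolution M) →
    (∀ i → n ℕ.< i → IsZeroᴹ (ProjectiveResolution.P P• i)) → PdAtMost n M
  PdAtMost-from-resolution zero {M} P• z =
    retract-projective ε⁻¹ ε (λ m → let x , e = preimage ε ε-surj m in
      M.≈ᴹ-trans (Hom.⟦⟧-cong ε (P₀.≈ᴹ-trans (Hom.⟦⟧-cong ε⁻¹ (M.≈ᴹ-sym e))
        (descend-∘ ε ε-surj idʰ ε-kernel x))) e) (projective 0)
    where
    open ProjectiveResolution P•
    module M = LeftModule M
    module P₀ = LeftModule (P 0)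
    ε-kernel : ∀ x → ⟦ ε ⟧ x M.≈ᴹ M.0ᴹ → x P₀.≈ᴹ P₀.0ᴹ
    ε-kernel x p = let y , e = proj₂ exact₀ x p in
      P₀.≈ᴹ-trans (P₀.≈ᴹ-sym e) (P₀.≈ᴹ-trans
        (Hom.⟦⟧-cong (d 0) (z 1 (ℕ.s≤s ℕ.z≤n) y)) (Hom.0ᴹ-homo (d 0)))
    ε⁻¹ : Hom M (P 0)
    ε⁻¹ = descend ε ε-surj idʰ ε-kernel
  PdAtMost-from-resolution (suc n) P• z =
    Pd.from n (kernel-exact ε ε-surj) (projective 0)
      (PdAtMost-from-resolution n (shift-resolution P•) (λ i n<i → z (suc i) (ℕ.s≤s n<i)))
    where open ProjectiveResolution P•

  pd⇒PdAtMost : ∀ {k M} n → k ℤ.≤ + n → pd M ≤ k → PdAtMost n M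
  pd⇒PdAtMost n k≤n (P• , z) = PdAtMost-from-resolution n P•
    (λ i n<i → z i (ℤ.≤-<-trans k≤n (ℤ.+<+ n<i)))

  private
    trivialResolution : ∀ {M} → Projective M → ProjectiveResolution M
    trivialResolution {M} M-proj = record
      { P = P′
      ; projective = λ { zero → M-proj ; (suc _) → zero-projective {zeroᴹ} (λ _ → _) }
      ; d = λ _ → 0ʰ
      ; ε = idʰ ; ε-surj = surjective-if (idʰ {M}) (λ y → y , M.≈ᴹ-refl)
      ; exact₀ = (λ _ → M.≈ᴹ-refl) , (λ y p → _ , M.≈ᴹ-sym p)
      ; exact = λ n → (λ _ → LeftModule.≈ᴹ-refl (P′ n)) , (λ _ _ → _ , _) }
      where
      module M = LeftModule M
      P′ : ℕ → Mod
      P′ zero    = M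
      P′ (suc _) = zeroᴹ

    splice : ∀ {N P M} → ShortExact N P M → Projective P → ProjectiveResolution N →
             ProjectiveResolution M
    splice {N} {P} {M} s P-proj Q• = record
      { P = P′ ; projective = λ { zero → P-proj ; (suc n) → Q.projective n }
      ; d = d′ ; ε = s.g ; ε-surj = s.surjective
      ; exact₀ = (λ x → proj₁ s.exact _) ,
          (λ y p → let n , e = proj₂ s.exact y p ; x , e′ = preimage Q.ε Q.ε-surj n in
            x , P.≈ᴹ-trans (Hom.⟦⟧-cong s.f e′) e)
      ; exact = λ
          { zero → (λ x → P.≈ᴹ-trans (Hom.⟦⟧-cong s.f (proj₁ Q.exact₀ x)) (Hom.0ᴹ-homo s.f)) ,
              (λ y p → proj₂ Q.exact₀ y (s.injective (P.≈ᴹ-trans p (P.≈ᴹ-sym (Hom.0ᴹ-homo s.f)))))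
          ; (suc n) → Q.exact n } }
      where
      module s = ShortExact s
      module Q = ProjectiveResolution Q•
      module P = LeftModule P
      P′ : ℕ → Mod
      P′ zero    = P
      P′ (suc n) = Q.P n
      d′ : ∀ n → Hom (P′ (suc n)) (P′ n)
      d′ zero    = s.f ∘ʰ Q.ε
      d′ (suc n) = Q.d n

  PdAtMost⇒pd : ∀ n {M} → PdAtMost n M → pd M ≤ (+ n)
  PdAtMost⇒pd zero M-proj = trivialResolution M-proj ,
    λ { zero (ℤ.+<+ ()) ; (suc _) _ → λ _ → _ }
  PdAtMost⇒pd (suc n) {M} p =
    let P• , z = PdAtMost⇒pd n (p (cover-exact M) (free-projective ∣ M ∣))
    in splice (cover-exact M) (free-projective ∣ M ∣) P• ,
       λ { zero (ℤ.+<+ ()) ; (suc i) (ℤ.+<+ (ℕ.s≤s n<i)) → z i (ℤ.+<+ n<i) }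

  FinitePd⇒PdAtMost : ∀ {M} → FinitePd M → ∃ λ n → PdAtMost n M
  FinitePd⇒PdAtMost (k , p) = ℤ.∣ k ∣ , pd⇒PdAtMost ℤ.∣ k ∣ (i≤∣i∣ k) p

  -- Only finiteness matters, so both bounds are raised to a crude common one; `Pd.left` allows `N`
  -- one more than `M`.
  FinitePd-left : ∀ {L M N} → ShortExact L M N → FinitePd M → FinitePd N → FinitePd L
  FinitePd-left {L} {M} {N} s pM pN =
    let m , pM′ = FinitePd⇒PdAtMost pM
        n , pN′ = FinitePd⇒PdAtMost pN
    in + (n ℕ.+ m) , PdAtMost⇒pd (n ℕ.+ m) (Pd.left (n ℕ.+ m) s (PdAtMost-+ n m pM′)
         (≡.subst (λ k → PdAtMost k N) (≡.cong suc (ℕ.+-comm m n)) (PdAtMost-+ (suc m) n pN′)))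

  FinitePd-right : ∀ {L M N} → ShortExact L M N → FinitePd L → FinitePd M → FinitePd N
  FinitePd-right {L} {M} {N} s pL pM =
    let l , pL′ = FinitePd⇒PdAtMost pL
        m , pM′ = FinitePd⇒PdAtMost pM
    in + suc (m ℕ.+ l) , PdAtMost⇒pd (suc (m ℕ.+ l)) (Pd.right (m ℕ.+ l) s (PdAtMost-+ m l pL′)
         (≡.subst (λ k → PdAtMost k M) (≡.cong suc (ℕ.+-comm l m)) (PdAtMost-+ (suc l) m pM′)))

-- Free modules of finite rank and finitely generated modules over a noetherian ring.

module FiniteGeneration {ℓ : Level} (R : Ring ℓ ℓ) where

  open Ring R using (Carrier; _≈_; _+_; _*_; 0#; 1#)
  private module R = Ring R
  open Homological R
  open Hom using (⟦_⟧)
  open Modules R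
  open Dimension R
  open Resolutions R

  infix 8 R^_
  R^_ : ℕ → Mod
  R^ n = record
    { Carrierᴹ = Vector Carrier n
    ; _≈ᴹ_ = λ c c′ → ∀ i → c i ≈ c′ i
    ; _+ᴹ_ = λ c c′ i → c i + c′ i
    ; _*ₗ_ = λ r c i → r * c i
    ; 0ᴹ = λ _ → 0#
    ; -ᴹ_ = λ c i → R.- c i
    ; isLeftModule = record
      { isLeftSemimodule = record
        { +ᴹ-isCommutativeMonoid = record
          { isMonoid = record
            { isSemigroup = record
              { isMagma = record
                { isEquivalence = record
                  { refl = λ _ → R.refl ; sym = λ p i → R.sym (p i)
                  ; trans = λ p q i → R.trans (p i) (q i) }
                ; ∙-cong = λ p q i → R.+-cong (p i) (q i)
                }
              ; assoc = λ _ _ _ _ → R.+-assoc _ _ _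
              }
            ; identity = (λ _ _ → R.+-identityˡ _) , (λ _ _ → R.+-identityʳ _)
            }
          ; comm = λ _ _ _ → R.+-comm _ _
          }
        ; isPreleftSemimodule = record
          { *ₗ-cong = λ r c i → R.*-cong r (c i)
          ; *ₗ-zeroˡ = λ _ _ → R.zeroˡ _
          ; *ₗ-distribʳ = λ _ _ _ _ → R.distribʳ _ _ _
          ; *ₗ-identityˡ = λ _ _ → R.*-identityˡ _
          ; *ₗ-assoc = λ _ _ _ _ → R.*-assoc _ _ _
          ; *ₗ-zeroʳ = λ _ _ → R.zeroʳ _
          ; *ₗ-distribˡ = λ _ _ _ _ → R.distribˡ _ _ _
          }
        }
      ; -ᴹ‿cong = λ p i → R.-‿cong (p i)
      ; -ᴹ‿inverse = (λ _ _ → R.-‿inverseˡ _) , (λ _ _ → R.-‿inverseʳ _)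
      }
    }

  basis : ∀ {n} → Fin n → Vector Carrier n
  basis zero    zero    = 1#
  basis zero    (suc _) = 0#
  basis (suc _) zero    = 0#
  basis (suc i) (suc j) = basis i j

  module _ (M : Mod) where

    private module M = ModuleProperties M

    linearCombination-cong : ∀ {n} {c c′ : Vector Carrier n} {x x′ : Vector ∣ M ∣ n} →
      (∀ i → c i ≈ c′ i) → (∀ i → x i M.≈ᴹ x′ i) →
      linearCombination M c x M.≈ᴹ linearCombination M c′ x′
    linearCombination-cong {zero}  p q = M.≈ᴹ-refl
    linearCombination-cong {suc n} p q = M.+ᴹ-cong (M.*ₗ-cong (p zero) (q zero))
      (linearCombination-cong (λ i → p (suc i)) (λ i → q (suc i)))

    linearCombination-+ : ∀ {n} (c c′ : Vector Carrier n) (x : Vector ∣ M ∣ n) →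
      linearCombination M (λ i → c i + c′ i) x M.≈ᴹ
      linearCombination M c x M.+ᴹ linearCombination M c′ x
    linearCombination-+ {zero}  c c′ x = M.≈ᴹ-sym M.0+0≈0
    linearCombination-+ {suc n} c c′ x = M.≈ᴹ-trans
      (M.+ᴹ-cong (M.*ₗ-distribʳ _ _ _) (linearCombination-+ (c ∘ suc) (c′ ∘ suc) (x ∘ suc)))
      (M.interchange _ _ _ _)

    linearCombination-* : ∀ {n} r (c : Vector Carrier n) (x : Vector ∣ M ∣ n) →
      linearCombination M (λ i → r * c i) x M.≈ᴹ r M.*ₗ linearCombination M c x
    linearCombination-* {zero}  r c x = M.≈ᴹ-sym (M.*ₗ-zeroʳ r)
    linearCombination-* {suc n} r c x = M.≈ᴹ-trans
      (M.+ᴹ-cong (M.*ₗ-assoc _ _ _) (linearCombination-* r (c ∘ suc) (x ∘ suc)))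
      (M.≈ᴹ-sym (M.*ₗ-distribˡ _ _ _))

    linearCombination-0 : ∀ {n} (x : Vector ∣ M ∣ n) →
      linearCombination M (λ _ → 0#) x M.≈ᴹ M.0ᴹ
    linearCombination-0 {zero}  x = M.≈ᴹ-refl
    linearCombination-0 {suc n} x = M.≈ᴹ-trans
      (M.+ᴹ-cong (M.*ₗ-zeroˡ _) (linearCombination-0 (x ∘ suc))) M.0+0≈0

    linearCombination-basis : ∀ {n} (i : Fin n) (x : Vector ∣ M ∣ n) →
      linearCombination M (basis i) x M.≈ᴹ x i
    linearCombination-basis zero x = M.≈ᴹ-trans
      (M.+ᴹ-cong (M.*ₗ-identityˡ _) (linearCombination-0 (x ∘ suc))) (M.+ᴹ-identityʳ _)
    linearCombination-basis (suc i) x = M.≈ᴹ-trans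
      (M.+ᴹ-cong (M.*ₗ-zeroˡ _) (linearCombination-basis i (x ∘ suc))) (M.+ᴹ-identityˡ _)

    combine : ∀ {n} → Vector ∣ M ∣ n → Hom (R^ n) M
    combine {n} x = mkHom (R^ n) M (λ c → linearCombination M c x)
      (λ p → linearCombination-cong p (λ _ → M.≈ᴹ-refl))
      (λ c c′ → linearCombination-+ c c′ x) (λ r c → linearCombination-* r c x)

    Span : ∀ {n} → Vector ∣ M ∣ n → Pred ∣ M ∣ ℓ
    Span x m = ∃ λ c → linearCombination M c x M.≈ᴹ m

    record IsSubmodule (U : Pred ∣ M ∣ ℓ) : Set ℓ where
      field
        resp     : ∀ {x y} → x M.≈ᴹ y → x ∈ U → y ∈ U
        0∈       : M.0ᴹ ∈ U
        +-closed : ∀ {x y} → x ∈ U → y ∈ U → (x M.+ᴹ y) ∈ U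
        *-closed : ∀ r {x} → x ∈ U → (r M.*ₗ x) ∈ U

      linearCombination∈ : ∀ {n} (c : Vector Carrier n) {x : Vector ∣ M ∣ n} →
                           (∀ i → x i ∈ U) → linearCombination M c x ∈ U
      linearCombination∈ {zero}  c x∈ = 0∈
      linearCombination∈ {suc n} c x∈ =
        +-closed (*-closed (c zero) (x∈ zero)) (linearCombination∈ (c ∘ suc) (x∈ ∘ suc))

      Span⊆ : ∀ {n} {x : Vector ∣ M ∣ n} → (∀ i → x i ∈ U) → ∀ {m} → Span x m → m ∈ U
      Span⊆ x∈ (c , e) = resp e (linearCombination∈ c x∈)

      sub-closed : ∀ {x y} → x ∈ U → y ∈ U → (x M.- y) ∈ U
      sub-closed x∈ y∈ = +-closed x∈ (resp -1*y≈-y (*-closed (R.- 1#) y∈))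
        where
        -1*y≈-y : ∀ {y} → (R.- 1#) M.*ₗ y M.≈ᴹ M.-ᴹ y
        -1*y≈-y {y} = M.inverseˡ-unique _ _ (M.≈ᴹ-trans
          (M.+ᴹ-congˡ (M.≈ᴹ-sym (M.*ₗ-identityˡ y)))
          (M.≈ᴹ-trans (M.≈ᴹ-sym (M.*ₗ-distribʳ y _ _))
            (M.≈ᴹ-trans (M.*ₗ-congʳ (R.-‿inverseˡ 1#)) (M.*ₗ-zeroˡ y))))

    open IsSubmodule

    Span-isSubmodule : ∀ {n} (x : Vector ∣ M ∣ n) → IsSubmodule (Span x)
    Span-isSubmodule x = record
      { resp = λ e (c , p) → c , M.≈ᴹ-trans p e
      ; 0∈ = (λ _ → 0#) , linearCombination-0 x
      ; +-closed = λ (c , p) (c′ , p′) → (λ i → c i + c′ i) ,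
          M.≈ᴹ-trans (linearCombination-+ c c′ x) (M.+ᴹ-cong p p′)
      ; *-closed = λ r (c , p) → (λ i → r * c i) ,
          M.≈ᴹ-trans (linearCombination-* r c x) (M.*ₗ-congˡ p) }

    generator∈Span : ∀ {n} (x : Vector ∣ M ∣ n) i → Span x (x i)
    generator∈Span x i = basis i , linearCombination-basis i x

    Span-++ˡ : ∀ {k l} (u : Vector ∣ M ∣ k) (v : Vector ∣ M ∣ l) {m} → Span u m → Span (u ++ v) m
    Span-++ˡ {k} {l} u v = Span⊆ (Span-isSubmodule (u ++ v)) λ i →
      ≡.subst (Span (u ++ v)) (≡.cong [ u , v ] (Fin.splitAt-↑ˡ k i l))
        (generator∈Span (u ++ v) (i Fin.↑ˡ l))

    Span-++ʳ : ∀ {k l} (u : Vector ∣ M ∣ k) (v : Vector ∣ M ∣ l) {m} → Span v m → Span (u ++ v) m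
    Span-++ʳ {k} {l} u v = Span⊆ (Span-isSubmodule (u ++ v)) λ i →
      ≡.subst (Span (u ++ v)) (≡.cong [ u , v ] (Fin.splitAt-↑ʳ k l i))
        (generator∈Span (u ++ v) (k Fin.↑ʳ i))

  ⟦⟧-linearCombination : ∀ {M N} (f : Hom M N) {n} (c : Vector Carrier n) (x : Vector ∣ M ∣ n) →
    LeftModule._≈ᴹ_ N (⟦ f ⟧ (linearCombination M c x)) (linearCombination N c (λ i → ⟦ f ⟧ (x i)))
  ⟦⟧-linearCombination f {zero}  c x = Hom.0ᴹ-homo f
  ⟦⟧-linearCombination {N = N} f {suc n} c x = N.≈ᴹ-trans (Hom.+ᴹ-homo f _ _)
    (N.+ᴹ-cong (Hom.*ₗ-homo f _ _) (⟦⟧-linearCombination f (c ∘ suc) (x ∘ suc)))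
    where module N = LeftModule N

  linearCombination-assoc : ∀ (M : Mod) {n} (c r : Vector Carrier n) (x : Vector ∣ M ∣ n) →
    let open LeftModule M in
    linearCombination M c (λ i → r i *ₗ x i) ≈ᴹ linearCombination M (λ i → c i * r i) x
  linearCombination-assoc M {zero}  c r x = LeftModule.≈ᴹ-refl M
  linearCombination-assoc M {suc n} c r x = M.+ᴹ-cong (M.≈ᴹ-sym (M.*ₗ-assoc _ _ _))
    (linearCombination-assoc M (c ∘ suc) (r ∘ suc) (x ∘ suc))
    where module M = LeftModule M

  linearCombination-zeros : ∀ (M : Mod) {n} (c : Vector Carrier n) (x : Vector ∣ M ∣ n) →
    let open LeftModule M in (∀ i → x i ≈ᴹ 0ᴹ) → linearCombination M c x ≈ᴹ 0ᴹ
  linearCombination-zeros M {zero}  c x x≈0 = LeftModule.≈ᴹ-refl M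
  linearCombination-zeros M {suc n} c x x≈0 = M.≈ᴹ-trans
    (M.+ᴹ-cong (M.≈ᴹ-trans (M.*ₗ-congˡ (x≈0 zero)) (M.*ₗ-zeroʳ _))
      (linearCombination-zeros M (c ∘ suc) (x ∘ suc) (x≈0 ∘ suc))) (M.+ᴹ-identityˡ _)
    where module M = LeftModule M

  linearCombination-pointwise : ∀ {k n} (c : Vector Carrier k) (x : Vector (Vector Carrier n) k) j →
    linearCombination (R^ n) c x j ≈ linearCombination regular c (λ i → x i j)
  linearCombination-pointwise {zero}  c x j = R.refl
  linearCombination-pointwise {suc k} c x j =
    R.+-congˡ (linearCombination-pointwise (c ∘ suc) (x ∘ suc) j)

  private
    basis-column : ∀ {n} (c : Vector Carrier n) j →
      linearCombination regular c (λ i → basis i j) ≈ c j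
    basis-column {suc n} c zero = R.trans
      (R.+-cong (R.*-identityʳ _) (zeros (c ∘ suc))) (R.+-identityʳ _)
      where
      zeros : ∀ {n} (c : Vector Carrier n) → linearCombination regular c (λ _ → 0#) ≈ 0#
      zeros {zero}  c = R.refl
      zeros {suc n} c = R.trans (R.+-cong (R.zeroʳ _) (zeros (c ∘ suc))) (R.+-identityˡ _)
    basis-column {suc n} c (suc j) = R.trans
      (R.+-cong (R.zeroʳ _) (basis-column (c ∘ suc) j)) (R.+-identityˡ _)

  basis-generates : ∀ {n} (c : Vector Carrier n) j → linearCombination (R^ n) c basis j ≈ c j
  basis-generates c j = R.trans (linearCombination-pointwise c basis j) (basis-column c j)

  R^-finitelyGenerated : ∀ n → FinitelyGenerated (R^ n)
  R^-finitelyGenerated n = n , basis , λ c → c , basis-generates c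

  ⟦⟧-basis : ∀ {n N} (f : Hom (R^ n) N) c →
    LeftModule._≈ᴹ_ N (⟦ f ⟧ c) (linearCombination N c (λ i → ⟦ f ⟧ (basis i)))
  ⟦⟧-basis {N = N} f c = LeftModule.≈ᴹ-trans N
    (Hom.⟦⟧-cong f (λ j → R.sym (basis-generates c j))) (⟦⟧-linearCombination f c basis)

  R^-projective : ∀ n → Projective (R^ n)
  R^-projective n {X} {Y} g g-surj f = combine X (proj₁ ∘ lift) , λ c →
    Y.≈ᴹ-trans (⟦⟧-linearCombination g c (proj₁ ∘ lift)) (Y.≈ᴹ-trans
      (linearCombination-cong Y (λ _ → R.refl) (proj₂ ∘ lift)) (Y.≈ᴹ-sym (⟦⟧-basis f c)))
    where
    module Y = LeftModule Y
    lift : ∀ i → ∃ λ x → ⟦ g ⟧ x Y.≈ᴹ ⟦ f ⟧ (basis i)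
    lift i = preimage g g-surj (⟦ f ⟧ (basis i))

  presentation : ∀ {M} → FinitelyGenerated M →
                 ∃ λ n → Σ (Hom (R^ n) M) λ π → IsSurjective π
  presentation {M} (n , x , gen) = n , combine M x , surjective-if (combine M x) gen

  FinitelyGenerated-quotient : ∀ {M N} (f : Hom M N) → IsSurjective f →
                               FinitelyGenerated M → FinitelyGenerated N
  FinitelyGenerated-quotient {M} {N} f f-surj (n , x , gen) = n , (λ i → ⟦ f ⟧ (x i)) , λ y →
    let m , e = preimage f f-surj y
        c , p = gen m
    in c , N.≈ᴹ-trans (N.≈ᴹ-sym (⟦⟧-linearCombination f c x)) (N.≈ᴹ-trans (Hom.⟦⟧-cong f p) e)
    where module N = LeftModule N

  FinitelyGenerated-extension : ∀ {L M N} → ShortExact L M N →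
    FinitelyGenerated L → FinitelyGenerated N → FinitelyGenerated M
  FinitelyGenerated-extension {L} {M} {N} s (k , x , genL) (l , y , genN) =
    k ℕ.+ l , u ++ v , λ m →
      let c , p = genN (⟦ s.g ⟧ m)
          w = linearCombination M c v
          a , q = proj₂ s.exact (m M.- w) (N.≈ᴹ-trans (⟦⟧-sub s.g m w) (N.x≈y⇒x-y≈0
                    (N.≈ᴹ-trans (N.≈ᴹ-sym p) (N.≈ᴹ-sym (N.≈ᴹ-trans (⟦⟧-linearCombination s.g c v)
                      (linearCombination-cong N (λ _ → R.refl) (λ i → proj₂ (lift (y i)))))))))
          c′ , p′ = genL a
          module S = IsSubmodule (Span-isSubmodule M (u ++ v))
      in S.resp (M.[y-x]+x≈y w m) (S.+-closed
           (Span-++ˡ M u v (c′ , M.≈ᴹ-trans (M.≈ᴹ-sym (⟦⟧-linearCombination s.f c′ x))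
             (M.≈ᴹ-trans (Hom.⟦⟧-cong s.f p′) q)))
           (Span-++ʳ M u v (c , M.≈ᴹ-refl)))
    where
    module s = ShortExact s
    module M = ModuleProperties M
    module N = ModuleProperties N
    lift = preimage s.g s.surjective
    u = λ i → ⟦ s.f ⟧ (x i)
    v = λ i → proj₁ (lift (y i))

  module _ (noetherian : LeftNoetherian) (M : Mod) where

    private module M = ModuleProperties M

    -- Induction on the number of generators. The coefficients at the first generator that occur in
    -- `U`, modulo the span of the others, form the ideal `I`; lifts of generators of `I`, together
    -- with generators of the part `U′` of `U` inside that span, generate `U`.
    submodule-finitelyGenerated : ∀ {n} (x : Vector ∣ M ∣ n) {U : Pred ∣ M ∣ ℓ} →
      IsSubmodule M U → (∀ {u} → u ∈ U → Span M x u) →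
      ∃ λ k → Σ (Vector ∣ M ∣ k) λ y → (∀ i → y i ∈ U) × (∀ {u} → u ∈ U → Span M y u)
    submodule-finitelyGenerated {zero} x U-sub U⊆ = 0 , x , (λ ()) , U⊆
    submodule-finitelyGenerated {suc n} x {U} U-sub U⊆ =
      let k , r , r∈I , I⊆ = noetherian I I-ideal
          l , v , v∈ , U′⊆ = submodule-finitelyGenerated (x ∘ suc) U′-sub proj₂
          u = λ i → proj₁ (r∈I i)
          z = λ i → u i , r i
          module S = IsSubmodule (Span-isSubmodule M (u ++ v))
      in k ℕ.+ l , u ++ v
       , (λ i → ++-∈ u v (λ i → proj₁ (proj₂ (r∈I i))) (λ i → proj₁ (v∈ i)) i)
       , λ {m} m∈ →
         let c , p = U⊆ m∈
             m-cx∈ : Span M (x ∘ suc) (m M.- c zero M.*ₗ x zero)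
             m-cx∈ = c ∘ suc , M.≈ᴹ-trans (M.≈ᴹ-sym (M.x+y-x≈y _ _)) (M.+ᴹ-congʳ p)
             -- The combination `w` of the lifts has the same leading coefficient `c zero` as `m`,
             -- so `m - w` falls into `U′`.
             a , q = I⊆ (m , m∈ , m-cx∈)
             w = linearCombination M a u
             w∈ = U.linearCombination∈ a (λ i → proj₁ (proj₂ (r∈I i)))
             φw : ⟦ φ ⟧ (linearCombination (M ⊞ regular) a z) M.≈ᴹ w M.- c zero M.*ₗ x zero
             φw = M.+ᴹ-cong (⟦⟧-linearCombination (fstʰ {M} {regular}) a z) (M.-ᴹ‿cong (M.*ₗ-congʳ
                    (R.trans (⟦⟧-linearCombination (sndʰ {M} {regular}) a z) q)))
             w-rx∈ : Span M (x ∘ suc) (w M.- c zero M.*ₗ x zero)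
             w-rx∈ = S′.resp (M.≈ᴹ-trans (M.≈ᴹ-sym (⟦⟧-linearCombination φ a z)) φw)
                       (S′.linearCombination∈ a (λ i → proj₂ (proj₂ (r∈I i))))
             m-w∈ : Span M (x ∘ suc) (m M.- w)
             m-w∈ = S′.resp (M.≈ᴹ-trans (M.+ᴹ-congˡ (M.⁻¹-anti-homo‿- _ _)) (M.sub-sub _ _ _))
                      (S′.sub-closed m-cx∈ w-rx∈)
         in S.resp (M.[y-x]+x≈y w m) (S.+-closed
              (Span-++ʳ M u v (U′⊆ (U.sub-closed m∈ w∈ , m-w∈)))
              (Span-++ˡ M u v (a , M.≈ᴹ-refl)))
      where
      module U = IsSubmodule U-sub
      module S′ = IsSubmodule (Span-isSubmodule M (x ∘ suc))
      -- The map (u, r) ↦ u - r x₀ is linear in the pair, so the closure properties of `I` and the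
      -- computation with `w` are homomorphism laws.
      φ : Hom (M ⊞ regular) M
      φ = fstʰ -ʰ (mkHom regular M (M._*ₗ x zero) M.*ₗ-congʳ
                     (λ r s → M.*ₗ-distribʳ _ r s) (λ r s → M.*ₗ-assoc r s _) ∘ʰ sndʰ)
      I : Pred Carrier ℓ
      I r = ∃ λ u → u ∈ U × Span M (x ∘ suc) (u M.- r M.*ₗ x zero)
      I-ideal : IsLeftIdeal I
      I-ideal = record
        { resp = λ e (u , u∈ , s) → u , u∈ , S′.resp (M.+ᴹ-congˡ (M.-ᴹ‿cong (M.*ₗ-congʳ e))) s
        ; 0∈ = M.0ᴹ , U.0∈ , S′.resp (M.≈ᴹ-sym (Hom.0ᴹ-homo φ)) S′.0∈
        ; +-closed = λ (u , u∈ , s) (u′ , u∈′ , s′) → u M.+ᴹ u′ , U.+-closed u∈ u∈′ ,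
            S′.resp (M.≈ᴹ-sym (Hom.+ᴹ-homo φ (u , _) (u′ , _))) (S′.+-closed s s′)
        ; *-closed = λ r (u , u∈ , s) → r M.*ₗ u , U.*-closed r u∈ ,
            S′.resp (M.≈ᴹ-sym (Hom.*ₗ-homo φ r (u , _))) (S′.*-closed r s) }
      U′ : Pred ∣ M ∣ ℓ
      U′ m = m ∈ U × Span M (x ∘ suc) m
      U′-sub : IsSubmodule M U′
      U′-sub = record
        { resp = λ e (p , q) → U.resp e p , S′.resp e q
        ; 0∈ = U.0∈ , S′.0∈
        ; +-closed = λ (p , q) (p′ , q′) → U.+-closed p p′ , S′.+-closed q q′
        ; *-closed = λ r (p , q) → U.*-closed r p , S′.*-closed r q }
      ++-∈ : ∀ {k l} (u : Vector ∣ M ∣ k) (v : Vector ∣ M ∣ l) → (∀ i → u i ∈ U) →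
             (∀ i → v i ∈ U) → ∀ i → (u ++ v) i ∈ U
      ++-∈ {k} u v u∈ v∈ i with Fin.splitAt k i
      ... | inj₁ j = u∈ j
      ... | inj₂ j = v∈ j

  FinitelyGenerated-submodule : LeftNoetherian → ∀ {L M} (f : Hom L M) → IsInjective f →
                                FinitelyGenerated M → FinitelyGenerated L
  FinitelyGenerated-submodule noetherian {L} {M} f f-inj (n , x , gen) =
    let k , y , y∈ , U⊆ = submodule-finitelyGenerated noetherian M x U-sub (λ {u} _ → gen u)
    in k , (λ i → proj₁ (y∈ i)) , λ l →
      let c , p = U⊆ (l , M.≈ᴹ-refl)
      in c , f-inj (M.≈ᴹ-trans (⟦⟧-linearCombination f c _)
           (M.≈ᴹ-trans (linearCombination-cong M (λ _ → R.refl) (λ i → proj₂ (y∈ i))) p))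
    where
    module M = LeftModule M
    module L = LeftModule L
    U : Pred ∣ M ∣ ℓ
    U m = ∃ λ l → ⟦ f ⟧ l M.≈ᴹ m
    U-sub : IsSubmodule M U
    U-sub = record
      { resp = λ e (l , p) → l , M.≈ᴹ-trans p e
      ; 0∈ = L.0ᴹ , Hom.0ᴹ-homo f
      ; +-closed = λ (l , p) (l′ , p′) → l L.+ᴹ l′ , M.≈ᴹ-trans (Hom.+ᴹ-homo f l l′) (M.+ᴹ-cong p p′)
      ; *-closed = λ r (l , p) → r L.*ₗ l , M.≈ᴹ-trans (Hom.*ₗ-homo f r l) (M.*ₗ-congˡ p) }

  coordinate : ∀ {n} → Fin n → Hom (R^ n) regular
  coordinate {n} i = mkHom (R^ n) regular (λ c → c i) (λ p → p i) (λ _ _ → R.refl) (λ _ _ → R.refl)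

  tuple : ∀ {M n} → Vector (Hom M regular) n → Hom M (R^ n)
  tuple {M} {n} y = mkHom M (R^ n) (λ x i → ⟦ y i ⟧ x) (λ e i → Hom.⟦⟧-cong (y i) e)
    (λ x x′ i → Hom.+ᴹ-homo (y i) x x′) (λ r x i → Hom.*ₗ-homo (y i) r x)

  syzygy-of : LeftNoetherian → ∀ {M} → FinitelyGenerated M →
              ∃ λ n → ∃ λ N → ShortExact N (R^ n) M × FinitelyGenerated N
  syzygy-of noetherian fg = let n , π , π-surj = presentation fg in
    n , kernel π , kernel-exact π π-surj ,
    FinitelyGenerated-submodule noetherian (kernel-inclusion π) (λ e → e) (R^-finitelyGenerated n)

  -- By induction the syzygy `N` is projective, so it embeds by `τ` as a retract of some free
  -- module. As Ext¹(K, R) = 0, the coordinates of `τ` extend to `R^ m`, which retracts `R^ m` onto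
  -- `N` and makes `K` a summand.
  finite-pd⇒projective : LeftNoetherian → ∀ n {K} → FinitelyGenerated K → PdAtMost n K →
                         ExtVanishesFrom 0 K → Projective K
  finite-pd⇒projective noetherian zero    fg p v = p
  finite-pd⇒projective noetherian (suc n) {K} fg p v
    with m , N , s , fgN ← syzygy-of noetherian fg
    with l , ρ , ρ-surj ← presentation fgN =
    retract-projective σ s.g (λ k → let x , e = preimage s.g s.surjective k in
      K.≈ᴹ-trans (Hom.⟦⟧-cong s.g (F.≈ᴹ-trans (Hom.⟦⟧-cong σ (K.≈ᴹ-sym e))
                   (descend-∘ s.g s.surjective c c-kernel x)))
        (K.≈ᴹ-trans (K.≈ᴹ-trans (⟦⟧-sub s.g x _) (K.≈ᴹ-trans
          (K.+ᴹ-congˡ (K.-ᴹ‿cong (proj₁ s.exact _))) (K.x-0≈x _))) e))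
      (R^-projective m)
    where
    module s = ShortExact s
    module K = ModuleProperties K
    module F = ModuleProperties (R^ m)
    module N = LeftModule N
    N-proj : Projective N
    N-proj = finite-pd⇒projective noetherian n fgN (p s (R^-projective m))
      (λ i → v (suc i) s (R^-projective m))
    τ : Hom N (R^ l)
    τ = proj₁ (N-proj ρ ρ-surj idʰ)
    extension : ∀ i → Σ (Hom (R^ m) regular) λ θ → ∀ x → ⟦ θ ⟧ (⟦ s.f ⟧ x) ≈ ⟦ τ ⟧ x i
    extension i = v 0 s (coordinate i ∘ʰ τ)
    r : Hom (R^ m) N
    r = ρ ∘ʰ tuple (λ i → proj₁ (extension i))
    r-retracts : ∀ x → ⟦ r ⟧ (⟦ s.f ⟧ x) N.≈ᴹ x
    r-retracts x = N.≈ᴹ-trans (Hom.⟦⟧-cong ρ (λ i → proj₂ (extension i) x))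
      (proj₂ (N-proj ρ ρ-surj idʰ) x)
    -- Since `r` retracts `s.f`, the map `c` kills the image of `N` and descends to a section of
    -- `s.g`.
    c : Hom (R^ m) (R^ m)
    c = idʰ -ʰ (s.f ∘ʰ r)
    c-kernel : ∀ x → ⟦ s.g ⟧ x K.≈ᴹ K.0ᴹ → ⟦ c ⟧ x F.≈ᴹ F.0ᴹ
    c-kernel x q = let y , e = proj₂ s.exact x q in F.x≈y⇒x-y≈0
      (F.≈ᴹ-trans (F.≈ᴹ-sym e) (Hom.⟦⟧-cong s.f (N.≈ᴹ-trans (N.≈ᴹ-sym (r-retracts y))
        (Hom.⟦⟧-cong r e))))
    σ : Hom K (R^ m)
    σ = descend s.g s.surjective c c-kernel

  -- The first syzygy meets the hypotheses of `finite-pd⇒projective`: passing to it turns vanishing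
  -- above degree 1 into vanishing in every positive degree.
  finite-pd⇒pd≤1 : LeftNoetherian → ∀ {M} → FinitelyGenerated M → FinitePd M →
                   ExtVanishesFrom 1 M → PdAtMost 1 M
  finite-pd⇒pd≤1 noetherian fg pd<∞ v =
    let n , p = FinitePd⇒PdAtMost pd<∞
        m , N , s , fgN = syzygy-of noetherian fg
    in Pd.from 0 s (R^-projective m) (finite-pd⇒projective noetherian n fgN
         (PdAtMost-suc n p s (R^-projective m)) (λ i → v i s (R^-projective m)))

-- Duality Hom(-, R) between left and right modules.

module Duality {ℓ : Level} (R : Ring ℓ ℓ) where

  open Ring R using (Carrier; _≈_; _+_; _*_; 0#; 1#)
  private module R = Ring R
  open Homological R
  open Hom using (⟦_⟧)
  open Modules R
  open Dimension R
  open Resolutions R using (ExtVanishesFrom)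
  open FiniteGeneration R

  module Hᵒ = Homological (Op.ring R)
  module Mᵒ = Modules (Op.ring R)
  module Dᵒ = Dimension (Op.ring R)
  module Rᵒ = Resolutions (Op.ring R)
  module Fᵒ = FiniteGeneration (Op.ring R)

  private module A = ModuleProperties regular

  scaleʳ : ∀ {M} → Carrier → Hom M regular → Hom M regular
  scaleʳ {M} r φ = mkHom M regular (λ x → φ.⟦ x ⟧ * r) (λ e → R.*-congʳ (φ.⟦⟧-cong e))
    (λ x y → R.trans (R.*-congʳ (φ.+ᴹ-homo x y)) (R.distribʳ _ _ _))
    (λ s x → R.trans (R.*-congʳ (φ.*ₗ-homo s x)) (R.*-assoc _ _ _))
    where module φ = Hom φ

  dual : Mod → Hᵒ.Mod
  dual M = record
    { Carrierᴹ = Hom M regular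
    ; _≈ᴹ_ = λ φ ψ → ∀ x → ⟦ φ ⟧ x ≈ ⟦ ψ ⟧ x
    ; _+ᴹ_ = _+ʰ_ ; _*ₗ_ = scaleʳ ; 0ᴹ = 0ʰ ; -ᴹ_ = -ʰ_
    ; isLeftModule = record
      { isLeftSemimodule = record
        { +ᴹ-isCommutativeMonoid = record
          { isMonoid = record
            { isSemigroup = record
              { isMagma = record
                { isEquivalence = record
                  { refl = λ _ → R.refl ; sym = λ p x → R.sym (p x)
                  ; trans = λ p q x → R.trans (p x) (q x) }
                ; ∙-cong = λ p q x → R.+-cong (p x) (q x)
                }
              ; assoc = λ _ _ _ _ → R.+-assoc _ _ _
              }
            ; identity = (λ _ _ → R.+-identityˡ _) , (λ _ _ → R.+-identityʳ _)
            }
          ; comm = λ _ _ _ → R.+-comm _ _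
          }
        ; isPreleftSemimodule = record
          { *ₗ-cong = λ r p x → R.*-cong (p x) r
          ; *ₗ-zeroˡ = λ _ _ → R.zeroʳ _
          ; *ₗ-distribʳ = λ _ _ _ _ → R.distribˡ _ _ _
          ; *ₗ-identityˡ = λ _ _ → R.*-identityʳ _
          ; *ₗ-assoc = λ _ _ _ _ → R.sym (R.*-assoc _ _ _)
          ; *ₗ-zeroʳ = λ _ _ → R.zeroˡ _
          ; *ₗ-distribˡ = λ _ _ _ _ → R.distribʳ _ _ _
          }
        }
      ; -ᴹ‿cong = λ p x → R.-‿cong (p x)
      ; -ᴹ‿inverse = (λ _ _ → R.-‿inverseˡ _) , (λ _ _ → R.-‿inverseʳ _)
      }
    }

  dualʰ : ∀ {M N} → Hom M N → Hᵒ.Hom (dual N) (dual M)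
  dualʰ {M} {N} f = Hᵒ.mkHom (dual N) (dual M) (_∘ʰ f)
    (λ p x → p (⟦ f ⟧ x)) (λ _ _ _ → R.refl) (λ _ _ _ → R.refl)

  dualʰ-injective : ∀ {M N} (f : Hom M N) → IsSurjective f → Hᵒ.IsInjective (dualʰ f)
  dualʰ-injective {N = N} f f-surj {φ} {ψ} p y = let x , e = preimage f f-surj y in
    R.trans (Hom.⟦⟧-cong φ (LeftModule.≈ᴹ-sym N e)) (R.trans (p x) (Hom.⟦⟧-cong ψ e))

  -- Dualising is left exact; surjectivity of the last map is `Extendable` verbatim.
  dual-exact : ∀ {L M N} (s : ShortExact L M N) → Extendable (ShortExact.f s) →
               Hᵒ.ShortExact (dual N) (dual M) (dual L)
  dual-exact {M = M} s extend = record
    { f = dualʰ s.g ; g = dualʰ s.f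
    ; injective = λ {φ} {ψ} → dualʰ-injective s.g s.surjective {φ} {ψ}
    ; exact = (λ ψ x → R.trans (Hom.⟦⟧-cong ψ (proj₁ s.exact x)) (Hom.0ᴹ-homo ψ)) ,
        (λ φ p → let φ-kernel = λ x q → let l , e = proj₂ s.exact x q in
                       R.trans (Hom.⟦⟧-cong φ (LeftModule.≈ᴹ-sym M e)) (p l)
                 in descend s.g s.surjective φ φ-kernel , descend-∘ s.g s.surjective φ φ-kernel)
    ; surjective = Mᵒ.surjective-if (dualʰ s.f) extend
    }
    where module s = ShortExact s

  dual-linearCombination : ∀ {M n} (c : Vector Carrier n) (y : Vector (Hom M regular) n) x →
    ⟦ Hᵒ.linearCombination (dual M) c y ⟧ x ≈ linearCombination regular (λ i → ⟦ y i ⟧ x) c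
  dual-linearCombination {n = zero}  c y x = R.refl
  dual-linearCombination {n = suc n} c y x = R.+-congˡ (dual-linearCombination (c ∘ suc) (y ∘ suc) x)

  dual-coordinates : ∀ {n} (φ : Hom (R^ n) regular) v →
    ⟦ Hᵒ.linearCombination (dual (R^ n)) (λ i → ⟦ φ ⟧ (basis i)) coordinate ⟧ v ≈ ⟦ φ ⟧ v
  dual-coordinates {n} φ v = R.trans
    (dual-linearCombination {R^ n} (λ i → ⟦ φ ⟧ (basis i)) coordinate v) (R.sym (⟦⟧-basis φ v))

  dual-R^-finitelyGenerated : ∀ n → Hᵒ.FinitelyGenerated (dual (R^ n))
  dual-R^-finitelyGenerated n =
    n , coordinate , λ φ → (λ i → ⟦ φ ⟧ (basis i)) , dual-coordinates φ

  dual-R^-projective : ∀ n → Hᵒ.Projective (dual (R^ n))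
  dual-R^-projective n = Dᵒ.retract-projective
    (Hᵒ.mkHom (dual (R^ n)) (Fᵒ.R^ n) (λ φ i → ⟦ φ ⟧ (basis i))
      (λ p i → p (basis i)) (λ _ _ _ → R.refl) (λ _ _ _ → R.refl))
    (Fᵒ.combine (dual (R^ n)) coordinate) dual-coordinates (Fᵒ.R^-projective n)

  evaluation : ∀ {M} → ∣ M ∣ → Hᵒ.Hom (dual M) Hᵒ.regular
  evaluation {M} x = Hᵒ.mkHom (dual M) Hᵒ.regular (λ φ → ⟦ φ ⟧ x)
    (λ p → p x) (λ _ _ → R.refl) (λ _ _ → R.refl)

  private
    linearCombination-flip : ∀ {n} (c d : Vector Carrier n) →
      Hᵒ.linearCombination Hᵒ.regular c d ≈ linearCombination regular d c
    linearCombination-flip {zero}  c d = R.refl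
    linearCombination-flip {suc n} c d = R.+-congˡ (linearCombination-flip (c ∘ suc) (d ∘ suc))

  -- The coordinates generate the dual, so `θ` is evaluation at the vector of its values on them.
  R^-reflexive : ∀ {n} (θ : Hᵒ.Hom (dual (R^ n)) Hᵒ.regular) →
    ∃ λ v → ∀ φ → Hᵒ.Hom.⟦ θ ⟧ φ ≈ ⟦ φ ⟧ v
  R^-reflexive {n} θ = v , λ φ → R.trans
    (Hᵒ.Hom.⟦⟧-cong θ {φ} {Hᵒ.linearCombination (dual (R^ n)) (λ i → ⟦ φ ⟧ (basis i)) coordinate}
      (λ x → R.sym (dual-coordinates φ x)))
    (R.trans (Fᵒ.⟦⟧-linearCombination θ (λ i → ⟦ φ ⟧ (basis i)) coordinate)
      (R.trans (linearCombination-flip (λ i → ⟦ φ ⟧ (basis i)) v) (R.sym (⟦⟧-basis φ v))))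
    where v = λ i → Hᵒ.Hom.⟦ θ ⟧ (coordinate i)

  module Gorenstein (noetherian : Noetherian R) (k : ℕ) (bound : Rᵒ.ExtDimensionAtMost k) where

    dual-finitelyGenerated : ∀ {M} → FinitelyGenerated M → Hᵒ.FinitelyGenerated (dual M)
    dual-finitelyGenerated fg = let n , π , π-surj = presentation fg in
      Fᵒ.FinitelyGenerated-submodule (proj₂ noetherian) (dualʰ π)
        (λ {φ} {ψ} → dualʰ-injective π π-surj {φ} {ψ}) (dual-R^-finitelyGenerated n)

    -- The dual of a resolution of L is exact, so the dual of L is a syzygy of arbitrarily high order.
    dual-ExtVanishes : ∀ {L} → FinitelyGenerated L → ExtVanishesFrom 0 L →
                       ∀ i → Dᵒ.ExtVanishes i (dual L)
    dual-ExtVanishes {L} fg v i = go k i fg v (ℕ.m≤m+n k i)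
      where
      -- Here `j` counts the syzygies still to be taken. Each of them raises by one the degree
      -- wanted for the next dual, so at `j = 0` that degree is at least `k` and `bound` applies.
      go : ∀ j i {L} → FinitelyGenerated L → ExtVanishesFrom 0 L → k ℕ.≤ j ℕ.+ i →
           Dᵒ.ExtVanishes i (dual L)
      go zero i {L} fg v k≤i with o , eq ← ℕ.m≤n⇒∃[o]m+o≡n k≤i =
        ≡.subst (λ n → Dᵒ.ExtVanishes n (dual L)) eq (bound (dual L) (dual-finitelyGenerated fg) o)
      go (suc j) i fg v k≤ =
        let n , N , s , fgN = syzygy-of (proj₁ noetherian) fg
        in go j (suc i) fgN (λ i → v (suc i) s (R^-projective n))
             (≡.subst (k ℕ.≤_) (≡.sym (ℕ.+-suc j i)) k≤)
             (dual-exact s (v 0 s)) (dual-R^-projective n)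

    -- Lift `x` to `f` in a free module. Evaluation at `f` kills every functional coming from `L`,
    -- so it descends to `χ` on the dual of the syzygy `N`. As the dual of `N′` has no Ext¹, `χ`
    -- extends to the dual of the free cover of `N`, where it is evaluation at some `w`. Comparing
    -- coordinates, `f` is the image of `w`, so it lies in `N` and `x` is zero.
    torsionless : ∀ {L} → FinitelyGenerated L → ExtVanishesFrom 0 L →
                  ∀ x → (∀ (ψ : Hom L regular) → ⟦ ψ ⟧ x ≈ 0#) → LeftModule._≈ᴹ_ L x (LeftModule.0ᴹ L)
    torsionless {L} fg v x ψx≈0 with n , N , s , fgN ← syzygy-of (proj₁ noetherian) fg
      with n′ , N′ , s′ , fgN′ ← syzygy-of (proj₁ noetherian) fgN =
      L.≈ᴹ-trans (L.≈ᴹ-sym πf≈x) (L.≈ᴹ-trans (Hom.⟦⟧-cong s.g f≈w) (proj₁ s.exact _))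
      where
      module L = LeftModule L
      module s = ShortExact s
      module s′ = ShortExact s′
      vN : ExtVanishesFrom 0 N
      vN i = v (suc i) s (R^-projective n)
      vN′ : ExtVanishesFrom 0 N′
      vN′ i = vN (suc i) s′ (R^-projective n′)
      t : Hᵒ.ShortExact (dual L) (dual (R^ n)) (dual N)
      t = dual-exact s (v 0 s)
      module t = Hᵒ.ShortExact t
      f : Vector Carrier n
      f = proj₁ (preimage s.g s.surjective x)
      πf≈x : ⟦ s.g ⟧ f L.≈ᴹ x
      πf≈x = proj₂ (preimage s.g s.surjective x)
      ev : Hᵒ.Hom (dual (R^ n)) Hᵒ.regular
      ev = evaluation {R^ n} f
      ev-kernel : ∀ (φ : Hom (R^ n) regular) → (∀ y → ⟦ φ ⟧ (⟦ s.f ⟧ y) ≈ 0#) → ⟦ φ ⟧ f ≈ 0#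
      ev-kernel φ p = let ψ , e = proj₂ t.exact φ p in
        R.trans (R.sym (e f)) (R.trans (Hom.⟦⟧-cong ψ πf≈x) (ψx≈0 ψ))
      χ : Hᵒ.Hom (dual N) Hᵒ.regular
      χ = Mᵒ.descend t.g t.surjective ev ev-kernel
      χ-spec : ∀ (φ : Hom (R^ n) regular) → Hᵒ.Hom.⟦ χ ⟧ (φ ∘ʰ s.f) ≈ ⟦ φ ⟧ f
      χ-spec = Mᵒ.descend-∘ t.g t.surjective ev ev-kernel
      extension : Σ (Hᵒ.Hom (dual (R^ n′)) Hᵒ.regular) λ θ →
                  ∀ (ψ : Hom N regular) → Hᵒ.Hom.⟦ θ ⟧ (ψ ∘ʰ s′.g) ≈ Hᵒ.Hom.⟦ χ ⟧ ψ
      extension = dual-ExtVanishes fgN′ vN′ 0 (dual-exact s′ (vN 0 s′)) χ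
      θ : Hᵒ.Hom (dual (R^ n′)) Hᵒ.regular
      θ = proj₁ extension
      w : Vector Carrier n′
      w = proj₁ (R^-reflexive θ)
      f≈w : ∀ i → f i ≈ ⟦ s.f ⟧ (⟦ s′.g ⟧ w) i
      f≈w i = R.trans (R.sym (χ-spec (coordinate i)))
        (R.trans (R.sym (proj₂ extension (coordinate i ∘ʰ s.f)))
          (proj₂ (R^-reflexive θ) ((coordinate i ∘ʰ s.f) ∘ʰ s′.g)))

-- Common multiples and common denominators in an Ore set.

module Ore {ℓ : Level} (R : Ring ℓ ℓ) (S : Pred (Ring.Carrier R) ℓ) (ore : IsOreSet R S) where

  open Ring R using (Carrier; _≈_; _*_; 1#; sym; trans; *-assoc; *-congˡ; *-congʳ)
  open IsOreSet ore

  opposite : IsOreSet (Op.ring R) S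
  opposite = record
    { resp = resp ; 1∈S = 1∈S ; *-closed = λ f∈ g∈ → *-closed g∈ f∈
    ; nonZeroDivisor = λ f∈ a → proj₂ (nonZeroDivisor f∈ a) , proj₁ (nonZeroDivisor f∈ a)
    ; oreʳ = oreˡ ; oreˡ = oreʳ }

  commonMultiple : ∀ {n} (s : Vector Carrier n) → (∀ i → s i ∈ S) →
                   ∃ λ t → t ∈ S × (∀ i → ∃ λ c → s i * c ≈ t)
  commonMultiple {zero}  s s∈ = 1# , 1∈S , λ ()
  commonMultiple {suc n} s s∈ =
    let t , t∈ , multiple = commonMultiple (s ∘ suc) (s∈ ∘ suc)
        b , u , u∈ , e = oreʳ (s∈ zero) t
    in t * u , *-closed t∈ u∈ , λ
         { zero → b , e
         ; (suc i) → let c , e′ = multiple i in c * u , trans (sym (*-assoc _ _ _)) (*-congʳ e′) }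

  -- The left fractions sᵢ⁻¹ aᵢ are rewritten as right fractions bᵢ t⁻¹ with a single denominator;
  -- `t` is a common multiple of the denominators that the Ore condition gives one by one.
  commonDenominator : ∀ {n} (s : Vector Carrier n) → (∀ i → s i ∈ S) → (a : Vector Carrier n) →
                      ∃ λ t → t ∈ S × (∀ i → ∃ λ b → s i * b ≈ a i * t)
  commonDenominator s s∈ a =
    let t , t∈ , multiple = commonMultiple (λ i → proj₁ (proj₂ (oreʳ (s∈ i) (a i))))
                              (λ i → proj₁ (proj₂ (proj₂ (oreʳ (s∈ i) (a i)))))
    in t , t∈ , λ i →
         let b , u , _ , e = oreʳ (s∈ i) (a i)
             c , e′ = multiple i
         in b * c , trans (sym (*-assoc _ _ _)) (trans (*-congʳ e)
              (trans (*-assoc _ _ _) (*-congˡ e′)))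

-- The category of finitely generated torsion modules, and covers by ⨁ R/Rsᵢ.

module TorsionModules {ℓ : Level} (R : Ring ℓ ℓ) (noetherian : Noetherian R)
                      (S : Pred (Ring.Carrier R) ℓ) (ore : IsOreSet R S) where

  open Ring R using (Carrier; _≈_; _+_; _*_; 0#; 1#)
  private module R = Ring R
  open IsOreSet ore
  open Homological R
  open Hom using (⟦_⟧)
  open Fitting R S
  open Modules R
  open Dimension R
  open Resolutions R
  open FiniteGeneration R
  open Ore R S ore
  module Oreᵒ = Ore (Op.ring R) S opposite

  IsTorsion-submodule : ∀ {L M} (f : Hom L M) → IsInjective f → IsTorsion M → IsTorsion L
  IsTorsion-submodule {L} {M} f f-inj tor l = let s , s∈ , e = tor (⟦ f ⟧ l) in
    s , s∈ , f-inj (M.≈ᴹ-trans (Hom.*ₗ-homo f s l) (M.≈ᴹ-trans e (M.≈ᴹ-sym (Hom.0ᴹ-homo f))))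
    where module M = LeftModule M

  IsTorsion-quotient : ∀ {M N} (f : Hom M N) → IsSurjective f → IsTorsion M → IsTorsion N
  IsTorsion-quotient {M} {N} f f-surj tor n =
    let m , p = preimage f f-surj n
        s , s∈ , e = tor m
    in s , s∈ , N.≈ᴹ-trans (N.*ₗ-congˡ (N.≈ᴹ-sym p)) (N.≈ᴹ-trans (N.≈ᴹ-sym (Hom.*ₗ-homo f s m))
         (N.≈ᴹ-trans (Hom.⟦⟧-cong f e) (Hom.0ᴹ-homo f)))
    where module N = LeftModule N

  IsTorsion-extension : ∀ {L M N} → ShortExact L M N → IsTorsion L → IsTorsion N → IsTorsion M
  IsTorsion-extension {L} {M} {N} s torL torN m =
    let u , u∈ , e = torN (⟦ s.g ⟧ m)
        l , p = proj₂ s.exact (u M.*ₗ m) (LeftModule.≈ᴹ-trans N (Hom.*ₗ-homo s.g u m) e)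
        t , t∈ , q = torL l
    in t * u , *-closed t∈ u∈ , M.≈ᴹ-trans (M.*ₗ-assoc t u m)
         (M.≈ᴹ-trans (M.*ₗ-congˡ (M.≈ᴹ-sym p)) (M.≈ᴹ-trans (M.≈ᴹ-sym (Hom.*ₗ-homo s.f t l))
           (M.≈ᴹ-trans (Hom.⟦⟧-cong s.f q) (Hom.0ᴹ-homo s.f))))
    where
    module s = ShortExact s
    module M = LeftModule M

  sub𝓜 : ∀ (M : 𝓜) {L N} → ShortExact L (mod M) N → 𝓜
  sub𝓜 M {L} s = record
    { mod = L
    ; finitelyGenerated = FinitelyGenerated-submodule (proj₁ noetherian) s.f s.injective M.finitelyGenerated
    ; torsion = IsTorsion-submodule s.f s.injective M.torsion }
    where module M = 𝓜 M
          module s = ShortExact s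

  quotient𝓜 : ∀ (M : 𝓜) {L N} → ShortExact L (mod M) N → 𝓜
  quotient𝓜 M {N = N} s = record
    { mod = N
    ; finitelyGenerated = FinitelyGenerated-quotient s.g s.surjective M.finitelyGenerated
    ; torsion = IsTorsion-quotient s.g s.surjective M.torsion }
    where module M = 𝓜 M
          module s = ShortExact s

  extension𝓜 : ∀ (L N : 𝓜) {M} → ShortExact (mod L) M (mod N) → 𝓜
  extension𝓜 L N {M} s = record
    { mod = M
    ; finitelyGenerated = FinitelyGenerated-extension s L.finitelyGenerated N.finitelyGenerated
    ; torsion = IsTorsion-extension s L.torsion N.torsion }
    where module L = 𝓜 L
          module N = 𝓜 N

  S-cancelˡ : ∀ {s} → s ∈ S → ∀ {a b} → s * a ≈ s * b → a ≈ b
  S-cancelˡ {s} s∈ {a} {b} e = A.x-y≈0⇒x≈y _ _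
    (proj₁ (nonZeroDivisor s∈ _) (R.trans (A.*ₗ-sub s a b) (A.x≈y⇒x-y≈0 e)))
    where module A = ModuleProperties regular

  diagonal : ∀ {n} → Vector Carrier n → Hom (R^ n) (R^ n)
  diagonal {n} s = mkHom (R^ n) (R^ n) (λ r i → r i * s i) (λ p i → R.*-congʳ (p i))
    (λ _ _ _ → R.distribʳ _ _ _) (λ _ _ _ → R.*-assoc _ _ _)

  module _ {n : ℕ} (s : Vector Carrier n) (s∈ : ∀ i → s i ∈ S) where

    diagonal-injective : IsInjective (diagonal s)
    diagonal-injective = injective-if (diagonal s) λ r p i → proj₂ (nonZeroDivisor (s∈ i) _) (p i)

    -- R/Rs₁ ⊕ … ⊕ R/Rsₙ
    cyclicSum : 𝓜
    cyclicSum = record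
      { mod = cokernel (diagonal s)
      ; finitelyGenerated = FinitelyGenerated-quotient (cokernel-projection (diagonal s))
          (ShortExact.surjective (cokernel-exact (diagonal s) diagonal-injective)) (R^-finitelyGenerated n)
      ; torsion = λ v →
          -- Over the opposite ring the equation reads bᵢ sᵢ = t vᵢ: one `t` moves every coordinate
          -- of `v` into its R sᵢ.
          let t , t∈ , multiple = Oreᵒ.commonDenominator s s∈ v
          in t , t∈ , (λ i → proj₁ (multiple i)) , λ i →
               R.trans (proj₂ (multiple i)) (R.sym (ModuleProperties.x-0≈x regular _)) }

    cyclicSum-exact : ShortExact (R^ n) (R^ n) (mod cyclicSum)
    cyclicSum-exact = cokernel-exact (diagonal s) diagonal-injective

    cyclicSum-pd : PdAtMost 1 (mod cyclicSum)
    cyclicSum-pd = Pd.from 0 cyclicSum-exact (R^-projective n) (R^-projective n)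

  -- Each generator `x i` is annihilated by some `s i ∈ S`, so the free cover of `M` factors through
  -- the sum of the R/Rsᵢ.
  cover-by-cyclicSum : ∀ (M : 𝓜) → ∃ λ (P : 𝓜) → ∃ λ (N : 𝓜) →
                       PdAtMost 1 (mod P) × 0⟶ N ⟶ P ⟶ M ⟶0
  cover-by-cyclicSum M = P , sub𝓜 P exact , cyclicSum-pd s s∈ , exact
    where
    module M = LeftModule (mod M)
    n = proj₁ (𝓜.finitelyGenerated M)
    x : Vector ∣ mod M ∣ n
    x = proj₁ (proj₂ (𝓜.finitelyGenerated M))
    s : Vector Carrier n
    s i = proj₁ (𝓜.torsion M (x i))
    s∈ : ∀ i → s i ∈ S
    s∈ i = proj₁ (proj₂ (𝓜.torsion M (x i)))
    P = cyclicSum s s∈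
    module P = LeftModule (mod P)
    π : Hom (R^ n) (mod P)
    π = cokernel-projection (diagonal s)
    π-surj = ShortExact.surjective (cyclicSum-exact s s∈)
    combine-kernel : ∀ v → v P.≈ᴹ P.0ᴹ → linearCombination (mod M) v x M.≈ᴹ M.0ᴹ
    combine-kernel v (r , p) = M.≈ᴹ-trans
      (linearCombination-cong (mod M) (λ i → R.sym (R.trans (p i) (ModuleProperties.x-0≈x regular _)))
        (λ _ → M.≈ᴹ-refl))
      (M.≈ᴹ-trans (M.≈ᴹ-sym (linearCombination-assoc (mod M) r s x))
        (linearCombination-zeros (mod M) r _ (λ i → proj₂ (proj₂ (𝓜.torsion M (x i))))))
    q : Hom (mod P) (mod M)
    q = descend π π-surj (combine (mod M) x) combine-kernel
    exact : ShortExact (kernel q) (mod P) (mod M)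
    exact = kernel-exact q (surjective-if q λ m → let c , e = proj₂ (proj₂ (𝓜.finitelyGenerated M)) m in
      c , M.≈ᴹ-trans (descend-∘ π π-surj (combine (mod M) x) combine-kernel c) e)

  -- Embedding a module of 𝓒 into some ⨁ R/Rsᵢ with cokernel in 𝓒.

  module Embedding (k : ℕ) (bound : Resolutions.ExtDimensionAtMost (Op.ring R) k) where

    open Duality R
    open Gorenstein noetherian k bound

    -- Full rank provides xᵢ ∈ K with ι(xᵢ) = tᵢ eᵢ. An extension of `y` would have to send eᵢ to
    -- tᵢ⁻¹ y(xᵢ); multiplying on the right by a common denominator `s` clears these fractions.
    functional-extends : ∀ {n K} (ι : Hom K (R^ n)) → IsInjective ι →
      (∀ v → ∃ λ t → t ∈ S × ∃ λ x → ∀ i → ⟦ ι ⟧ x i ≈ t * v i) →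
      ∀ (y : Hom K regular) → ∃ λ s → s ∈ S × Σ (Hom (R^ n) regular) λ z →
        ∀ x → ⟦ z ⟧ (⟦ ι ⟧ x) ≈ ⟦ y ⟧ x * s
    functional-extends {n} {K} ι ι-inj fullRank y = s , s∈ , z , λ x →
      -- Here dᵢ tᵢ = t (ι x)ᵢ, hence t x = Σ dᵢ xᵢ: it is enough to compare the two functionals on
      -- the xᵢ and then to cancel `t`.
      let t , t∈ , multiple = Oreᵒ.commonDenominator t_ t∈_ (⟦ ι ⟧ x)
          d = λ i → proj₁ (multiple i)
          tx≈dx : ∀ j → ⟦ ι ⟧ (t K.*ₗ x) j ≈ ⟦ ι ⟧ (linearCombination K d x_) j
          tx≈dx j = R.trans (Hom.*ₗ-homo ι t x j) (R.trans (R.sym (proj₂ (multiple j))) (R.sym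
            (R.trans (⟦⟧-linearCombination ι d x_ j) (R.trans
              (linearCombination-cong (R^ n) {c = d} (λ _ → R.refl) ιx≈ j)
              (R.trans (linearCombination-assoc (R^ n) d t_ basis j) (basis-generates _ j))))))
          both : ∀ (φ : Hom K regular) → t * ⟦ φ ⟧ x ≈ linearCombination regular d (λ i → ⟦ φ ⟧ (x_ i))
          both φ = R.trans (R.sym (Hom.*ₗ-homo φ t x)) (R.trans (Hom.⟦⟧-cong φ (ι-inj tx≈dx))
            (⟦⟧-linearCombination φ d x_))
      in S-cancelˡ t∈ (R.trans (both (z ∘ʰ ι)) (R.trans
           (linearCombination-cong regular {c = d} (λ _ → R.refl) agree)
           (R.sym (both (scaleʳ s y)))))
      where
      module K = LeftModule K
      t_ : Vector Carrier n
      t_ i = proj₁ (fullRank (basis i))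
      t∈_ : ∀ i → t_ i ∈ S
      t∈_ i = proj₁ (proj₂ (fullRank (basis i)))
      x_ : Vector ∣ K ∣ n
      x_ i = proj₁ (proj₂ (proj₂ (fullRank (basis i))))
      ιx≈ : ∀ i j → ⟦ ι ⟧ (x_ i) j ≈ t_ i * basis i j
      ιx≈ i = proj₂ (proj₂ (proj₂ (fullRank (basis i))))
      denominator = commonDenominator t_ t∈_ (λ i → ⟦ y ⟧ (x_ i))
      s = proj₁ denominator
      s∈ : s ∈ S
      s∈ = proj₁ (proj₂ denominator)
      a : Vector Carrier n
      a i = proj₁ (proj₂ (proj₂ denominator) i)
      z : Hom (R^ n) regular
      z = combine regular a
      agree : ∀ i → ⟦ z ⟧ (⟦ ι ⟧ (x_ i)) ≈ ⟦ y ⟧ (x_ i) * s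
      agree i = R.trans (Hom.⟦⟧-cong z (ιx≈ i)) (R.trans (Hom.*ₗ-homo z (t_ i) (basis i))
        (R.trans (R.*-congˡ (linearCombination-basis regular i a)) (proj₂ (proj₂ (proj₂ denominator) i))))

    -- With yᵢ generating Hom(K, R) for a presentation 0 → K → Rⁿ → M → 0 and zᵢ : Rⁿ → R extending
    -- yᵢ sᵢ, the zᵢ induce M → ⨁ R/Rsᵢ, the dual of the cover of Ext¹(M, R) given by the yᵢ.
    embed-in-cyclicSum : ∀ (M : 𝓜) → ExtVanishesFrom 1 (mod M) →
      ∃ λ (P : 𝓜) → ∃ λ (C : 𝓜) →
      PdAtMost 1 (mod P) × ExtVanishesFrom 1 (mod C) × 0⟶ M ⟶ P ⟶ C ⟶0
    embed-in-cyclicSum M vM with n , K , π-exact , fgK ← syzygy-of (proj₁ noetherian) (𝓜.finitelyGenerated M) =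
      P , quotient𝓜 P exact , cyclicSum-pd s s∈ , vC , exact
      where
      module M = ModuleProperties (mod M)
      module K = ModuleProperties K
      module F = LeftModule (R^ n)
      open ShortExact π-exact renaming
        (f to ι; g to π; injective to ι-inj; surjective to π-surj; exact to ι-π)
      vK : ExtVanishesFrom 0 K
      vK i = vM i π-exact (R^-projective n)

      y-data = dual-finitelyGenerated fgK
      m = proj₁ y-data
      y : Vector (Hom K regular) m
      y = proj₁ (proj₂ y-data)
      G = tuple y

      y-generates : ∀ (ψ : Hom K regular) → ∃ λ c → ∀ x →
        linearCombination regular (⟦ G ⟧ x) c ≈ ⟦ ψ ⟧ x
      y-generates ψ = let c , e = proj₂ (proj₂ y-data) ψ in
        c , λ x → R.trans (R.sym (dual-linearCombination {K} c y x)) (e x)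

      fullRank : ∀ v → ∃ λ t → t ∈ S × ∃ λ x → ∀ i → ⟦ ι ⟧ x i ≈ t * v i
      fullRank v =
        let t , t∈ , e = 𝓜.torsion M (⟦ π ⟧ v)
            x , p = proj₂ ι-π (t F.*ₗ v) (M.≈ᴹ-trans (Hom.*ₗ-homo π t v) e)
        in t , t∈ , x , p

      extended : ∀ i → ∃ λ s → s ∈ S × Σ (Hom (R^ n) regular) λ z →
                 ∀ x → ⟦ z ⟧ (⟦ ι ⟧ x) ≈ ⟦ y i ⟧ x * s
      extended i = functional-extends ι ι-inj fullRank (y i)
      s : Vector Carrier m
      s i = proj₁ (extended i)
      s∈ : ∀ i → s i ∈ S
      s∈ i = proj₁ (proj₂ (extended i))
      Z : Hom (R^ n) (R^ m)
      Z = tuple (λ i → proj₁ (proj₂ (proj₂ (extended i))))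
      σ = diagonal s
      module G^ = ModuleProperties (R^ m)
      Zι≈σG : ∀ x → ⟦ Z ⟧ (⟦ ι ⟧ x) G^.≈ᴹ ⟦ σ ⟧ (⟦ G ⟧ x)
      Zι≈σG x i = proj₂ (proj₂ (proj₂ (extended i))) x

      G-inj : IsInjective G
      G-inj = injective-if G λ x p → ι-inj λ j →
        let c , e = y-generates (coordinate j ∘ʰ ι) in
        R.trans (R.sym (e x)) (R.trans (linearCombination-cong regular {c′ = λ _ → 0#} p (λ _ → R.refl))
          (R.trans (linearCombination-0 regular c) (R.sym (Hom.0ᴹ-homo ι j))))

      L = cokernel G
      L-exact : ShortExact K (R^ m) L
      L-exact = cokernel-exact G G-inj
      module L = LeftModule L
      -- Every functional on `K` is a combination of the yᵢ and hence extends along `G`; the higher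
      -- degrees shift to `K`.
      vL : ExtVanishesFrom 0 L
      vL zero    = Ext¹Vanishes-from L-exact (R^-projective m) λ ψ →
        let c , e = y-generates ψ in combine regular c , e
      vL (suc i) = Ext.from i L-exact (R^-projective m) (vK i)
      fgL : FinitelyGenerated L
      fgL = FinitelyGenerated-quotient (ShortExact.g L-exact) (ShortExact.surjective L-exact)
        (R^-finitelyGenerated m)

      P = cyclicSum s s∈
      module P = LeftModule (mod P)
      toP : Hom (R^ n) (mod P)
      toP = cokernel-projection σ ∘ʰ Z
      toP-kernel : ∀ v → ⟦ π ⟧ v M.≈ᴹ M.0ᴹ → ⟦ toP ⟧ v P.≈ᴹ P.0ᴹ
      toP-kernel v p = let x , e = proj₂ ι-π v p in ⟦ G ⟧ x ,
        G^.≈ᴹ-trans (G^.≈ᴹ-sym (Zι≈σG x)) (G^.≈ᴹ-trans (Hom.⟦⟧-cong Z e) (G^.≈ᴹ-sym (G^.x-0≈x _)))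

      -- Some t v lies in `K`, and then t r lies in the image of `G` because `σ` is injective. So
      -- `r` is torsion in `L`; functionals with values in `R` kill torsion and `L` is torsionless,
      -- so `r` itself is some G x′. Cancelling `t` gives v = ι x′. This is the injectivity of `j`.
      σ-lifts⇒∈K : ∀ v r → ⟦ Z ⟧ v G^.≈ᴹ ⟦ σ ⟧ r → ⟦ π ⟧ v M.≈ᴹ M.0ᴹ
      σ-lifts⇒∈K v r Zv≈σr =
        let t , t∈ , x , ιx≈tv = fullRank v
            Gx≈tr : ⟦ G ⟧ x G^.≈ᴹ t G^.*ₗ r
            Gx≈tr = diagonal-injective s s∈ (G^.≈ᴹ-trans (G^.≈ᴹ-sym (Zι≈σG x))
              (G^.≈ᴹ-trans (Hom.⟦⟧-cong Z ιx≈tv) (G^.≈ᴹ-trans (Hom.*ₗ-homo Z t v)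
                (G^.≈ᴹ-trans (G^.*ₗ-congˡ {t} Zv≈σr) (G^.≈ᴹ-sym (Hom.*ₗ-homo σ t r))))))
            ψr≈0 : ∀ (ψ : Hom L regular) → ⟦ ψ ⟧ r ≈ 0#
            ψr≈0 ψ = proj₁ (nonZeroDivisor t∈ _) (R.trans (R.sym (Hom.*ₗ-homo ψ t r))
              (R.trans (Hom.⟦⟧-cong ψ (x , G^.≈ᴹ-trans Gx≈tr (G^.≈ᴹ-sym (G^.x-0≈x _)))) (Hom.0ᴹ-homo ψ)))
            x′ , Gx′≈r = torsionless fgL vL r ψr≈0
            x≈tx′ : x K.≈ᴹ t K.*ₗ x′
            x≈tx′ = G-inj (G^.≈ᴹ-trans Gx≈tr (G^.≈ᴹ-sym (G^.≈ᴹ-trans (Hom.*ₗ-homo G t x′)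
              (G^.*ₗ-congˡ {t} (G^.≈ᴹ-trans Gx′≈r (G^.x-0≈x r))))))
            v≈ιx′ : v F.≈ᴹ ⟦ ι ⟧ x′
            v≈ιx′ i = S-cancelˡ t∈ (R.trans (R.sym (ιx≈tv i))
              (R.trans (Hom.⟦⟧-cong ι x≈tx′ i) (Hom.*ₗ-homo ι t x′ i)))
        in M.≈ᴹ-trans (Hom.⟦⟧-cong π v≈ιx′) (proj₁ ι-π x′)

      j : Hom (mod M) (mod P)
      j = descend π π-surj toP toP-kernel
      j-spec : ∀ v → ⟦ j ⟧ (⟦ π ⟧ v) P.≈ᴹ ⟦ toP ⟧ v
      j-spec = descend-∘ π π-surj toP toP-kernel
      j-inj : IsInjective j
      j-inj = injective-if j λ x p →
        let v , πv≈x = preimage π π-surj x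
            r , e = P.≈ᴹ-trans (P.≈ᴹ-sym (j-spec v)) (P.≈ᴹ-trans (Hom.⟦⟧-cong j πv≈x) p)
        in M.≈ᴹ-trans (M.≈ᴹ-sym πv≈x) (σ-lifts⇒∈K v r (G^.≈ᴹ-sym (G^.≈ᴹ-trans e (G^.x-0≈x _))))

      C = cokernel j
      exact : ShortExact (mod M) (mod P) C
      exact = cokernel-exact j j-inj
      module C = LeftModule C

      q : Hom (R^ m) C
      q = cokernel-projection j ∘ʰ cokernel-projection σ
      q-exact : ShortExact (kernel q) (R^ m) C
      q-exact = kernel-exact q (surjective-if q λ v → v , C.≈ᴹ-refl)

      -- Together with `pairʰ G ι` this is the mapping cone of the chain map (`G`, `Z`) from `ι` to
      -- `σ` lying over `j : M → P`; it resolves the cokernel `C`.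
      e₀ : Hom (R^ m ⊞ R^ n) (R^ m)
      e₀ = (Z ∘ʰ sndʰ) -ʰ (σ ∘ʰ fstʰ)
      e₀∈ : ∀ w → ⟦ q ⟧ (⟦ e₀ ⟧ w) C.≈ᴹ C.0ᴹ
      e₀∈ (r , v) = ⟦ π ⟧ v , P.≈ᴹ-trans (j-spec v) (r ,
        G^.≈ᴹ-sym (G^.≈ᴹ-trans (G^.+ᴹ-congˡ (G^.-ᴹ‿cong (G^.x-0≈x _)))
          (G^.x-[x-y]≈y (⟦ Z ⟧ v) (⟦ σ ⟧ r))))
      e : Hom (R^ m ⊞ R^ n) (kernel q)
      e = corestrict (kernel-inclusion q) (λ p → p) e₀ (λ w → (⟦ e₀ ⟧ w , e₀∈ w) , G^.≈ᴹ-refl)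

      e-exact : ShortExact K (R^ m ⊞ R^ n) (kernel q)
      e-exact = record
        { f = pairʰ G ι
        ; g = e
        ; injective = λ p → G-inj (proj₁ p)
        ; exact = (λ x → G^.x≈y⇒x-y≈0 (Zι≈σG x)) , λ (r , v) p →
            let Zv≈σr = G^.x-y≈0⇒x≈y _ _ p
                x , ιx≈v = proj₂ ι-π v (σ-lifts⇒∈K v r Zv≈σr)
            in x , diagonal-injective s s∈ (G^.≈ᴹ-trans (G^.≈ᴹ-sym (Zι≈σG x))
                     (G^.≈ᴹ-trans (Hom.⟦⟧-cong Z ιx≈v) Zv≈σr)) , ιx≈v
        ; surjective = surjective-if e λ (w , x , jx≈w) →
            let v , πv≈x = preimage π π-surj x
                r , σr≈ = P.≈ᴹ-trans (P.≈ᴹ-sym (j-spec v)) (P.≈ᴹ-trans (Hom.⟦⟧-cong j πv≈x) jx≈w)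
                σr≈′ : ⟦ σ ⟧ r G^.≈ᴹ ⟦ Z ⟧ v G^.- w
                σr≈′ = G^.≈ᴹ-trans σr≈ (G^.+ᴹ-congˡ (G^.-ᴹ‿cong (G^.x-0≈x w)))
            in (r , v) , G^.≈ᴹ-trans (G^.+ᴹ-congˡ (G^.-ᴹ‿cong σr≈′)) (G^.x-[x-y]≈y (⟦ Z ⟧ v) w)
        }

      free-sum : Projective (R^ m ⊞ R^ n)
      free-sum = projective-closed {R^ m} {R^ m ⊞ R^ n} {R^ n} (record
        { f = pairʰ idʰ 0ʰ ; g = sndʰ ; injective = proj₁
        ; exact = (λ _ → F.≈ᴹ-refl) , (λ (r , v) p → r , G^.≈ᴹ-refl , F.≈ᴹ-sym p)
        ; surjective = surjective-if (sndʰ {R^ m} {R^ n}) (λ v → (G^.0ᴹ , v) , F.≈ᴹ-refl) })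
        (R^-projective m) (R^-projective n)

      -- In degree zero this amounts to Ext²(C, R) = 0. A functional on `K` is a combination of the
      -- yᵢ, so it extends through the summand `R^ m` alone.
      vKernel : ∀ i → ExtVanishes i (kernel q)
      vKernel zero    = Ext¹Vanishes-from e-exact free-sum λ ψ →
        let c , p = y-generates ψ in combine regular c ∘ʰ fstʰ , p
      vKernel (suc i) = Ext.from i e-exact free-sum (vK i)

      vC : ExtVanishesFrom 1 C
      vC i = Ext.from i q-exact (R^-projective m) (vKernel i)

-- Invariants on the classes pd⋆ ≤ k and their shifts.

module Invariants {ℓ a e : Level} (R : Ring ℓ ℓ) (noetherian : Noetherian R)
                  (S : Pred (Ring.Carrier R) ℓ) (ore : IsOreSet R S)
                  (Ω : CommutativeMonoid a e) where

  open Homological R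
  open Fitting R S
  open Modules R
  open Dimension R
  open Resolutions R
  open FiniteGeneration R
  open TorsionModules R noetherian S ore
  open CommutativeMonoid Ω
  open SetoidReasoning setoid
  open CommutativeSemigroupProperties commutativeSemigroup using (x∙yz≈y∙xz)

  unit-cancel : ∀ {u x y} → IsUnit Ω u → u ∙ x ≈ u ∙ y → x ≈ y
  unit-cancel {u} {x} {y} (u⁻¹ , u⁻¹u≈ε , _) ux≈uy = begin
    x              ≈⟨ identityˡ x ⟨
    ε ∙ x          ≈⟨ ∙-congʳ u⁻¹u≈ε ⟨
    (u⁻¹ ∙ u) ∙ x  ≈⟨ assoc _ _ _ ⟩
    u⁻¹ ∙ (u ∙ x)  ≈⟨ ∙-congˡ ux≈uy ⟩
    u⁻¹ ∙ (u ∙ y)  ≈⟨ assoc _ _ _ ⟨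
    (u⁻¹ ∙ u) ∙ y  ≈⟨ ∙-congʳ u⁻¹u≈ε ⟩
    ε ∙ y          ≈⟨ identityˡ y ⟩
    y              ∎

  infix 8 _⁻¹[_]
  _⁻¹[_] : ∀ u → IsUnit Ω u → Carrier
  _ ⁻¹[ u⁻¹ , _ ] = u⁻¹

  unit-∙ : ∀ {u v} (u-unit : IsUnit Ω u) → IsUnit Ω v → IsUnit Ω (u ⁻¹[ u-unit ] ∙ v)
  unit-∙ {u} {v} (u⁻¹ , p , p′) (v⁻¹ , q , q′) = u ∙ v⁻¹ , left , trans (comm _ _) left
    where
    left : (u ∙ v⁻¹) ∙ (u⁻¹ ∙ v) ≈ ε
    left = begin
      (u ∙ v⁻¹) ∙ (u⁻¹ ∙ v)  ≈⟨ assoc _ _ _ ⟩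
      u ∙ (v⁻¹ ∙ (u⁻¹ ∙ v))  ≈⟨ ∙-congˡ (x∙yz≈y∙xz _ _ _) ⟩
      u ∙ (u⁻¹ ∙ (v⁻¹ ∙ v))  ≈⟨ assoc _ _ _ ⟨
      (u ∙ u⁻¹) ∙ (v⁻¹ ∙ v)  ≈⟨ ∙-cong p′ q ⟩
      ε ∙ ε                  ≈⟨ identityˡ ε ⟩
      ε                      ∎

  -- The element u⁻¹ y is how `Φ` and `Ψ` form their values from one chosen exact sequence; this
  -- carries its defining equation over to any other sequence.
  cross-multiply : ∀ {u w x y} (u-unit : IsUnit Ω u) → u ∙ x ≈ w ∙ y → w ∙ (u ⁻¹[ u-unit ] ∙ y) ≈ x
  cross-multiply {u} {w} {x} {y} (u⁻¹ , p , _) ux≈wy = begin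
    w ∙ (u⁻¹ ∙ y)  ≈⟨ x∙yz≈y∙xz _ _ _ ⟩
    u⁻¹ ∙ (w ∙ y)  ≈⟨ ∙-congˡ ux≈wy ⟨
    u⁻¹ ∙ (u ∙ x)  ≈⟨ assoc _ _ _ ⟨
    (u⁻¹ ∙ u) ∙ x  ≈⟨ ∙-congʳ p ⟩
    ε ∙ x          ≈⟨ identityˡ x ⟩
    x              ∎

  zero𝓜 : 𝓜
  zero𝓜 = record
    { mod = zeroᴹ
    ; finitelyGenerated = 0 , (λ ()) , λ _ → (λ ()) , _
    ; torsion = λ _ → Ring.1# R , IsOreSet.1∈S ore , _ }

  zero-left : ∀ M → 0⟶ zero𝓜 ⟶ M ⟶ M ⟶0
  zero-left M = record
    { f = 0ʰ ; g = idʰ ; injective = λ _ → _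
    ; exact = (λ _ → M.≈ᴹ-refl) , (λ y p → _ , M.≈ᴹ-sym p)
    ; surjective = surjective-if (idʰ {mod M}) (λ y → y , M.≈ᴹ-refl) }
    where module M = LeftModule (mod M)

  zero-right : ∀ M → 0⟶ M ⟶ M ⟶ zero𝓜 ⟶0
  zero-right M = record
    { f = idʰ ; g = 0ʰ ; injective = λ p → p
    ; exact = (λ _ → _) , (λ y _ → y , M.≈ᴹ-refl)
    ; surjective = surjective-if (0ʰ {mod M} {zeroᴹ}) (λ _ → M.0ᴹ , _) }
    where module M = LeftModule (mod M)

  zero𝓜-projective : Projective (mod zero𝓜)
  zero𝓜-projective = zero-projective {zeroᴹ} (λ _ → _)

  zero∈𝓠 : zero𝓜 ∈𝓠
  zero∈𝓠 = + 0 , PdAtMost⇒pd 0 zero𝓜-projective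

  pd≤1⇒∈𝓠 : ∀ {P} → PdAtMost 1 (mod P) → P ∈𝓠
  pd≤1⇒∈𝓠 p = + 1 , PdAtMost⇒pd 1 p

  abstract
    pullback𝓜 : ∀ {A B M A′ B′} → 0⟶ A ⟶ B ⟶ M ⟶0 → 0⟶ A′ ⟶ B′ ⟶ M ⟶0 →
                ∃ λ X → 0⟶ A ⟶ X ⟶ B′ ⟶0 × 0⟶ A′ ⟶ X ⟶ B ⟶0
    pullback𝓜 {A} {B′ = B′} s t = let _ , s₁ , s₂ = pullback s t in extension𝓜 A B′ s₁ , s₁ , s₂

    pushout𝓜 : ∀ {M B C B′ C′} → 0⟶ M ⟶ B ⟶ C ⟶0 → 0⟶ M ⟶ B′ ⟶ C′ ⟶0 →
               ∃ λ X → 0⟶ B ⟶ X ⟶ C′ ⟶0 × 0⟶ B′ ⟶ X ⟶ C ⟶0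
    pushout𝓜 {B = B} {C′ = C′} s t = let _ , s₁ , s₂ = pushout s t in extension𝓜 B C′ s₁ , s₁ , s₂

    kernel-of-composite𝓜 : ∀ {N Q M M′ P} → 0⟶ N ⟶ Q ⟶ M ⟶0 → 0⟶ M′ ⟶ M ⟶ P ⟶0 →
                           ∃ λ K → 0⟶ K ⟶ Q ⟶ P ⟶0 × 0⟶ N ⟶ K ⟶ M′ ⟶0
    kernel-of-composite𝓜 {Q = Q} s t =
      let _ , s₁ , s₂ = kernel-of-composite s t in sub𝓜 Q s₁ , s₁ , s₂

    cokernel-of-composite𝓜 : ∀ {M Q C M′ P} → 0⟶ M ⟶ Q ⟶ C ⟶0 → 0⟶ M′ ⟶ M ⟶ P ⟶0 →
                             ∃ λ K → 0⟶ M′ ⟶ Q ⟶ K ⟶0 × 0⟶ P ⟶ K ⟶ C ⟶0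
    cokernel-of-composite𝓜 {Q = Q} s t =
      let _ , s₁ , s₂ = cokernel-of-composite s t in quotient𝓜 Q s₁ , s₁ , s₂

    cover𝓜 : ∀ M → ∃ λ P → ∃ λ N → PdAtMost 1 (mod P) × 0⟶ N ⟶ P ⟶ M ⟶0
    cover𝓜 = cover-by-cyclicSum

  -- pd⋆ ≤ k
  𝓒≤ : ℕ → 𝓜 → Set (lsuc ℓ)
  𝓒≤ k M = ExtVanishesFrom k (mod M)

  abstract
    𝓒≤-suc : ∀ {k M} → 𝓒≤ k M → 𝓒≤ (suc k) M
    𝓒≤-suc {k} {M} v i = ≡.subst (λ n → ExtVanishes n (mod M)) (ℕ.+-suc k i) (v (suc i))

    pd≤1⇒𝓒≤ : ∀ k {M} → PdAtMost 1 (mod M) → 𝓒≤ (suc k) M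
    pd≤1⇒𝓒≤ k p i = PdAtMost⇒ExtVanishes 1 (k ℕ.+ i) p

    zero∈𝓒≤ : ∀ k → 𝓒≤ k zero𝓜
    zero∈𝓒≤ k i = Projective⇒ExtVanishes (k ℕ.+ i) zero𝓜-projective

    𝓒≤-middle : ∀ k {L M N} → 0⟶ L ⟶ M ⟶ N ⟶0 → 𝓒≤ k L → 𝓒≤ k N → 𝓒≤ k M
    𝓒≤-middle k s vL vN i = Ext.middle (k ℕ.+ i) s (vL i) (vN i)

    𝓒≤-left : ∀ k {L M N} → 0⟶ L ⟶ M ⟶ N ⟶0 → 𝓒≤ k M → 𝓒≤ (suc k) N → 𝓒≤ k L
    𝓒≤-left k s vM vN i = Ext.left (k ℕ.+ i) s (vM i) (vN i)

  -- A quasi-Fitting invariant on the class pd⋆ ≤ k, with 𝓠 in place of 𝓟; for k = 1 this is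
  -- no stronger, because 𝓠 ∩ 𝓒 = 𝓟.
  record Invariant (k : ℕ) : Set (lsuc ℓ ⊔ a ⊔ e) where
    field
      value     : ∀ M → 𝓒≤ k M → Carrier
      unit      : ∀ {P} (p : 𝓒≤ k P) → P ∈𝓠 → IsUnit Ω (value P p)
      quotient  : ∀ {M′ M P} m′ m p → P ∈𝓠 → 0⟶ M′ ⟶ M ⟶ P ⟶0 →
                  value M m ≈ value P p ∙ value M′ m′
      submodule : ∀ {P M M′} p m m′ → P ∈𝓠 → 0⟶ P ⟶ M ⟶ M′ ⟶0 →
                  value M m ≈ value P p ∙ value M′ m′

    zero≈ε : ∀ v → value zero𝓜 v ≈ ε
    zero≈ε v = sym (unit-cancel (unit {zero𝓜} v zero∈𝓠)
      (trans (identityʳ _) (quotient {zero𝓜} {zero𝓜} {zero𝓜} v v v zero∈𝓠 (zero-left zero𝓜))))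

    -- A value depends formally on a proof of membership. The sequence 0 → M → M → 0 → 0, with a
    -- different proof at each copy of `M`, removes this dependence.
    irrelevant : ∀ {M} v w → value M v ≈ value M w
    irrelevant {M} v w = trans (quotient {M} {M} {zero𝓜} w v (zero∈𝓒≤ k) zero∈𝓠 (zero-right M))
      (trans (∙-congʳ (zero≈ε (zero∈𝓒≤ k))) (identityˡ _))

  open Invariant

  restrict : ∀ {k} → Invariant (suc k) → Invariant k
  restrict {k} F = record
    { value = λ M m → value F M (𝓒≤-suc {k} {M} m)
    ; unit = λ {P} p → unit F (𝓒≤-suc {k} {P} p)
    ; quotient = λ {M′} {M} {P} m′ m p →
        quotient F (𝓒≤-suc {k} {M′} m′) (𝓒≤-suc {k} {M} m) (𝓒≤-suc {k} {P} p)
    ; submodule = λ {P} {M} {M′} p m m′ →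
        submodule F (𝓒≤-suc {k} {P} p) (𝓒≤-suc {k} {M} m) (𝓒≤-suc {k} {M′} m′) }

  module Cover (M : 𝓜) where
    P N : 𝓜
    P = proj₁ (cover𝓜 M)
    N = proj₁ (proj₂ (cover𝓜 M))
    pd≤1 : PdAtMost 1 (mod P)
    pd≤1 = proj₁ (proj₂ (proj₂ (cover𝓜 M)))
    exact : 0⟶ N ⟶ P ⟶ M ⟶0
    exact = proj₂ (proj₂ (proj₂ (cover𝓜 M)))
    P∈𝓠 : P ∈𝓠
    P∈𝓠 = pd≤1⇒∈𝓠 {P} pd≤1
    P∈𝓒 : ∀ k → 𝓒≤ (suc k) P
    P∈𝓒 k = pd≤1⇒𝓒≤ k {P} pd≤1
    N∈𝓒 : ∀ k → 𝓒≤ (suc (suc k)) M → 𝓒≤ (suc k) N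
    N∈𝓒 k m = 𝓒≤-left (suc k) {N} {P} {M} exact (P∈𝓒 k) m

  -- The upward shift Φ, through covers.

  module Syzygy {k : ℕ} (F : Invariant (suc k)) where

    private
      coverUnit : ∀ M → IsUnit Ω (value F (Cover.P M) (Cover.P∈𝓒 M k))
      coverUnit M = unit F {Cover.P M} (Cover.P∈𝓒 M k) (Cover.P∈𝓠 M)

    Φ-value : ∀ M → 𝓒≤ (suc (suc k)) M → Carrier
    Φ-value M m = (value F (Cover.P M) (Cover.P∈𝓒 M k)) ⁻¹[ coverUnit M ]
                  ∙ value F (Cover.N M) (Cover.N∈𝓒 M k m)

    -- Two presentations of M are compared through their pullback, which is an extension of
    -- each P by the other N.
    Φ-defining : ∀ {N P M} n p m → P ∈𝓠 → 0⟶ N ⟶ P ⟶ M ⟶0 →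
                 value F P p ∙ Φ-value M m ≈ value F N n
    Φ-defining {N} {P} {M} n p m P∈𝓠 s =
      let X , s₁ , s₂ = pullback𝓜 {C.N} {C.P} {M} {N} {P} C.exact s
          x = 𝓒≤-middle (suc k) {N} {X} {C.P} s₂ n (C.P∈𝓒 k)
      in cross-multiply (coverUnit M) (trans
           (sym (quotient F {N} {X} {C.P} n x (C.P∈𝓒 k) C.P∈𝓠 s₂))
           (quotient F {C.N} {X} {P} (C.N∈𝓒 k m) x p P∈𝓠 s₁))
      where module C = Cover M

    Φ-cover : ∀ M m → value F (Cover.P M) (Cover.P∈𝓒 M k) ∙ Φ-value M m ≈
                      value F (Cover.N M) (Cover.N∈𝓒 M k m)
    Φ-cover M m = Φ-defining {C.N} {C.P} {M} (C.N∈𝓒 k m) (C.P∈𝓒 k) m C.P∈𝓠 C.exact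
      where module C = Cover M

    -- For both multiplicative laws the cover of `M` is composed with the map onto the right-hand
    -- term. The kernel `K` of the composite is a syzygy of that term and at the same time presents
    -- the left-hand term, with the syzygy of `M` as kernel.
    Φ : Invariant (suc (suc k))
    Φ = record
      { value = Φ-value
      ; unit = λ {P} p P∈𝓠 → let module C = Cover P in
          unit-∙ (coverUnit P) (unit F {C.N} (C.N∈𝓒 k p) (FinitePd-left C.exact C.P∈𝓠 P∈𝓠))
      ; quotient = λ {M′} {M} {P} m′ m p P∈𝓠 s →
          let module C = Cover M
              K , s₁ , s₂ = kernel-of-composite𝓜 {C.N} {C.P} {M} {M′} {P} C.exact s
              κ = 𝓒≤-left (suc k) {K} {C.P} {P} s₁ (C.P∈𝓒 k) p
          in unit-cancel (coverUnit M) (begin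
            value F C.P _ ∙ Φ-value M m                    ≈⟨ Φ-cover M m ⟩
            value F C.N (C.N∈𝓒 k m)                        ≈⟨ Φ-defining {C.N} {K} {M′} (C.N∈𝓒 k m) κ m′
                                                                (FinitePd-left s₁ C.P∈𝓠 P∈𝓠) s₂ ⟨
            value F K κ ∙ Φ-value M′ m′                    ≈⟨ ∙-congʳ (Φ-defining {K} {C.P} {P} κ (C.P∈𝓒 k) p C.P∈𝓠 s₁) ⟨
            (value F C.P _ ∙ Φ-value P p) ∙ Φ-value M′ m′  ≈⟨ assoc _ _ _ ⟩
            value F C.P _ ∙ (Φ-value P p ∙ Φ-value M′ m′)  ∎)
      ; submodule = λ {P} {M} {M′} p m m′ P∈𝓠 s →
          let module C = Cover M
              module D = Cover P
              K , s₁ , s₂ = kernel-of-composite𝓜 {C.N} {C.P} {M} {P} {M′} C.exact s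
              κ = 𝓒≤-left (suc k) {K} {C.P} {M′} s₁ (C.P∈𝓒 k) m′
              -- `K` presents `P` but is not known to lie in 𝓠, so `Φ-defining` does not apply.
              -- Pulling back along a cover of `P` helps, since that cover has its kernel in 𝓠.
              Y , t₁ , t₂ = pullback𝓜 {C.N} {K} {P} {D.N} {D.P} s₂ D.exact
              y = 𝓒≤-middle (suc k) {C.N} {Y} {D.P} t₁ (C.N∈𝓒 k m) (D.P∈𝓒 k)
              n = C.N∈𝓒 k m
              FN≈ : value F C.N n ≈ Φ-value P p ∙ value F K κ
              FN≈ = unit-cancel (coverUnit P) (begin
                value F D.P _ ∙ value F C.N n                ≈⟨ quotient F {C.N} {Y} {D.P} n y (D.P∈𝓒 k) D.P∈𝓠 t₁ ⟨
                value F Y y                                  ≈⟨ submodule F {D.N} {Y} {K} (D.N∈𝓒 k p) y κ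
                                                                   (FinitePd-left D.exact D.P∈𝓠 P∈𝓠) t₂ ⟩
                value F D.N _ ∙ value F K κ                  ≈⟨ ∙-congʳ (Φ-cover P p) ⟨
                (value F D.P _ ∙ Φ-value P p) ∙ value F K κ  ≈⟨ assoc _ _ _ ⟩
                value F D.P _ ∙ (Φ-value P p ∙ value F K κ)  ∎)
          in unit-cancel (coverUnit M) (begin
            value F C.P _ ∙ Φ-value M m                    ≈⟨ Φ-cover M m ⟩
            value F C.N n                                  ≈⟨ FN≈ ⟩
            Φ-value P p ∙ value F K κ                      ≈⟨ ∙-congˡ (Φ-defining {K} {C.P} {M′} κ (C.P∈𝓒 k) m′ C.P∈𝓠 s₁) ⟨
            Φ-value P p ∙ (value F C.P _ ∙ Φ-value M′ m′)  ≈⟨ x∙yz≈y∙xz _ _ _ ⟩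
            value F C.P _ ∙ (Φ-value P p ∙ Φ-value M′ m′)  ∎)
      }

  open Syzygy using (Φ; Φ-defining; Φ-cover)

  Φ-cong : ∀ {k} (F G : Invariant (suc k)) → (∀ M m → value F M m ≈ value G M m) →
           ∀ M m → value (Φ F) M m ≈ value (Φ G) M m
  Φ-cong {k} F G F≈G M m = unit-cancel (unit F {C.P} (C.P∈𝓒 k) C.P∈𝓠) (begin
    value F C.P _ ∙ value (Φ F) M m  ≈⟨ Φ-cover F M m ⟩
    value F C.N _                    ≈⟨ F≈G C.N _ ⟩
    value G C.N _                    ≈⟨ Φ-cover G M m ⟨
    value G C.P _ ∙ value (Φ G) M m  ≈⟨ ∙-congʳ (F≈G C.P _) ⟨
    value F C.P _ ∙ value (Φ G) M m  ∎)
    where module C = Cover M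

  Φ-restrict : ∀ {k} (F : Invariant (suc (suc k))) → ∀ M m m′ →
               value (Φ F) M m′ ≈ value (Φ (restrict F)) M m
  Φ-restrict {k} F M m m′ = unit-cancel (unit F {C.P} (C.P∈𝓒 (suc k)) C.P∈𝓠) (begin
    value F C.P _ ∙ value (Φ F) M m′                       ≈⟨ Φ-cover F M m′ ⟩
    value F C.N _                                          ≈⟨ irrelevant F {C.N} _ _ ⟩
    value (restrict F) C.N (C.N∈𝓒 k m)                     ≈⟨ Φ-cover (restrict F) M m ⟨
    value (restrict F) C.P _ ∙ value (Φ (restrict F)) M m  ≈⟨ ∙-congʳ (irrelevant F {C.P} _ _) ⟩
    value F C.P _ ∙ value (Φ (restrict F)) M m             ∎)
    where module C = Cover M

  module _ (d : ℕ) (bound : Resolutions.ExtDimensionAtMost (Op.ring R) d) where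

    abstract
      embedding : ∀ M → 𝓒≤ 1 M → ∃ λ (P : 𝓜) → ∃ λ (C : 𝓜) →
                  PdAtMost 1 (mod P) × 𝓒≤ 1 C × 0⟶ M ⟶ P ⟶ C ⟶0
      embedding = Embedding.embed-in-cyclicSum d bound

    module Embed (M : 𝓜) (m : 𝓒≤ 1 M) where
      P C : 𝓜
      P = proj₁ (embedding M m)
      C = proj₁ (proj₂ (embedding M m))
      pd≤1 : PdAtMost 1 (mod P)
      pd≤1 = proj₁ (proj₂ (proj₂ (embedding M m)))
      C∈𝓒 : 𝓒≤ 1 C
      C∈𝓒 = proj₁ (proj₂ (proj₂ (proj₂ (embedding M m))))
      exact : 0⟶ M ⟶ P ⟶ C ⟶0
      exact = proj₂ (proj₂ (proj₂ (proj₂ (embedding M m))))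
      P∈𝓠 : P ∈𝓠
      P∈𝓠 = pd≤1⇒∈𝓠 {P} pd≤1
      P∈𝓒 : 𝓒≤ 1 P
      P∈𝓒 = pd≤1⇒𝓒≤ 0 {P} pd≤1

    -- The downward shift Ψ, through embeddings.

    module Cosyzygy (F : Invariant 1) where

      private
        embedUnit : ∀ M m → IsUnit Ω (value F (Embed.P M m) (Embed.P∈𝓒 M m))
        embedUnit M m = unit F {Embed.P M m} (Embed.P∈𝓒 M m) (Embed.P∈𝓠 M m)

      Ψ-value : ∀ M → 𝓒≤ 1 M → Carrier
      Ψ-value M m = (value F (Embed.P M m) (Embed.P∈𝓒 M m)) ⁻¹[ embedUnit M m ]
                    ∙ value F (Embed.C M m) (Embed.C∈𝓒 M m)

      -- Two embeddings of `M` are compared through their pushout, which is an extension of each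
      -- cokernel by the other overmodule.
      Ψ-defining : ∀ {M P C} m p c → P ∈𝓠 → 0⟶ M ⟶ P ⟶ C ⟶0 →
                   value F P p ∙ Ψ-value M m ≈ value F C c
      Ψ-defining {M} {P} {C} m p c P∈𝓠 s =
        let X , s₁ , s₂ = pushout𝓜 {M} {E.P} {E.C} {P} {C} E.exact s
            x = 𝓒≤-middle 1 {E.P} {X} {C} s₁ E.P∈𝓒 c
        in cross-multiply (embedUnit M m) (trans
             (sym (submodule F {E.P} {X} {C} E.P∈𝓒 x c E.P∈𝓠 s₁))
             (submodule F {P} {X} {E.C} p x E.C∈𝓒 P∈𝓠 s₂))
        where module E = Embed M m

      Ψ-embed : ∀ M m → value F (Embed.P M m) (Embed.P∈𝓒 M m) ∙ Ψ-value M m ≈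
                        value F (Embed.C M m) (Embed.C∈𝓒 M m)
      Ψ-embed M m = Ψ-defining {M} {E.P} {E.C} m E.P∈𝓒 E.C∈𝓒 E.P∈𝓠 E.exact
        where module E = Embed M m

      Ψ-inverse : ∀ {P} p → P ∈𝓠 → value F P p ∙ Ψ-value P p ≈ ε
      Ψ-inverse {P} p P∈𝓠 =
        trans (Ψ-defining {P} {P} {zero𝓜} p p (zero∈𝓒≤ 1) P∈𝓠 (zero-right P)) (zero≈ε F (zero∈𝓒≤ 1))

      -- The cokernel `K` of the left-hand term in `E.P` is an extension of `E.C` by the right-hand
      -- term, so it stays in 𝓒. In `submodule` it also lies in 𝓠 and serves as an overmodule of
      -- `M′`; in `quotient` it contains `P`, whose Ψ-value is inverse to its F-value.
      Ψ : Invariant 1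
      Ψ = record
        { value = Ψ-value
        ; unit = λ {P} p P∈𝓠 → let module E = Embed P p in
            unit-∙ (embedUnit P p) (unit F {E.C} E.C∈𝓒 (FinitePd-right E.exact P∈𝓠 E.P∈𝓠))
        ; quotient = λ {M′} {M} {P} m′ m p P∈𝓠 s →
            let module E = Embed M m
                K , s₁ , s₂ = cokernel-of-composite𝓜 {M} {E.P} {E.C} {M′} {P} E.exact s
                κ = 𝓒≤-middle 1 {P} {K} {E.C} s₂ p E.C∈𝓒
            in unit-cancel (embedUnit M m) (begin
              value F E.P _ ∙ Ψ-value M m                    ≈⟨ Ψ-embed M m ⟩
              value F E.C _                                  ≈⟨ identityˡ _ ⟨
              ε ∙ value F E.C _                              ≈⟨ ∙-congʳ (trans (comm _ _) (Ψ-inverse {P} p P∈𝓠)) ⟨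
              (Ψ-value P p ∙ value F P p) ∙ value F E.C _    ≈⟨ assoc _ _ _ ⟩
              Ψ-value P p ∙ (value F P p ∙ value F E.C _)    ≈⟨ ∙-congˡ (submodule F {P} {K} {E.C} p κ E.C∈𝓒 P∈𝓠 s₂) ⟨
              Ψ-value P p ∙ value F K κ                      ≈⟨ ∙-congˡ (Ψ-defining {M′} {E.P} {K} m′ E.P∈𝓒 κ E.P∈𝓠 s₁) ⟨
              Ψ-value P p ∙ (value F E.P _ ∙ Ψ-value M′ m′)  ≈⟨ x∙yz≈y∙xz _ _ _ ⟩
              value F E.P _ ∙ (Ψ-value P p ∙ Ψ-value M′ m′)  ∎)
        ; submodule = λ {P} {M} {M′} p m m′ P∈𝓠 s →
            let module E = Embed M m
                K , s₁ , s₂ = cokernel-of-composite𝓜 {M} {E.P} {E.C} {P} {M′} E.exact s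
                κ = 𝓒≤-middle 1 {M′} {K} {E.C} s₂ m′ E.C∈𝓒
            in unit-cancel (embedUnit M m) (begin
              value F E.P _ ∙ Ψ-value M m                    ≈⟨ Ψ-embed M m ⟩
              value F E.C _                                  ≈⟨ Ψ-defining {M′} {K} {E.C} m′ κ E.C∈𝓒
                                                                  (FinitePd-right s₁ P∈𝓠 E.P∈𝓠) s₂ ⟨
              value F K κ ∙ Ψ-value M′ m′                    ≈⟨ ∙-congʳ (Ψ-defining {P} {E.P} {K} p E.P∈𝓒 κ E.P∈𝓠 s₁) ⟨
              (value F E.P _ ∙ Ψ-value P p) ∙ Ψ-value M′ m′  ≈⟨ assoc _ _ _ ⟩
              value F E.P _ ∙ (Ψ-value P p ∙ Ψ-value M′ m′)  ∎)
        }

      -- The cover of `M` is also an embedding of its syzygy with cokernel `M`, so the defining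
      -- equation of `Ψ` on that sequence returns the value of `F` at `M`.
      ΦΨ≈ : ∀ M m m′ → value (Φ Ψ) M m′ ≈ value F M m
      ΦΨ≈ M m m′ = begin
        value (Φ Ψ) M m′                                    ≈⟨ identityˡ _ ⟨
        ε ∙ value (Φ Ψ) M m′                                ≈⟨ ∙-congʳ (Ψ-inverse {C.P} (C.P∈𝓒 0) C.P∈𝓠) ⟨
        (value F C.P _ ∙ Ψ-value C.P _) ∙ value (Φ Ψ) M m′  ≈⟨ assoc _ _ _ ⟩
        value F C.P _ ∙ (Ψ-value C.P _ ∙ value (Φ Ψ) M m′)  ≈⟨ ∙-congˡ (Φ-cover Ψ M m′) ⟩
        value F C.P _ ∙ Ψ-value C.N _                       ≈⟨ Ψ-defining {C.N} {C.P} {M} (C.N∈𝓒 0 m′) (C.P∈𝓒 0) m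
                                                                 C.P∈𝓠 C.exact ⟩
        value F M m                                         ∎
        where module C = Cover M

    open Cosyzygy using (Ψ; ΦΨ≈)

    module _ (F : Invariant 1) where

      -- All shifts are first built on 𝓒 alone, where the restriction of `Φ` and `Ψ` can be
      -- iterated; the bound on pd⋆ is raised afterwards.
      shifted : ℤ → Invariant 1
      shifted (+ zero)       = F
      shifted (+ suc n)      = restrict (Φ (shifted (+ n)))
      shifted (-[1+ zero ])  = Ψ F
      shifted (-[1+ suc n ]) = Ψ (shifted (-[1+ n ]))

      Φ-shifted : ∀ n M m m′ → value (Φ (shifted (n ℤ.- 1ℤ))) M m′ ≈ value (shifted n) M m
      Φ-shifted (+ zero)     M m m′ = ΦΨ≈ F M m m′
      Φ-shifted (+ suc n)    M m m′ = irrelevant (Φ (shifted (+ n))) {M} _ _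
      -- The index `-[1+ n ] ℤ.- 1ℤ` reduces only to `-[1+ suc (n ℕ.+ 0) ]`, hence the transport.
      Φ-shifted (-[1+ n ]) M m m′ = ≡.subst
        (λ k → value (Φ (shifted -[1+ suc k ])) M m′ ≈ value (shifted -[1+ n ]) M m)
        (≡.sym (ℕ.+-identityʳ n)) (ΦΨ≈ (shifted -[1+ n ]) M m m′)

      -- The n-th shift of F on the class pd⋆ ≤ j + 1.
      extended : ∀ j → ℤ → Invariant (suc j)
      extended zero    n = shifted n
      extended (suc j) n = Φ (extended j (n ℤ.- 1ℤ))

      -- Enlarging the class changes no value: the base case is that `Φ` raises each shift to the
      -- next, and the induction uses that `Φ` commutes with restriction.
      extended-suc : ∀ j n M m m′ → value (extended (suc j) n) M m′ ≈ value (extended j n) M m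
      extended-suc zero    n M m m′ = Φ-shifted n M m m′
      extended-suc (suc j) n M m m′ = trans
        (Φ-restrict (extended (suc j) (n ℤ.- 1ℤ)) M m m′)
        (Φ-cong (restrict (extended (suc j) (n ℤ.- 1ℤ))) (extended j (n ℤ.- 1ℤ))
          (λ N v → extended-suc j (n ℤ.- 1ℤ) N v (𝓒≤-suc {suc j} {N} v)) M m)

      extended-𝓒 : ∀ j n M (m : 𝓒≤ 1 M) m′ → value (extended j n) M m′ ≈ value (shifted n) M m
      extended-𝓒 zero    n M m m′ = irrelevant (shifted n) {M} m′ m
      extended-𝓒 (suc j) n M m m′ =
        trans (extended-suc j n M (weaken j) m′) (extended-𝓒 j n M m (weaken j))
        where
        weaken : ∀ j → 𝓒≤ (suc j) M
        weaken zero    = m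
        weaken (suc j) = 𝓒≤-suc {suc j} {M} (weaken j)

  to𝓒 : ∀ M → 𝓒≤ 1 M → 𝓒
  to𝓒 M m = record { obj = M ; pd⋆≤1 = ExtVanishesFrom⇒pd⋆ 1 m }

  module _ {𝓕 : 𝓒 → Carrier} (isQuasiFitting : IsQuasiFitting Ω 𝓕) where

    private module 𝓕 = IsQuasiFitting isQuasiFitting

    𝓠∩𝓒⊆𝓟 : ∀ {P} → P ∈𝓠 → 𝓒≤ 1 P → P ∈𝓟
    𝓠∩𝓒⊆𝓟 {P} P∈𝓠 p = PdAtMost⇒pd 1
      (finite-pd⇒pd≤1 (proj₁ noetherian) (𝓜.finitelyGenerated P) P∈𝓠 p)

    fromQuasiFitting : Invariant 1
    fromQuasiFitting = record
      { value = λ M m → 𝓕 (to𝓒 M m)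
      ; unit = λ {P} p P∈𝓠 → 𝓕.unit (to𝓒 P p) (𝓠∩𝓒⊆𝓟 {P} P∈𝓠 p)
      ; quotient = λ {M′} {M} {P} m′ m p P∈𝓠 s →
          𝓕.quotient {to𝓒 M′ m′} {to𝓒 M m} {to𝓒 P p} (𝓠∩𝓒⊆𝓟 {P} P∈𝓠 p) s
      ; submodule = λ {P} {M} {M′} p m m′ P∈𝓠 s →
          𝓕.submodule {to𝓒 P p} {to𝓒 M m} {to𝓒 M′ m′} (𝓠∩𝓒⊆𝓟 {P} P∈𝓠 p) s
      }

    -- An object of 𝓒 contains its own proof of pd⋆ ≤ 1, while `to𝓒` supplies another; the axiom
    -- (ii) with zero quotient identifies the two values.
    fromQuasiFitting≈ : ∀ C m → value fromQuasiFitting (obj C) m ≈ 𝓕 C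
    fromQuasiFitting≈ C m = sym (begin
      𝓕 C                            ≈⟨ 𝓕.quotient {to𝓒 M m} {C} {to𝓒 zero𝓜 z}
                                          (𝓠∩𝓒⊆𝓟 {zero𝓜} zero∈𝓠 z) (zero-right M) ⟩
      value F zero𝓜 z ∙ value F M m  ≈⟨ ∙-congʳ (zero≈ε F z) ⟩
      ε ∙ value F M m                ≈⟨ identityˡ _ ⟩
      value F M m                    ∎)
      where
      F = fromQuasiFitting
      M = obj C
      z = zero∈𝓒≤ 1

  -- Uniqueness of the shifted family.

  module ShiftedFamilyProperties {𝓕 : 𝓒 → Carrier} {G : ℤ → 𝓜 → Carrier}
    (isFamily : IsShiftedFamily Ω 𝓕 G) where

    open IsShiftedFamily isFamily public renaming (unit to family-unit; submodule to family-submodule)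

    inverse : ∀ {P} → P ∈𝓠 → ∀ n → G (n ℤ.- 1ℤ) P ∙ G n P ≈ ε
    inverse {P} P∈𝓠 n = trans (comm _ _) (trans (sym (shift {P} {P} {zero𝓜} P∈𝓠 (zero-right P) n))
      (sym (unit-cancel (family-unit {zero𝓜} zero∈𝓠 n)
        (trans (identityʳ _) (family-submodule {zero𝓜} {zero𝓜} {zero𝓜} zero∈𝓠 (zero-left zero𝓜) n)))))

  module Uniqueness (d : ℕ)
    (boundˡ : ∀ (M : 𝓜) → 𝓒≤ (suc d) M)
    (boundʳ : Resolutions.ExtDimensionAtMost (Op.ring R) d)
    {𝓕 : 𝓒 → Carrier} {G H : ℤ → 𝓜 → Carrier}
    (isFamilyG : IsShiftedFamily Ω 𝓕 G) (isFamilyH : IsShiftedFamily Ω 𝓕 H) where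

    private
      module G = ShiftedFamilyProperties isFamilyG
      module H = ShiftedFamilyProperties isFamilyH

    Agree : ℤ → 𝓜 → Set e
    Agree n M = G n M ≈ H n M

    -- Agreement on `P` is needed at `n` but assumed only at `n ℤ.- 1ℤ`; it carries over because the
    -- two values of `P` are inverse to each other.
    agree-up : ∀ n M → Agree (n ℤ.- 1ℤ) (Cover.P M) → Agree (n ℤ.- 1ℤ) (Cover.N M) → Agree n M
    agree-up n M atP atN = begin
      G n M                       ≈⟨ G.shift {C.N} {C.P} {M} C.P∈𝓠 C.exact n ⟩
      G n C.P ∙ G (n ℤ.- 1ℤ) C.N  ≈⟨ ∙-cong G≈H atN ⟩
      H n C.P ∙ H (n ℤ.- 1ℤ) C.N  ≈⟨ H.shift {C.N} {C.P} {M} C.P∈𝓠 C.exact n ⟨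
      H n M                       ∎
      where
      module C = Cover M
      G≈H : G n C.P ≈ H n C.P
      G≈H = unit-cancel (G.family-unit {C.P} C.P∈𝓠 (n ℤ.- 1ℤ)) (trans (G.inverse {C.P} C.P∈𝓠 n)
        (trans (sym (H.inverse {C.P} C.P∈𝓠 n)) (∙-congʳ (sym atP))))

    agree-down : ∀ n {M P C} → P ∈𝓠 → 0⟶ M ⟶ P ⟶ C ⟶0 → Agree n P → Agree n C → Agree (n ℤ.- 1ℤ) M
    agree-down n {M} {P} {C} P∈𝓠 s atP atC = unit-cancel (G.family-unit {P} P∈𝓠 n) (begin
      G n P ∙ G (n ℤ.- 1ℤ) M  ≈⟨ G.shift {M} {P} {C} P∈𝓠 s n ⟨
      G n C                   ≈⟨ atC ⟩
      H n C                   ≈⟨ H.shift {M} {P} {C} P∈𝓠 s n ⟩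
      H n P ∙ H (n ℤ.- 1ℤ) M  ≈⟨ ∙-congʳ atP ⟨
      G n P ∙ H (n ℤ.- 1ℤ) M  ∎)

    agree-𝓒 : ∀ n M → 𝓒≤ 1 M → Agree n M
    agree-𝓒 (+ zero) M m = trans (G.extends (to𝓒 M m)) (sym (H.extends (to𝓒 M m)))
    agree-𝓒 (+ suc n) M m = agree-up (+ suc n) M (agree-𝓒 (+ n) C.P (C.P∈𝓒 0))
      (agree-𝓒 (+ n) C.N (C.N∈𝓒 0 (𝓒≤-suc {1} {M} m)))
      where module C = Cover M
    agree-𝓒 -[1+ zero ] M m = agree-down (+ 0) {M} {E.P} {E.C} E.P∈𝓠 E.exact
      (agree-𝓒 (+ 0) E.P E.P∈𝓒) (agree-𝓒 (+ 0) E.C E.C∈𝓒)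
      where module E = Embed d boundʳ M m
    agree-𝓒 -[1+ suc n ] M m = ≡.subst (λ k → Agree -[1+ suc k ] M) (ℕ.+-identityʳ n)
      (agree-down -[1+ n ] {M} {E.P} {E.C} E.P∈𝓠 E.exact
        (agree-𝓒 -[1+ n ] E.P E.P∈𝓒) (agree-𝓒 -[1+ n ] E.C E.C∈𝓒))
      where module E = Embed d boundʳ M m

    -- A cover lowers both the bound on pd⋆ and the shift by one; as `agree-𝓒` holds for every
    -- shift, the induction runs on the bound alone.
    agree-𝓒≤ : ∀ j n M → 𝓒≤ (suc j) M → Agree n M
    agree-𝓒≤ zero    n M m = agree-𝓒 n M m
    agree-𝓒≤ (suc j) n M m = agree-up n M (agree-𝓒≤ j (n ℤ.- 1ℤ) C.P (C.P∈𝓒 j))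
      (agree-𝓒≤ j (n ℤ.- 1ℤ) C.N (C.N∈𝓒 j m))
      where module C = Cover M

    agree : ∀ n M → Agree n M
    agree n M = agree-𝓒≤ d n M (boundˡ M)

  -- Existence of the shifted family.

  module Existence (d : ℕ)
    (boundˡ : ∀ (M : 𝓜) → 𝓒≤ (suc d) M)
    (boundʳ : Resolutions.ExtDimensionAtMost (Op.ring R) d)
    {𝓕 : 𝓒 → Carrier} (isQuasiFitting : IsQuasiFitting Ω 𝓕) where

    private
      F : Invariant 1
      F = fromQuasiFitting isQuasiFitting

      𝓖 : ℤ → Invariant (suc d)
      𝓖 = extended d boundʳ F d

    family : ℤ → 𝓜 → Carrier
    family n M = value (𝓖 n) M (boundˡ M)

    -- `Φ` leads to the class of the next bound, but `boundˡ` already puts all of 𝓜 into the smaller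
    -- one, so on 𝓜 the family is closed under `Φ`. The shift property is derived from this.
    Φ-family : ∀ n M → value (Φ (𝓖 (n ℤ.- 1ℤ))) M (𝓒≤-suc {suc d} {M} (boundˡ M)) ≈ family n M
    Φ-family n M = extended-suc d boundʳ F d n M (boundˡ M) (𝓒≤-suc {suc d} {M} (boundˡ M))

    family-defining : ∀ {N P M} → P ∈𝓠 → 0⟶ N ⟶ P ⟶ M ⟶0 → ∀ n →
                      family (n ℤ.- 1ℤ) P ∙ family n M ≈ family (n ℤ.- 1ℤ) N
    family-defining {N} {P} {M} P∈𝓠 s n = trans (∙-congˡ (sym (Φ-family n M)))
      (Φ-defining (𝓖 (n ℤ.- 1ℤ)) {N} {P} {M} (boundˡ N) (boundˡ P) (𝓒≤-suc {suc d} {M} (boundˡ M)) P∈𝓠 s)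

    family-inverse : ∀ {P} → P ∈𝓠 → ∀ n → family (n ℤ.- 1ℤ) P ∙ family n P ≈ ε
    family-inverse {P} P∈𝓠 n = trans (family-defining {zero𝓜} {P} {P} P∈𝓠 (zero-left P) n)
      (zero≈ε (𝓖 (n ℤ.- 1ℤ)) (boundˡ zero𝓜))

    family-shift : ∀ {N P M} → P ∈𝓠 → 0⟶ N ⟶ P ⟶ M ⟶0 → ∀ n →
                   family n M ≈ family n P ∙ family (n ℤ.- 1ℤ) N
    family-shift {N} {P} {M} P∈𝓠 s n = begin
      family n M                                       ≈⟨ identityˡ _ ⟨
      ε ∙ family n M                                   ≈⟨ ∙-congʳ (family-inverse {P} P∈𝓠 n) ⟨
      (family (n ℤ.- 1ℤ) P ∙ family n P) ∙ family n M  ≈⟨ ∙-congʳ (comm _ _) ⟩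
      (family n P ∙ family (n ℤ.- 1ℤ) P) ∙ family n M  ≈⟨ assoc _ _ _ ⟩
      family n P ∙ (family (n ℤ.- 1ℤ) P ∙ family n M)  ≈⟨ ∙-congˡ (family-defining {N} {P} {M} P∈𝓠 s n) ⟩
      family n P ∙ family (n ℤ.- 1ℤ) N                 ∎

    isShiftedFamily : IsShiftedFamily Ω 𝓕 family
    isShiftedFamily = record
      { extends = λ C → let m = pd⋆⇒ExtVanishesFrom 1 (𝓒.pd⋆≤1 C) in
          trans (extended-𝓒 d boundʳ F d 0ℤ (obj C) m (boundˡ (obj C)))
                (fromQuasiFitting≈ isQuasiFitting C m)
      ; unit = λ {P} P∈𝓠 n → unit (𝓖 n) {P} (boundˡ P) P∈𝓠
      ; shift = λ {N} {P} {M} → family-shift {N} {P} {M}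
      ; quotient = λ {M′} {M} {P} P∈𝓠 s n →
          quotient (𝓖 n) {M′} {M} {P} (boundˡ M′) (boundˡ M) (boundˡ P) P∈𝓠 s
      ; submodule = λ {P} {M} {M′} P∈𝓠 s n →
          submodule (𝓖 n) {P} {M} {M′} (boundˡ P) (boundˡ M) (boundˡ M′) P∈𝓠 s
      }

-- The given bound is an integer, possibly negative; its absolute value is a bound in ℕ, as the
-- inductive notions require.
pd⋆-bound : ∀ {ℓ} (R : Ring ℓ ℓ) (d : ℤ) {M} → Homological.pd⋆_≤_ R M d →
            ∀ k → ℤ.∣ d ∣ ℕ.≤ k → Resolutions.ExtVanishesFrom R k M
pd⋆-bound R d z k d≤k = Resolutions.pd⋆⇒ExtVanishesFrom R k
  λ i k<i → z i (ℤ.≤-<-trans (ℤ.≤-trans (i≤∣i∣ d) (ℤ.+≤+ d≤k)) k<i)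

theorem3p20 : ∀ {ℓ a e : Level}
    (R : Ring ℓ ℓ) → Noetherian R →
    (S : Pred (Ring.Carrier R) ℓ) → IsOreSet R S →
    (d : ℤ) → BoundedBy R d →
    let open Fitting R S in
    (Ω : CommutativeMonoid a e) →
    let open CommutativeMonoid Ω in
    (𝓕 : 𝓒 → Carrier) → IsQuasiFitting Ω 𝓕 →
    ∃! (λ (𝓖 𝓗 : ℤ → 𝓜 → Carrier) → ∀ n M → 𝓖 n M ≈ 𝓗 n M)
    (IsShiftedFamily Ω 𝓕)
theorem3p20 R noetherian S ore d (boundˡ , boundʳ) Ω 𝓕 isQuasiFitting =
  family , isShiftedFamily , Uniqueness.agree ∣d∣ boundedˡ boundedʳ isShiftedFamily
  where
  open Invariants R noetherian S ore Ω
  open Fitting R S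
  ∣d∣ = ℤ.∣ d ∣
  -- The successor is needed because `extended` starts at 𝓒, the class of bound 1, and raises it
  -- `∣d∣` times.
  boundedˡ : ∀ (M : 𝓜) → 𝓒≤ (suc ∣d∣) M
  boundedˡ M = pd⋆-bound R d (boundˡ (mod M) (𝓜.finitelyGenerated M)) (suc ∣d∣) (ℕ.n≤1+n _)
  boundedʳ : Resolutions.ExtDimensionAtMost (Op.ring R) ∣d∣
  boundedʳ M fg = pd⋆-bound (Op.ring R) d (boundʳ M fg) ∣d∣ ℕ.≤-refl
  open Existence ∣d∣ boundedˡ boundedʳ isQuasiFitting
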